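{- Let $(P_1,e_1),\dots,(P_\ell,e_\ell)$ be friendly tree patterns with $P_i\in\mathcal{T}_{k_i}$ for $i\in[\ell]$, and let $n\ge1$. Then Algorithm H visits every binary tree from $\mathcal{T}_n((P_1,e_1),\dots,(P_\ell,e_\ell))$ exactly once, in the same order as Algorithm S (initialized with the right path), in time $O(n^2\sum_{i=1}^\ell k_i^2)$ per binary tree.
   Context: $\mathcal{T}_n$ is the set of binary trees on $n$ vertices labeled $1,\dots,n$ by the search tree property. $c_L(i),c_R(i),p(i)$: left child, right child, parent ($\varepsilon$ if nonexistent); $r(T)$ root; $L(i),R(i)$ subtrees rooted at $c_L(i),c_R(i)$. $B_R(i)=\{i,c_R(i),c_R^2(i),\dots\}$; $B_R^-(i)$ is $B_R(i)$ minus its last vertex. Tree pattern $(P,e)$: $P\in\mathcal{T}_k$, $e\colon[k]\setminus\{r(P)\}\to\{0,1\}$. $T$ contains $(P,e)$ if there is an injection $f\colon[k]\to[n]$ such that for every non-root $i$ of $P$: if $e(i)=1$, $f(i)$ is the left (resp. right) child of $f(p(i))$ when $i$ is the left (resp. right) child of $p(i)$; if $e(i)=0$, $f(i)\in L(f(p(i)))$ (resp. $R(f(p(i)))$) accordingly. $\mathcal{T}_n((P_1,e_1),\dots,(P_\ell,e_\ell))$: trees avoiding all patterns. $(P,e)$ is friendly if (i) $p(k)\ne\varepsilon$ and $c_L(k)\ne\varepsilon$; (ii) $e(j)=0$ for all $j\in B_R^-(r(P))\setminus\{r(P)\}$; (iii) $e(k)=1$ implies $e(c_L(k))=0$. Rotations: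 if $j=c_R(p(j))$, the up-rotation of $j$ (with $i=p(j)$, $Y=L(j)$) puts $j$ in place of $i$ as child of $p(i)$, makes $i$ the left child of $j$ and $Y$ the right subtree of $i$; the down-rotation of $j$ is its inverse (defined iff $c_L(j)\ne\varepsilon$). An up/down-slide of $j$ by $d$ steps is $d$ consecutive up/down-rotations of $j$. For $\mathcal{L}_n\subseteq\mathcal{T}_n$, a slide into $\mathcal{L}_n$ is minimal if every slide of the same vertex in the same direction by fewer steps produces a tree outside $\mathcal{L}_n$. Algorithm S (on $\mathcal{L}_n$, initial tree $T_0$): visit $T_0$; then repeatedly generate an unvisited tree of $\mathcal{L}_n$ by a minimal slide of the largest possible vertex in the most recently visited tree, terminating if none exists or the direction is ambiguous. Algorithm H (on $\mathcal{L}_n=\mathcal{T}_n((P_1,e_1),\dots,(P_\ell,e_\ell))$, with arrays $o=(o_1,\dots,o_n)$ of directions in $\{\uparrow,\downarrow\}$ and $s=(s_1,\dots,s_n)$): H1. Set $T$ to the right path, $o_j\gets\uparrow$, $s_j\gets j$ for $j=1,\dots,n$. H2. Visit $T$. H3. Set $j\gets s_n$; terminate if $j=1$. H4. Perform in $T$ a slide of $j$ that is minimal w.r.t. $\mathcal{L}_n$, upward if $o_j=\uparrow$ and downward if $o_j=\downarrow$. H5. Set $s_n\gets n$. If $o_j=\uparrow$ and $j$ is the root or $p(j)>j$, set $o_j\gets\downarrow$; or if $o_j=\downarrow$ and $j$ has no left child, set $o_j\gets\uparrow$; in both of these cases set $s_j\gets s_{j-1}$ and $s_{j-1}\gets j-1$.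 Go to H2. -}

module Defs where

open import Data.Bool using (Bool; true; false; if_then_else_; _∧_)
open import Data.Fin using (toℕ)
open import Data.List using (List; []; _∷_; [_]; _++_; _∷ʳ_; map; sum; length; lookup)
open import Data.List.Membership.Propositional using (_∈_; _∉_)
open import Data.List.Relation.Binary.Pointwise using (Pointwise)
open import Data.List.Relation.Unary.All using (All)
open import Data.Maybe using (Maybe; just; nothing; fromMaybe)
open import Data.Nat using (ℕ; zero; suc; _+_; _∸_; _*_; _^_; _≤_; _<_; _>_; _≡ᵇ_; _<ᵇ_)
open import Data.Nat.Properties using (<-cmp)
open import Data.Product using (∃; _×_; _,_; proj₁; proj₂)
open import Data.Sum using (_⊎_)
open import Data.Unit using (⊤)
open import Function.Bundles using (_⇔_)
open import Relation.Binary.Definitions using (tri<; tri≈; tri>)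
open import Relation.Binary.PropositionalEquality using (_≡_; _≢_)
open import Relation.Nullary using (¬_)

data Tree : Set where
  ε    : Tree
  node : (l : Tree) (i : ℕ) (r : Tree) → Tree

vertices : Tree → List ℕ
vertices ε            = []
vertices (node l i r) = vertices l ++ i ∷ vertices r

_∈[_] : ℕ → ℕ → Set
i ∈[ n ] = 1 ≤ i × i ≤ n

SearchTree : Tree → Set
SearchTree ε            = ⊤
SearchTree (node l i r) =
  All (_< i) (vertices l) × All (i <_) (vertices r) × SearchTree l × SearchTree r

-- The search tree property makes the labels distinct, so such a tree has
-- exactly n vertices.
_∈𝒯_ : Tree → ℕ → Set
T ∈𝒯 n = SearchTree T × (∀ i → i ∈ vertices T ⇔ i ∈[ n ])

root : Tree → Maybe ℕ
root ε            = nothing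
root (node _ i _) = just i

left right : Tree → Tree
left ε             = ε
left (node l _ _)  = l
right ε            = ε
right (node _ _ r) = r

-- The subtree rooted at i, located by binary search; ε if i is not a vertex.
subtree : Tree → ℕ → Tree
subtree ε            i = ε
subtree (node l x r) i with <-cmp i x
... | tri< _ _ _ = subtree l i
... | tri≈ _ _ _ = node l x r
... | tri> _ _ _ = subtree r i

L R : Tree → ℕ → Tree
L T i = left  (subtree T i)
R T i = right (subtree T i)

cL cR : Tree → ℕ → Maybe ℕ
cL T i = root (L T i)
cR T i = root (R T i)

-- Parent T i j means p(j) = i.
Parent : Tree → ℕ → ℕ → Set
Parent T i j = cL T i ≡ just j ⊎ cR T i ≡ just j

data B-R (T : Tree) (i : ℕ) : ℕ → Set where
  here : B-R T i i
  next : ∀ {j j′} → B-R T i j → cR T j ≡ just j′ → B-R T i j′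

-- The last vertex of the branch is the one without a right child.
B-R⁻ : Tree → ℕ → ℕ → Set
B-R⁻ T i j = B-R T i j × cR T j ≢ nothing

rightPathFrom : ℕ → ℕ → Tree
rightPathFrom a zero    = ε
rightPathFrom a (suc m) = node ε a (rightPathFrom (suc a) m)

rightPath : ℕ → Tree
rightPath n = rightPathFrom 1 n

-- Only the values of e on [k] ∖ {r(P)} are ever used; true stands for 1.
record Pattern : Set where
  field
    k    : ℕ
    P    : Tree
    P∈𝒯k : P ∈𝒯 k
    e    : ℕ → Bool

open Pattern public

-- Non-root vertices j of P are enumerated as children of i = p(j).
record Contains (n : ℕ) (T : Tree) (p : Pattern) : Set where
  field
    f         : ℕ → ℕ
    f-range   : ∀ {i} → i ∈[ k p ] → f i ∈[ n ]
    injective : ∀ {i j} → i ∈[ k p ] → j ∈[ k p ] → f i ≡ f j → i ≡ j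
    left-1    : ∀ {i j} → cL (P p) i ≡ just j → e p j ≡ true  → cL T (f i) ≡ just (f j)
    left-0    : ∀ {i j} → cL (P p) i ≡ just j → e p j ≡ false → f j ∈ vertices (L T (f i))
    right-1   : ∀ {i j} → cR (P p) i ≡ just j → e p j ≡ true  → cR T (f i) ≡ just (f j)
    right-0   : ∀ {i j} → cR (P p) i ≡ just j → e p j ≡ false → f j ∈ vertices (R T (f i))

Language : Set₁
Language = Tree → Set

𝒯 : ℕ → List Pattern → Language
𝒯 n ps T = T ∈𝒯 n × All (λ p → ¬ Contains n T p) ps

record Friendly (p : Pattern) : Set where
  field
    k-has-parent     : ∃ λ i → Parent (P p) i (k p)
    k-has-left-child : cL (P p) (k p) ≢ nothing
    branch           : ∀ {r j} → root (P p) ≡ just r → B-R⁻ (P p) r j → j ≢ r → e p j ≡ false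
    k-edges          : ∀ {c} → cL (P p) (k p) ≡ just c → e p (k p) ≡ true → e p c ≡ false

data Direction : Set where
  ↑ ↓ : Direction

opposite : Direction → Direction
opposite ↑ = ↓
opposite ↓ = ↑

data UpRotation (j : ℕ) : Tree → Tree → Set where
  here : ∀ {X i Y Z} → UpRotation j (node X i (node Y j Z)) (node (node X i Y) j Z)
  inˡ  : ∀ {l l′ x r} → UpRotation j l l′ → UpRotation j (node l x r) (node l′ x r)
  inʳ  : ∀ {l x r r′} → UpRotation j r r′ → UpRotation j (node l x r) (node l x r′)

Rotation : Direction → ℕ → Tree → Tree → Set
Rotation ↑ j T T′ = UpRotation j T T′
Rotation ↓ j T T′ = UpRotation j T′ T

data Slide (δ : Direction) (j : ℕ) : ℕ → Tree → Tree → Set where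
  done : ∀ {T} → Slide δ j 0 T T
  _◅_  : ∀ {d T T′ T″} → Rotation δ j T T′ → Slide δ j d T′ T″ → Slide δ j (suc d) T T″

MinimalSlide : Language → Direction → ℕ → Tree → Tree → Set
MinimalSlide 𝓛 δ j T T′ = ∃ λ d →
  1 ≤ d × Slide δ j d T T′ × 𝓛 T′ ×
  (∀ d′ T″ → 1 ≤ d′ → d′ < d → Slide δ j d′ T T″ → ¬ 𝓛 T″)

module AlgorithmS (𝓛 : Language) where

  NewSlide : List Tree → Direction → ℕ → Tree → Tree → Set
  NewSlide visited δ j T T′ = MinimalSlide 𝓛 δ j T T′ × T′ ∉ visited

  NoneAbove : List Tree → ℕ → Tree → Set
  NoneAbove visited j T = ∀ j′ → j < j′ → ∀ δ T′ → ¬ NewSlide visited δ j′ T T′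

  -- RunFrom visited T Ts: having visited the trees in the list `visited`, of
  -- which T is the most recent, the trees visited from T on, T included, are
  -- Ts.
  data RunFrom (visited : List Tree) (T : Tree) : List Tree → Set where
    none      : (∀ δ j T′ → ¬ NewSlide visited δ j T T′) → RunFrom visited T [ T ]
    ambiguous : ∀ {j T↑ T↓} → NoneAbove visited j T →
                NewSlide visited ↑ j T T↑ → NewSlide visited ↓ j T T↓ →
                RunFrom visited T [ T ]
    slide     : ∀ {δ j T′ Ts} → NoneAbove visited j T →
                NewSlide visited δ j T T′ →
                (∀ T″ → ¬ NewSlide visited (opposite δ) j T T″) →
                RunFrom (T′ ∷ visited) T′ Ts →
                RunFrom visited T (T ∷ Ts)

  Run : Tree → List Tree → Set
  Run T₀ Ts = RunFrom [ T₀ ] T₀ Ts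

_[_↦_] : ∀ {A : Set} → (ℕ → A) → ℕ → A → (ℕ → A)
(a [ i ↦ v ]) j = if j ≡ᵇ i then v else a j

record HState : Set where
  constructor ⟨_,_,_⟩
  field
    tree : Tree
    o    : ℕ → Direction
    s    : ℕ → ℕ

open HState public

module AlgorithmH (𝓛 : Language) (n : ℕ) where

  H1 : HState
  H1 = ⟨ rightPath n , (λ _ → ↑) , (λ j → j) ⟩

  -- The condition for reversing o_j; T is the tree after the slide.
  Turn : Direction → ℕ → Tree → Set
  Turn ↑ j T = root T ≡ just j ⊎ ∃ λ i → Parent T i j × i > j
  Turn ↓ j T = cL T j ≡ nothing

  -- The assignments s_j ← s_{j-1}, s_{j-1} ← j-1, in this order.
  turn-s : ℕ → (ℕ → ℕ) → (ℕ → ℕ)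
  turn-s j s = (s [ j ↦ s (j ∸ 1) ]) [ (j ∸ 1) ↦ (j ∸ 1) ]

  data Step : HState → HState → Set where
    turn : ∀ {T T′ o s} → let j = s n in
           j ≢ 1 → MinimalSlide 𝓛 (o j) j T T′ → Turn (o j) j T′ →
           Step ⟨ T , o , s ⟩
                ⟨ T′ , o [ j ↦ opposite (o j) ] , turn-s j (s [ n ↦ n ]) ⟩
    keep : ∀ {T T′ o s} → let j = s n in
           j ≢ 1 → MinimalSlide 𝓛 (o j) j T T′ → ¬ Turn (o j) j T′ →
           Step ⟨ T , o , s ⟩ ⟨ T′ , o , s [ n ↦ n ] ⟩

  -- The states at the visits, up to termination.
  data RunFrom : HState → List HState → Set where
    halt : ∀ {σ} → s σ n ≡ 1 → RunFrom σ [ σ ]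
    _◅_  : ∀ {σ σ′ σs} → Step σ σ′ → RunFrom σ′ σs → RunFrom σ (σ ∷ σs)

  Run : List HState → Set
  Run σs = RunFrom H1 σs

-- Running time is measured on a random access machine with unit-cost
-- operations, programmed in a while-language.  A memory cell is addressed by
-- the name of an array and two indices.  One-dimensional arrays and scalars
-- use index 0 for the missing ones.
Memory : Set
Memory = ℕ → ℕ → ℕ → ℕ

write : Memory → ℕ → ℕ → ℕ → ℕ → Memory
write μ a i j v a′ i′ j′ =
  if (a′ ≡ᵇ a) ∧ (i′ ≡ᵇ i) ∧ (j′ ≡ᵇ j) then v else μ a′ i′ j′

-- There is deliberately no multiplication, so that the numbers computed in t
-- operations have O(t) more bits than those in the input.
data Expr : Set where
  lit                     : ℕ → Expr
  read                    : (a : ℕ) (i j : Expr) → Expr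
  _⊕_ _⊖_ _equals_ _less_ : Expr → Expr → Expr

data Program : Set where
  skip visit : Program
  assign     : (a : ℕ) (i j v : Expr) → Program
  _⨾_        : Program → Program → Program
  ifnz       : Expr → Program → Program → Program
  while      : Expr → Program → Program

bit : Bool → ℕ
bit false = 0
bit true  = 1

eval : Expr → Memory → ℕ
eval (lit c)      μ = c
eval (read a i j) μ = μ a (eval i μ) (eval j μ)
eval (x ⊕ y)      μ = eval x μ + eval y μ
eval (x ⊖ y)      μ = eval x μ ∸ eval y μ
eval (x equals y) μ = bit (eval x μ ≡ᵇ eval y μ)
eval (x less y)   μ = bit (eval x μ <ᵇ eval y μ)

cost : Expr → ℕ
cost (lit c)      = 1
cost (read a i j) = 1 + cost i + cost j
cost (x ⊕ y)      = 1 + cost x + cost y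
cost (x ⊖ y)      = 1 + cost x + cost y
cost (x equals y) = 1 + cost x + cost y
cost (x less y)   = 1 + cost x + cost y

-- The clock counts the operations since the last visit (or since the start).
-- The log holds, in chronological order, the clock and the memory contents
-- at each visit.
record Config : Set where
  constructor config
  field
    memory : Memory
    clock  : ℕ
    log    : List (ℕ × Memory)

open Config public

start : Memory → Config
start μ = config μ 0 []

tick : ℕ → Config → Config
tick c (config μ t ℓ) = config μ (c + t) ℓ

data _/_⇓_ : Program → Config → Config → Set where
  skip   : ∀ {κ} → skip / κ ⇓ tick 1 κ
  visit  : ∀ {μ t ℓ} → visit / config μ t ℓ ⇓ config μ 0 (ℓ ∷ʳ (suc t , μ))
  assign : ∀ {a i j v μ t ℓ} →
           assign a i j v / config μ t ℓ
             ⇓ config (write μ a (eval i μ) (eval j μ) (eval v μ))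
                      (1 + cost i + cost j + cost v + t) ℓ
  seq    : ∀ {c₁ c₂ κ₀ κ₁ κ₂} → c₁ / κ₀ ⇓ κ₁ → c₂ / κ₁ ⇓ κ₂ → (c₁ ⨾ c₂) / κ₀ ⇓ κ₂
  if-yes : ∀ {b c₁ c₂ κ κ′} → eval b (memory κ) ≢ 0 →
           c₁ / tick (1 + cost b) κ ⇓ κ′ → ifnz b c₁ c₂ / κ ⇓ κ′
  if-no  : ∀ {b c₁ c₂ κ κ′} → eval b (memory κ) ≡ 0 →
           c₂ / tick (1 + cost b) κ ⇓ κ′ → ifnz b c₁ c₂ / κ ⇓ κ′
  loop   : ∀ {b c κ κ₁ κ₂} → eval b (memory κ) ≢ 0 →
           c / tick (1 + cost b) κ ⇓ κ₁ → while b c / κ₁ ⇓ κ₂ → while b c / κ ⇓ κ₂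
  exit   : ∀ {b c κ} → eval b (memory κ) ≡ 0 →
           while b c / κ ⇓ tick (1 + cost b) κ

-- Array names for the input and for the variables of Algorithm H; all others
-- are free for use as working memory.
#n #ℓ #k #P-root #P-left #P-right #P-e #T-root #T-left #T-right #o #s : ℕ
#n       = 0
#ℓ       = 1
#k       = 2
#P-root  = 3
#P-left  = 4
#P-right = 5
#P-e     = 6
#T-root  = 7
#T-left  = 8
#T-right = 9
#o       = 10
#s       = 11

-- A vertex is stored as its label and a nonexistent one as 0.
pointer : Maybe ℕ → ℕ
pointer = fromMaybe 0

direction : Direction → ℕ
direction ↑ = 0
direction ↓ = 1

-- The patterns are numbered from 0.  All cells not mentioned have arbitrary
-- contents.
record Input (n : ℕ) (ps : List Pattern) (μ : Memory) : Set where
  field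
    n-cell  : μ #n 0 0 ≡ n
    ℓ-cell  : μ #ℓ 0 0 ≡ length ps
    k-cell  : ∀ t → μ #k (toℕ t) 0 ≡ k (lookup ps t)
    P-root  : ∀ t → μ #P-root (toℕ t) 0 ≡ pointer (root (P (lookup ps t)))
    P-left  : ∀ t i → i ∈[ k (lookup ps t) ] →
              μ #P-left (toℕ t) i ≡ pointer (cL (P (lookup ps t)) i)
    P-right : ∀ t i → i ∈[ k (lookup ps t) ] →
              μ #P-right (toℕ t) i ≡ pointer (cR (P (lookup ps t)) i)
    P-e     : ∀ t i → i ∈[ k (lookup ps t) ] → root (P (lookup ps t)) ≢ just i →
              μ #P-e (toℕ t) i ≡ bit (e (lookup ps t) i)

record Represents (n : ℕ) (μ : Memory) (σ : HState) : Set where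
  field
    T-root  : μ #T-root 0 0 ≡ pointer (root (tree σ))
    T-left  : ∀ i → i ∈[ n ] → μ #T-left i 0 ≡ pointer (cL (tree σ) i)
    T-right : ∀ i → i ∈[ n ] → μ #T-right i 0 ≡ pointer (cR (tree σ) i)
    o-cell  : ∀ i → i ∈[ n ] → μ #o i 0 ≡ direction (o σ i)
    s-cell  : ∀ i → i ∈[ n ] → μ #s i 0 ≡ s σ i

-- On the given input, the program halts after going through the states σs of
-- Algorithm H, using at most `bound` operations before the first visit,
-- between any two consecutive visits, and after the last one.
Executes : Program → ℕ → List Pattern → List HState → ℕ → Set
Executes program n ps σs bound = ∀ μ → Input n ps μ → ∃ λ κ →
  program / start μ ⇓ κ ×
  Pointwise (λ v σ → Represents n (proj₂ v) σ) (log κ) σs ×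
  All (λ v → proj₁ v ≤ bound) (log κ) ×
  clock κ ≤ bound

sumOfSquares : List Pattern → ℕ
sumOfSquares ps = sum (map (λ p → k p ^ 2) ps)

{-# OPTIONS --safe #-}
module Submission where

-- Deleting the largest label n maps the trees of the language onto those of the
-- language for n - 1, and the trees over T arise by inserting n somewhere on the
-- right branch of T.  Friendliness makes the two extreme insertions, at the
-- bottom and at the top, avoid all patterns whenever T does, and makes deletion
-- preserve avoidance: an edge broken by n is either a non-contiguous one or the
-- last one of the right branch of the pattern, and then n can replace k.  Hence
-- both algorithms for n sweep n between the two extremes over each tree T and, at
-- an extreme, where all slides of n are used up and slides of smaller labels
-- commute with the insertion of n, do what they do for n - 1.
--
-- For the running time, a tree is tested for a pattern with k vertices by dynamic
-- programming over pairs of subtrees in O(n k) operations.  A slide takes at most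
-- n rotations, since the left subtree of the sliding vertex changes its size
-- strictly monotonically.

open import Defs
open import Data.Bool using (Bool; true; false; if_then_else_; _∧_; _∨_; not) renaming (T to IsTrue)
open import Data.Bool.Properties using (∨-zeroʳ)
open import Data.Empty using (⊥; ⊥-elim)
open import Data.Fin using (Fin; zero; suc; toℕ)
open import Data.List using (List; []; _∷_; [_]; _++_; _∷ʳ_; map; length; lookup)
open import Data.List.Membership.Propositional using (_∈_; _∉_)
open import Data.List.Membership.Propositional.Properties using (∈-++⁺ˡ; ∈-++⁺ʳ; ∈-++⁻)
open import Data.List.Properties using (++-assoc; length-++; ++-identityʳ)
open import Data.List.Relation.Binary.Pointwise using (Pointwise; []; _∷_)
open import Data.List.Relation.Unary.All as All using (All; []; _∷_)
open import Data.List.Relation.Unary.All.Properties using (++⁺; ++⁻)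
open import Data.List.Relation.Unary.AllPairs using ([]; _∷_)
open import Data.List.Relation.Unary.Any using (here; there)
open import Data.List.Relation.Unary.Unique.Propositional using (Unique)
open import Data.Maybe using (just; nothing)
open import Data.Maybe.Properties using (just-injective)
open import Data.Nat using (ℕ; zero; suc; _+_; _∸_; _*_; _^_; _≤_; _<_; _≡ᵇ_; _<ᵇ_; z≤n; s≤s)
open import Data.Nat.Properties
open import Data.Nat.Solver using (module +-*-Solver)
open import Data.Product using (∃; ∃₂; _×_; _,_; proj₁; proj₂)
open import Data.Sum using (_⊎_; inj₁; inj₂)
open import Data.Unit using (⊤; tt)
open import Function.Base using (_∘_; id; case_of_)
open import Function.Bundles using (_⇔_; mk⇔; Equivalence)
open import Relation.Binary.Definitions using (tri<; tri≈; tri>)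
open import Relation.Binary.PropositionalEquality using (_≡_; _≢_; refl; sym; trans; cong; cong₂; subst; subst₂)
open import Relation.Nullary using (¬_; Dec; yes; no; contradiction)
open +-*-Solver using (solve; _:=_; _:+_; _:*_; con)

-- Subtrees and search trees

-- Algorithm S chooses with respect to everything visited so far, so it does not suffice to follow H
-- alone. The induction on n therefore carries a joint run, in which each step of H is the forced
-- choice of S for an explicit list of visited trees. Two invariants tie the lists of two
-- consecutive levels together: every tree visited for n lies over a tree visited for n - 1, and
-- when a sweep ends, all trees of the language over the latter have been visited. So a slide that
-- is new at the end of a sweep comes from a new slide on the level below. H passes between the
-- levels because a turn of n copies the entry of n - 1 in `s` to n: the next vertex read is the one
-- that the smaller run would read. Containment quantifies over maps. A Boolean recursion replaces
-- it, which serves the insertion lemmas, decides the language and specifies the tables of the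
-- program. The cell for `e` at the root of a pattern is arbitrary, so the tables are described by
-- the edge labels found in memory, which agree with `e` below the root.

data _⊑_ : Tree → Tree → Set where
  ⊑-refl  : ∀ {t} → t ⊑ t
  ⊑-left  : ∀ {t l x r} → t ⊑ l → t ⊑ node l x r
  ⊑-right : ∀ {t l x r} → t ⊑ r → t ⊑ node l x r

⊑-trans : ∀ {t u v} → t ⊑ u → u ⊑ v → t ⊑ v
⊑-trans p ⊑-refl      = p
⊑-trans p (⊑-left q)  = ⊑-left (⊑-trans p q)
⊑-trans p (⊑-right q) = ⊑-right (⊑-trans p q)

-- Unlike membership in `vertices T`, this determines the tree T by unification.
data _∈ᵗ_ (i : ℕ) : Tree → Set where
  at-root  : ∀ {l r} → i ∈ᵗ node l i r
  in-left  : ∀ {l x r} → i ∈ᵗ l → i ∈ᵗ node l x r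
  in-right : ∀ {l x r} → i ∈ᵗ r → i ∈ᵗ node l x r

∈⇒∈ᵗ : ∀ {i} T → i ∈ vertices T → i ∈ᵗ T
∈⇒∈ᵗ (node l x r) i∈ with ∈-++⁻ (vertices l) i∈
... | inj₁ i∈l         = in-left (∈⇒∈ᵗ l i∈l)
... | inj₂ (here refl) = at-root
... | inj₂ (there i∈r) = in-right (∈⇒∈ᵗ r i∈r)

∈ᵗ⇒∈ : ∀ {i T} → i ∈ᵗ T → i ∈ vertices T
∈ᵗ⇒∈ (at-root {l})      = ∈-++⁺ʳ (vertices l) (here refl)
∈ᵗ⇒∈ (in-left i∈)       = ∈-++⁺ˡ (∈ᵗ⇒∈ i∈)
∈ᵗ⇒∈ (in-right {l} i∈)  = ∈-++⁺ʳ (vertices l) (there (∈ᵗ⇒∈ i∈))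

∈-⊑ : ∀ {t u i} → t ⊑ u → i ∈ᵗ t → i ∈ᵗ u
∈-⊑ ⊑-refl      i∈ = i∈
∈-⊑ (⊑-left p)  i∈ = in-left (∈-⊑ p i∈)
∈-⊑ (⊑-right p) i∈ = in-right (∈-⊑ p i∈)

SearchTree-⊑ : ∀ {t u} → t ⊑ u → SearchTree u → SearchTree t
SearchTree-⊑ ⊑-refl      su              = su
SearchTree-⊑ (⊑-left p)  (_ , _ , sl , _) = SearchTree-⊑ p sl
SearchTree-⊑ (⊑-right p) (_ , _ , _ , sr) = SearchTree-⊑ p sr

left-< : ∀ {l x r i} → SearchTree (node l x r) → i ∈ᵗ l → i < x
left-< (<x , _) = All.lookup <x ∘ ∈ᵗ⇒∈

right-> : ∀ {l x r i} → SearchTree (node l x r) → i ∈ᵗ r → x < i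
right-> (_ , x< , _) = All.lookup x< ∘ ∈ᵗ⇒∈

subtree-⊑ : ∀ T i → subtree T i ⊑ T
subtree-⊑ ε i = ⊑-refl
subtree-⊑ (node l x r) i with <-cmp i x
... | tri< _ _ _ = ⊑-left (subtree-⊑ l i)
... | tri≈ _ _ _ = ⊑-refl
... | tri> _ _ _ = ⊑-right (subtree-⊑ r i)

-- Binary search takes the same turns as the path to the subtree, since any other turn contradicts
-- the order of the labels. Lookups by label thereby become statements about subterms.
subtree-node : ∀ {T l i r} → SearchTree T → node l i r ⊑ T → subtree T i ≡ node l i r
subtree-node {i = i} _ ⊑-refl with <-cmp i i
... | tri< _ i≢i _ = contradiction refl i≢i
... | tri≈ _ _ _   = refl
... | tri> _ i≢i _ = contradiction refl i≢i
subtree-node {node l′ x _} {l} {i} {r} sT@(_ , _ , sl , _) (⊑-left p) with <-cmp i x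
... | tri< _ _ _   = subtree-node sl p
... | tri≈ i≮x _ _ = contradiction (left-< sT (∈-⊑ p at-root)) i≮x
... | tri> i≮x _ _ = contradiction (left-< sT (∈-⊑ p at-root)) i≮x
subtree-node {node _ x _} {l} {i} {r} sT@(_ , _ , _ , sr) (⊑-right p) with <-cmp i x
... | tri< _ _ x≮i = contradiction (right-> sT (∈-⊑ p at-root)) x≮i
... | tri≈ _ _ x≮i = contradiction (right-> sT (∈-⊑ p at-root)) x≮i
... | tri> _ _ _   = subtree-node sr p

∈⇒⊑ : ∀ {T i} → i ∈ᵗ T → ∃₂ λ l r → node l i r ⊑ T
∈⇒⊑ at-root       = _ , _ , ⊑-refl
∈⇒⊑ (in-left i∈)  = let l , r , p = ∈⇒⊑ i∈ in l , r , ⊑-left p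
∈⇒⊑ (in-right i∈) = let l , r , p = ∈⇒⊑ i∈ in l , r , ⊑-right p

subtree-∈ : ∀ {T i} → SearchTree T → i ∈ᵗ T → ∃₂ λ l r → subtree T i ≡ node l i r
subtree-∈ {T} sT i∈ = let l , r , p = ∈⇒⊑ i∈ in l , r , subtree-node sT p

subtree-label : ∀ T i {l x r} → subtree T i ≡ node l x r → x ≡ i
subtree-label (node l y r) i eq with <-cmp i y
... | tri< _ _ _ = subtree-label l i eq
subtree-label (node l y r) i refl | tri≈ _ i≡y _ = sym i≡y
... | tri> _ _ _ = subtree-label r i eq

subtree-∉ : ∀ T {i} → ¬ i ∈ᵗ T → subtree T i ≡ ε
subtree-∉ T {i} i∉ with subtree T i in eq
... | ε = refl
... | node l x r = contradiction (∈-⊑ (subst (_⊑ T) eq (subtree-⊑ T i))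
                     (subst (_∈ᵗ node l x r) (subtree-label T i eq) at-root)) i∉

root⇒node : ∀ {t j} → root t ≡ just j → ∃₂ λ l r → t ≡ node l j r
root⇒node {node l _ r} refl = l , r , refl

left-⊑ : ∀ t → left t ⊑ t
left-⊑ ε            = ⊑-refl
left-⊑ (node _ _ _) = ⊑-left ⊑-refl

right-⊑ : ∀ t → right t ⊑ t
right-⊑ ε            = ⊑-refl
right-⊑ (node _ _ _) = ⊑-right ⊑-refl

L-⊑ : ∀ T i → L T i ⊑ T
L-⊑ T i = ⊑-trans (left-⊑ (subtree T i)) (subtree-⊑ T i)

R-⊑ : ∀ T i → R T i ⊑ T
R-⊑ T i = ⊑-trans (right-⊑ (subtree T i)) (subtree-⊑ T i)

subtree-child : ∀ {T t j} → SearchTree T → t ⊑ T → root t ≡ just j → subtree T j ≡ t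
subtree-child {t = t} sT p eq with root⇒node {t} eq
... | _ , _ , refl = subtree-node sT p

∈⇒label : ∀ {n T i} → T ∈𝒯 n → i ∈ᵗ T → i ∈[ n ]
∈⇒label (_ , lab) i∈ = Equivalence.to (lab _) (∈ᵗ⇒∈ i∈)

label⇒∈ : ∀ {n T i} → T ∈𝒯 n → i ∈[ n ] → i ∈ᵗ T
label⇒∈ (_ , lab) i∈ = ∈⇒∈ᵗ _ (Equivalence.from (lab _) i∈)

0∉ : ∀ {n T} → T ∈𝒯 n → ¬ 0 ∈ᵗ T
0∉ T∈ 0∈ with proj₁ (∈⇒label T∈ 0∈)
... | ()

-- 0 encodes a missing child, and as it is no label, looking it up yields `ε` as well. So stored
-- pointers can be read back as subtrees without a case distinction.
subtree-pointer : ∀ {T t} → SearchTree T → ¬ 0 ∈ᵗ T → t ⊑ T → subtree T (pointer (root t)) ≡ t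
subtree-pointer {T} {ε} _ 0∉T p = subtree-∉ T 0∉T
subtree-pointer {T} {node _ _ _} sT _ p = subtree-node sT p

⊑-node : ∀ {t l x r} → t ⊑ node l x r → t ≡ node l x r ⊎ t ⊑ l ⊎ t ⊑ r
⊑-node ⊑-refl      = inj₁ refl
⊑-node (⊑-left p)  = inj₂ (inj₁ p)
⊑-node (⊑-right p) = inj₂ (inj₂ p)

¬parent-of-root : ∀ {l x r i} → SearchTree (node l x r) → ¬ Parent (node l x r) i x
¬parent-of-root {l} {x} {r} {i} sT par = go (⊑-node sub) par
  where
  T = node l x r
  sub = subtree-⊑ T i
  left-∈-sub : ∀ {t} → root (left t) ≡ just x → x ∈ᵗ left t
  left-∈-sub {node (node l _ _) _ _} refl = at-root
  right-∈-sub : ∀ {t} → root (right t) ≡ just x → x ∈ᵗ right t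
  right-∈-sub {node _ _ (node l _ _)} refl = at-root
  go : ∀ {t} → t ≡ T ⊎ t ⊑ l ⊎ t ⊑ r → root (left t) ≡ just x ⊎ root (right t) ≡ just x → ⊥
  go (inj₁ refl) (inj₁ eq) = <-irrefl refl (left-< sT (left-∈-sub {T} eq))
  go (inj₁ refl) (inj₂ eq) = <-irrefl refl (right-> sT (right-∈-sub {T} eq))
  go {t} (inj₂ (inj₁ p)) (inj₁ eq) = <-irrefl refl (left-< sT (∈-⊑ (⊑-trans (left-⊑ t) p) (left-∈-sub {t} eq)))
  go {t} (inj₂ (inj₁ p)) (inj₂ eq) = <-irrefl refl (left-< sT (∈-⊑ (⊑-trans (right-⊑ t) p) (right-∈-sub {t} eq)))
  go {t} (inj₂ (inj₂ p)) (inj₁ eq) = <-irrefl refl (right-> sT (∈-⊑ (⊑-trans (left-⊑ t) p) (left-∈-sub {t} eq)))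
  go {t} (inj₂ (inj₂ p)) (inj₂ eq) = <-irrefl refl (right-> sT (∈-⊑ (⊑-trans (right-⊑ t) p) (right-∈-sub {t} eq)))

-- Rotations

UpRotation-vertices : ∀ {j T T′} → UpRotation j T T′ → vertices T ≡ vertices T′
UpRotation-vertices (here {X} {i} {Y} {Z}) = sym (++-assoc (vertices X) (i ∷ vertices Y) _)
UpRotation-vertices (inˡ p) = cong (_++ _) (UpRotation-vertices p)
UpRotation-vertices (inʳ {l} {x} p) = cong (λ vs → vertices l ++ x ∷ vs) (UpRotation-vertices p)

UpRotation-SearchTree : ∀ {j T T′} → UpRotation j T T′ → SearchTree T → SearchTree T′
UpRotation-SearchTree (here {X} {i} {Y} {Z}) (X<i , i<r , sX , Y<j , j<Z , sY , sZ) =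
  let i<Y , i<jZ = ++⁻ (vertices Y) i<r
      i<j = All.head i<jZ
  in ++⁺ (All.map (λ x<i → <-trans x<i i<j) X<i) (i<j ∷ Y<j) , j<Z , (X<i , i<Y , sX , sY) , sZ
UpRotation-SearchTree (inˡ p) (<x , x< , sl , sr) =
  subst (All _) (UpRotation-vertices p) <x , x< , UpRotation-SearchTree p sl , sr
UpRotation-SearchTree (inʳ p) (<x , x< , sl , sr) =
  <x , subst (All _) (UpRotation-vertices p) x< , sl , UpRotation-SearchTree p sr

DownRotation-SearchTree : ∀ {j T T′} → UpRotation j T T′ → SearchTree T′ → SearchTree T
DownRotation-SearchTree (here {X} {i} {Y} {Z}) (l<j , j<Z , (X<i , i<Y , sX , sY) , sZ) =
  let X<j , iY<j = ++⁻ (vertices X) l<j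
      i<j = All.head iY<j
  in X<i , ++⁺ i<Y (i<j ∷ All.map (<-trans i<j) j<Z) , sX , All.tail iY<j , j<Z , sY , sZ
DownRotation-SearchTree (inˡ p) (<x , x< , sl , sr) =
  subst (All _) (sym (UpRotation-vertices p)) <x , x< , DownRotation-SearchTree p sl , sr
DownRotation-SearchTree (inʳ p) (<x , x< , sl , sr) =
  <x , subst (All _) (sym (UpRotation-vertices p)) x< , sl , DownRotation-SearchTree p sr

Rotation-vertices : ∀ δ {j T T′} → Rotation δ j T T′ → vertices T ≡ vertices T′
Rotation-vertices ↑ p = UpRotation-vertices p
Rotation-vertices ↓ p = sym (UpRotation-vertices p)

Rotation-SearchTree : ∀ δ {j T T′} → Rotation δ j T T′ → SearchTree T → SearchTree T′
Rotation-SearchTree ↑ = UpRotation-SearchTree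
Rotation-SearchTree ↓ = DownRotation-SearchTree

Slide-vertices : ∀ {δ j d T T′} → Slide δ j d T T′ → vertices T ≡ vertices T′
Slide-vertices done = refl
Slide-vertices {δ} (ρ ◅ ρs) = trans (Rotation-vertices δ ρ) (Slide-vertices ρs)

Slide-SearchTree : ∀ {δ j d T T′} → Slide δ j d T T′ → SearchTree T → SearchTree T′
Slide-SearchTree done = id
Slide-SearchTree {δ} (ρ ◅ ρs) = Slide-SearchTree ρs ∘ Rotation-SearchTree δ ρ

UpRotation-∈ : ∀ {j T T′} → UpRotation j T T′ → j ∈ᵗ T′
UpRotation-∈ here    = at-root
UpRotation-∈ (inˡ p) = in-left (UpRotation-∈ p)
UpRotation-∈ (inʳ p) = in-right (UpRotation-∈ p)

Rotation-∈ : ∀ δ {j T T′} → Rotation δ j T T′ → j ∈ᵗ T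
Rotation-∈ ↑ p = ∈⇒∈ᵗ _ (subst (_ ∈_) (sym (UpRotation-vertices p)) (∈ᵗ⇒∈ (UpRotation-∈ p)))
Rotation-∈ ↓ p = UpRotation-∈ p

UpRotation-≢root : ∀ {j X i r T′} → UpRotation j (node X i r) T′ → SearchTree (node X i r) →
  j ≢ i
UpRotation-≢root here sT refl = <-irrefl refl (right-> sT at-root)
UpRotation-≢root (inˡ p) sT refl = <-irrefl refl (left-< sT (Rotation-∈ ↑ p))
UpRotation-≢root (inʳ p) sT refl = <-irrefl refl (right-> sT (Rotation-∈ ↑ p))

-- The order of the labels fixes the place of `j`, so two rotations of it act at the same place;
-- every mixed case contradicts that order.
UpRotation-functional : ∀ {j T T₁ T₂} → SearchTree T → UpRotation j T T₁ → UpRotation j T T₂ → T₁ ≡ T₂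
UpRotation-functional sT here here = refl
UpRotation-functional sT here (inˡ q) =
  contradiction (left-< sT (Rotation-∈ ↑ q)) (<-asym (right-> sT at-root))
UpRotation-functional sT@(_ , _ , _ , sr) here (inʳ q) = contradiction refl (UpRotation-≢root q sr)
UpRotation-functional sT (inˡ p) here =
  contradiction (left-< sT (Rotation-∈ ↑ p)) (<-asym (right-> sT at-root))
UpRotation-functional sT@(_ , _ , sl , _) (inˡ p) (inˡ q) = cong (λ l → node l _ _) (UpRotation-functional sl p q)
UpRotation-functional sT (inˡ p) (inʳ q) =
  contradiction (left-< sT (Rotation-∈ ↑ p)) (<-asym (right-> sT (Rotation-∈ ↑ q)))
UpRotation-functional sT@(_ , _ , _ , sr) (inʳ p) here = contradiction refl (UpRotation-≢root p sr)
UpRotation-functional sT (inʳ p) (inˡ q) =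
  contradiction (left-< sT (Rotation-∈ ↑ q)) (<-asym (right-> sT (Rotation-∈ ↑ p)))
UpRotation-functional sT@(_ , _ , _ , sr) (inʳ p) (inʳ q) = cong (node _ _) (UpRotation-functional sr p q)

DownRotation-functional : ∀ {j T T₁ T₂} → SearchTree T → UpRotation j T₁ T → UpRotation j T₂ T → T₁ ≡ T₂
DownRotation-functional sT here here = refl
DownRotation-functional sT here (inˡ q) = contradiction (left-< sT (Rotation-∈ ↓ q)) (<-irrefl refl)
DownRotation-functional sT here (inʳ q) = contradiction (right-> sT (Rotation-∈ ↓ q)) (<-irrefl refl)
DownRotation-functional sT (inˡ p) here = contradiction (left-< sT (Rotation-∈ ↓ p)) (<-irrefl refl)
DownRotation-functional sT@(_ , _ , sl , _) (inˡ p) (inˡ q) = cong (λ l → node l _ _) (DownRotation-functional sl p q)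
DownRotation-functional sT (inˡ p) (inʳ q) =
  contradiction (left-< sT (Rotation-∈ ↓ p)) (<-asym (right-> sT (Rotation-∈ ↓ q)))
DownRotation-functional sT (inʳ p) here = contradiction (right-> sT (Rotation-∈ ↓ p)) (<-irrefl refl)
DownRotation-functional sT (inʳ p) (inˡ q) =
  contradiction (left-< sT (Rotation-∈ ↓ q)) (<-asym (right-> sT (Rotation-∈ ↓ p)))
DownRotation-functional sT@(_ , _ , _ , sr) (inʳ p) (inʳ q) = cong (node _ _) (DownRotation-functional sr p q)

Rotation-functional : ∀ δ {j T T₁ T₂} → SearchTree T → Rotation δ j T T₁ → Rotation δ j T T₂ → T₁ ≡ T₂
Rotation-functional ↑ = UpRotation-functional
Rotation-functional ↓ = DownRotation-functional

Slide-functional : ∀ {δ j d T T₁ T₂} → SearchTree T → Slide δ j d T T₁ → Slide δ j d T T₂ → T₁ ≡ T₂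
Slide-functional sT done done = refl
Slide-functional {δ} sT (ρ ◅ ρs) (π ◅ πs) with Rotation-functional δ sT ρ π
... | refl = Slide-functional (Rotation-SearchTree δ ρ sT) ρs πs

-- If the lengths differ, the shorter slide ends in the language, against the minimality of the
-- longer one.
MinimalSlide-functional : ∀ {𝓛 δ j T T₁ T₂} → SearchTree T →
  MinimalSlide 𝓛 δ j T T₁ → MinimalSlide 𝓛 δ j T T₂ → T₁ ≡ T₂
MinimalSlide-functional {𝓛} sT (d₁ , 1≤d₁ , ρ₁ , 𝓛₁ , min₁) (d₂ , 1≤d₂ , ρ₂ , 𝓛₂ , min₂) with <-cmp d₁ d₂
... | tri< d₁<d₂ _ _ = contradiction 𝓛₁ (min₂ d₁ _ 1≤d₁ d₁<d₂ ρ₁)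
... | tri≈ _ refl _  = Slide-functional sT ρ₁ ρ₂
... | tri> _ _ d₂<d₁ = contradiction 𝓛₂ (min₁ d₂ _ 1≤d₂ d₂<d₁ ρ₂)

∈𝒯-resp : ∀ {n T T′} → vertices T ≡ vertices T′ → SearchTree T′ → T ∈𝒯 n → T′ ∈𝒯 n
∈𝒯-resp eq sT′ (_ , lab) = sT′ , λ i → subst (λ vs → i ∈ vs ⇔ _) eq (lab i)

MinimalSlide-∈ : ∀ {𝓛 δ j T T′} → MinimalSlide 𝓛 δ j T T′ → j ∈ᵗ T
MinimalSlide-∈ {δ = δ} (_ , _ , ρ ◅ _ , _) = Rotation-∈ δ ρ

-- Pattern containment, decided recursively

-- `at e Q t` matches Q with its root placed at the root of t, `below e Q t`
-- with its root placed anywhere in t, and `child e Q t` as the edge above the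
-- root of Q demands.
mutual
  at : (ℕ → Bool) → Tree → Tree → Bool
  at e ε            t            = true
  at e (node _ _ _) ε            = false
  at e (node l _ r) (node x _ z) = child e l x ∧ child e r z

  below : (ℕ → Bool) → Tree → Tree → Bool
  below e Q ε            = false
  below e Q (node x i z) = at e Q (node x i z) ∨ (below e Q x ∨ below e Q z)

  child : (ℕ → Bool) → Tree → Tree → Bool
  child e ε            t = true
  child e (node l b r) t = if e b then at e (node l b r) t else below e (node l b r) t

∧-intro : ∀ {a b} → a ≡ true → b ≡ true → a ∧ b ≡ true
∧-intro refl refl = refl

∧-elim : ∀ {a b} → a ∧ b ≡ true → a ≡ true × b ≡ true
∧-elim {true} {true} refl = refl , refl

∨-elim : ∀ {a b} → a ∨ b ≡ true → a ≡ true ⊎ b ≡ true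
∨-elim {true}  _  = inj₁ refl
∨-elim {false} eq = inj₂ eq

∨-introʳ : ∀ {a b} → b ≡ true → a ∨ b ≡ true
∨-introʳ {a} refl = ∨-zeroʳ a

∨-introˡ : ∀ {a b} → a ≡ true → a ∨ b ≡ true
∨-introˡ refl = refl

below-left : ∀ e Q {x i z} → below e Q x ≡ true → below e Q (node x i z) ≡ true
below-left e Q {x} {i} {z} b = ∨-introʳ {at e Q (node x i z)} (∨-introˡ b)

below-right : ∀ e Q {x i z} → below e Q z ≡ true → below e Q (node x i z) ≡ true
below-right e Q {x} {i} {z} b = ∨-introʳ {at e Q (node x i z)} (∨-introʳ {below e Q x} b)

below-⊑ : ∀ e Q {t u} → t ⊑ u → below e Q t ≡ true → below e Q u ≡ true
below-⊑ e Q ⊑-refl      b = b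
below-⊑ e Q (⊑-left p)  b = below-left e Q (below-⊑ e Q p b)
below-⊑ e Q (⊑-right p) b = below-right e Q (below-⊑ e Q p b)

at⇒below : ∀ e Q {x i z} → at e Q (node x i z) ≡ true → below e Q (node x i z) ≡ true
at⇒below e Q = ∨-introˡ

root⇒∈ : ∀ {t j} → root t ≡ just j → j ∈ᵗ t
root⇒∈ {node _ _ _} refl = at-root

module _ {n : ℕ} {T : Tree} {p : Pattern} (T∈ : T ∈𝒯 n) (c : Contains n T p) where
  open Contains c

  -- The premises say where the root of `Q` goes and what the edge above it demands. For a
  -- contiguous edge `t` is itself the subtree at `f b`; otherwise that subtree lies somewhere
  -- inside `t`, and `below` is inherited by larger trees.
  Contains⇒child : ∀ Q t → t ⊑ T →
    (∀ {b} → root Q ≡ just b → at (e p) Q (subtree T (f b)) ≡ true) →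
    (∀ {b} → root Q ≡ just b → e p b ≡ true → root t ≡ just (f b)) →
    (∀ {b} → root Q ≡ just b → e p b ≡ false → f b ∈ᵗ t) →
    child (e p) Q t ≡ true
  Contains⇒child ε _ _ _ _ _ = refl
  Contains⇒child Q@(node _ b _) t t⊑ m edge-1 edge-0 with e p b in eb
  ... | true  = subst (λ u → at (e p) Q u ≡ true) (subtree-child (proj₁ T∈) t⊑ (edge-1 refl eb)) (m refl)
  ... | false with ∈⇒⊑ (edge-0 refl eb)
  ... | x , z , u⊑ = below-⊑ (e p) Q u⊑ (at⇒below (e p) Q {x} {f b} {z}
    (subst (λ u → at (e p) Q u ≡ true) (subtree-node (proj₁ T∈) (⊑-trans u⊑ t⊑)) (m refl)))

  Contains⇒at : ∀ Q → Q ⊑ P p → ∀ {a} → root Q ≡ just a → at (e p) Q (subtree T (f a)) ≡ true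
  Contains⇒at (node l a r) Q⊑ refl
    with subtree T (f a) in eq
       | subtree-node (proj₁ (P∈𝒯k p)) Q⊑
       | subtree-∈ (proj₁ T∈) (label⇒∈ T∈ (f-range (∈⇒label (P∈𝒯k p) (∈-⊑ Q⊑ at-root))))
  ... | t | eqP | x , z , refl = ∧-intro
    (Contains⇒child l x (⊑-trans (⊑-left ⊑-refl) t⊑)
      (Contains⇒at l (⊑-trans (⊑-left ⊑-refl) Q⊑))
      (λ l≡ eb → trans (cong (root ∘ left) (sym eq)) (left-1 (cLa l≡) eb))
      (λ l≡ eb → ∈⇒∈ᵗ x (subst (λ u → _ ∈ vertices (left u)) eq (left-0 (cLa l≡) eb))))
    (Contains⇒child r z (⊑-trans (⊑-right ⊑-refl) t⊑)
      (Contains⇒at r (⊑-trans (⊑-right ⊑-refl) Q⊑))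
      (λ r≡ eb → trans (cong (root ∘ right) (sym eq)) (right-1 (cRa r≡) eb))
      (λ r≡ eb → ∈⇒∈ᵗ z (subst (λ u → _ ∈ vertices (right u)) eq (right-0 (cRa r≡) eb))))
    where
    t⊑ : node x (f a) z ⊑ T
    t⊑ = subst (_⊑ T) eq (subtree-⊑ T (f a))
    cLa : ∀ {b} → root l ≡ just b → cL (P p) a ≡ just b
    cLa l≡ = trans (cong (root ∘ left) eqP) l≡
    cRa : ∀ {b} → root r ≡ just b → cR (P p) a ≡ just b
    cRa r≡ = trans (cong (root ∘ right) eqP) r≡

  Contains⇒below : ∀ {r} → root (P p) ≡ just r → below (e p) (P p) T ≡ true
  Contains⇒below eq with subtree-∈ (proj₁ T∈) (label⇒∈ T∈ (f-range (∈⇒label (P∈𝒯k p) (root⇒∈ eq))))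
  ... | _ , _ , eqT = below-⊑ (e p) (P p) (subst (_⊑ T) eqT (subtree-⊑ T _))
                       (at⇒below (e p) (P p) (subst (λ u → at (e p) (P p) u ≡ true) eqT
                         (Contains⇒at (P p) ⊑-refl eq)))

-- Embeddings of patterns into trees

Edge : (ℕ → Bool) → (ℕ → ℕ) → Tree → Tree → Set
Edge e f Q u = ∀ {b} → root Q ≡ just b →
  (e b ≡ true → root u ≡ just (f b)) × (e b ≡ false → f b ∈ᵗ u)

-- A form of containment that refers only to subterms of `Q` and `t`, so that embeddings of two
-- subtrees can be put together. Monotonicity follows from the search tree property and later yields
-- injectivity.
record Embedding (e : ℕ → Bool) (f : ℕ → ℕ) (Q t : Tree) : Set where
  field
    f-∈      : ∀ {x} → x ∈ᵗ Q → f x ∈ᵗ t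
    monotone : ∀ {x y} → x ∈ᵗ Q → y ∈ᵗ Q → x < y → f x < f y
    edges    : ∀ {l a r} → node l a r ⊑ Q →
               ∃₂ λ u v → node u (f a) v ⊑ t × Edge e f l u × Edge e f r v

Edge-cong : ∀ {e f g Q u} → (∀ {x} → x ∈ᵗ Q → f x ≡ g x) → Edge e f Q u → Edge e g Q u
Edge-cong f≡g E eq with f≡g (root⇒∈ eq) | E eq
... | fb≡gb | E₁ , E₀ = (λ eb → trans (E₁ eb) (cong just fb≡gb)) , (λ eb → subst (_∈ᵗ _) fb≡gb (E₀ eb))

Embedding-cong : ∀ {e f g Q t} → (∀ {x} → x ∈ᵗ Q → f x ≡ g x) → Embedding e f Q t → Embedding e g Q t
Embedding-cong {e} {f} {g} {Q} {t} f≡g E = record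
  { f-∈      = λ x∈ → subst (_∈ᵗ t) (f≡g x∈) (f-∈ x∈)
  ; monotone = λ x∈ y∈ x<y → subst₂ _<_ (f≡g x∈) (f≡g y∈) (monotone x∈ y∈ x<y)
  ; edges    = λ {l} {a} {r} Q′⊑ → let u , v , t′⊑ , El , Er = edges Q′⊑ in
      u , v , subst (λ i → node u i v ⊑ t) (f≡g (∈-⊑ Q′⊑ at-root)) t′⊑ ,
      Edge-cong (λ x∈ → f≡g (∈-⊑ Q′⊑ (in-left x∈))) El ,
      Edge-cong (λ x∈ → f≡g (∈-⊑ Q′⊑ (in-right x∈))) Er
  }
  where open Embedding E

Embedding-⊑ : ∀ {e f Q t u} → t ⊑ u → Embedding e f Q t → Embedding e f Q u
Embedding-⊑ t⊑u E = record
  { f-∈      = λ x∈ → ∈-⊑ t⊑u (f-∈ x∈)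
  ; monotone = monotone
  ; edges    = λ Q′⊑ → let u , v , t′⊑ , El , Er = edges Q′⊑ in u , v , ⊑-trans t′⊑ t⊑u , El , Er
  }
  where open Embedding E

-- The two subtrees of a pattern yield independent maps. Labels on the left are smaller than `a` and
-- labels on the right are larger, so a comparison with `a` tells which map applies.
glue : ℕ → (ℕ → ℕ) → ℕ → (ℕ → ℕ) → ℕ → ℕ
glue a f i g x with <-cmp x a
... | tri< _ _ _ = f x
... | tri≈ _ _ _ = i
... | tri> _ _ _ = g x

glue-< : ∀ a f i g {x} → x < a → f x ≡ glue a f i g x
glue-< a f i g {x} x<a with <-cmp x a
... | tri< _ _ _   = refl
... | tri≈ x≮a _ _ = contradiction x<a x≮a
... | tri> x≮a _ _ = contradiction x<a x≮a

glue-≡ : ∀ a f i g → glue a f i g a ≡ i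
glue-≡ a f i g with <-cmp a a
... | tri< _ a≢a _ = contradiction refl a≢a
... | tri≈ _ _ _   = refl
... | tri> _ a≢a _ = contradiction refl a≢a

glue-> : ∀ a f i g {x} → a < x → g x ≡ glue a f i g x
glue-> a f i g {x} a<x with <-cmp x a
... | tri< _ _ a≮x = contradiction a<x a≮x
... | tri≈ _ _ a≮x = contradiction a<x a≮x
... | tri> _ _ _   = refl

Embedding-node : ∀ {e f l a r x i z} → SearchTree (node l a r) → SearchTree (node x i z) →
  f a ≡ i → Embedding e f l x → Embedding e f r z → Edge e f l x → Edge e f r z →
  Embedding e f (node l a r) (node x i z)
Embedding-node {e} {f} {l} {a} {r} {x} {i} {z} sQ sT refl El Er edge-l edge-r = record
  { f-∈ = f-∈′ ; monotone = mono ; edges = edges′ }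
  where
  module El = Embedding El
  module Er = Embedding Er
  f-∈′ : ∀ {y} → y ∈ᵗ node l a r → f y ∈ᵗ node x (f a) z
  f-∈′ at-root       = at-root
  f-∈′ (in-left y∈)  = in-left (El.f-∈ y∈)
  f-∈′ (in-right y∈) = in-right (Er.f-∈ y∈)
  fl< : ∀ {y} → y ∈ᵗ l → f y < f a
  fl< y∈ = left-< sT (El.f-∈ y∈)
  <fr : ∀ {y} → y ∈ᵗ r → f a < f y
  <fr y∈ = right-> sT (Er.f-∈ y∈)
  mono : ∀ {y w} → y ∈ᵗ node l a r → w ∈ᵗ node l a r → y < w → f y < f w
  mono at-root       at-root       y<w = contradiction y<w (<-irrefl refl)
  mono at-root       (in-left w∈)  y<w = contradiction (left-< sQ w∈) (<-asym y<w)
  mono at-root       (in-right w∈) y<w = <fr w∈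
  mono (in-left y∈)  at-root       y<w = fl< y∈
  mono (in-left y∈)  (in-left w∈)  y<w = El.monotone y∈ w∈ y<w
  mono (in-left y∈)  (in-right w∈) y<w = <-trans (fl< y∈) (<fr w∈)
  mono (in-right y∈) at-root       y<w = contradiction (right-> sQ y∈) (<-asym y<w)
  mono (in-right y∈) (in-left w∈)  y<w =
    contradiction (<-trans (left-< sQ w∈) (right-> sQ y∈)) (<-asym y<w)
  mono (in-right y∈) (in-right w∈) y<w = Er.monotone y∈ w∈ y<w
  edges′ : ∀ {l′ a′ r′} → node l′ a′ r′ ⊑ node l a r →
    ∃₂ λ u v → node u (f a′) v ⊑ node x (f a) z × Edge e f l′ u × Edge e f r′ v
  edges′ ⊑-refl      = x , z , ⊑-refl , edge-l , edge-r
  edges′ (⊑-left p)  = let u , v , t⊑ , E = El.edges p in u , v , ⊑-left t⊑ , E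
  edges′ (⊑-right p) = let u , v , t⊑ , E = Er.edges p in u , v , ⊑-right t⊑ , E

mutual
  at⇒Embedding : ∀ e {l a r x i z} → SearchTree (node l a r) → SearchTree (node x i z) →
    at e (node l a r) (node x i z) ≡ true →
    ∃ λ f → f a ≡ i × Embedding e f (node l a r) (node x i z)
  at⇒Embedding e {l} {a} {r} {x} {i} {z} sQ@(_ , _ , sl , sr) sT@(_ , _ , sx , sz) m =
    let ml , mr = ∧-elim m
        fl , El , edge-l = child⇒Embedding e l x sl sx ml
        fr , Er , edge-r = child⇒Embedding e r z sr sz mr
        f = glue a fl i fr
        fl≡f : ∀ {y} → y ∈ᵗ l → fl y ≡ f y
        fl≡f y∈ = glue-< a fl i fr (left-< sQ y∈)
        fr≡f : ∀ {y} → y ∈ᵗ r → fr y ≡ f y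
        fr≡f y∈ = glue-> a fl i fr (right-> sQ y∈)
        fa≡i = glue-≡ a fl i fr
    in f , fa≡i , Embedding-node sQ sT fa≡i (Embedding-cong fl≡f El) (Embedding-cong fr≡f Er)
                    (Edge-cong fl≡f edge-l) (Edge-cong fr≡f edge-r)

  below⇒Embedding : ∀ e {l a r} t → SearchTree (node l a r) → SearchTree t →
    below e (node l a r) t ≡ true → ∃ λ f → Embedding e f (node l a r) t
  below⇒Embedding e {l} {a} {r} t@(node x i z) sQ sT@(_ , _ , sx , sz) m
    with ∨-elim {at e (node l a r) t} m
  ... | inj₁ m₀ = let f , _ , E = at⇒Embedding e sQ sT m₀ in f , E
  ... | inj₂ m′ with ∨-elim {below e (node l a r) x} m′
  ... | inj₁ m₁ = let f , E = below⇒Embedding e x sQ sx m₁ in f , Embedding-⊑ (⊑-left ⊑-refl) E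
  ... | inj₂ m₂ = let f , E = below⇒Embedding e z sQ sz m₂ in f , Embedding-⊑ (⊑-right ⊑-refl) E

  child⇒Embedding : ∀ e Q t → SearchTree Q → SearchTree t → child e Q t ≡ true →
    ∃ λ f → Embedding e f Q t × Edge e f Q t
  -- There is no vertex to map, so any function will do.
  child⇒Embedding e ε t sQ st m = id , record { f-∈ = λ () ; monotone = λ () ; edges = λ () } , λ ()
  child⇒Embedding e (node l b r) t sQ st m with e b in eb
  child⇒Embedding e (node l b r) (node x i z) sQ st m | true =
    let f , fb≡i , E = at⇒Embedding e sQ st m
    in f , E , λ { refl → (λ _ → cong just (sym fb≡i)) , (λ eb′ → case trans (sym eb) eb′ of λ ()) }
  child⇒Embedding e (node l b r) t sQ st m | false =
    let f , E = below⇒Embedding e t sQ st m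
    in f , E , λ { refl → (λ eb′ → case trans (sym eb) eb′ of λ ()) , (λ _ → Embedding.f-∈ E at-root) }

Embedding⇒Contains : ∀ {n T p f} → T ∈𝒯 n → Embedding (e p) f (P p) T → Contains n T p
Embedding⇒Contains {n} {T} {p} {f} T∈ E = record
  { f         = f
  ; f-range   = λ i∈ → ∈⇒label T∈ (f-∈ (label⇒∈ (P∈𝒯k p) i∈))
  ; injective = injective
  ; left-1    = λ {i} eq eb → let u , v , t⊑ , El , _ = edges (cL⇒⊑ i eq) in
                  trans (cong (root ∘ left) (subtree-node sT t⊑)) (proj₁ (El eq) eb)
  ; left-0    = λ {i} eq eb → let u , v , t⊑ , El , _ = edges (cL⇒⊑ i eq) in
                  subst (λ t → _ ∈ vertices (left t)) (sym (subtree-node sT t⊑)) (∈ᵗ⇒∈ (proj₂ (El eq) eb))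
  ; right-1   = λ {i} eq eb → let u , v , t⊑ , _ , Er = edges (cR⇒⊑ i eq) in
                  trans (cong (root ∘ right) (subtree-node sT t⊑)) (proj₁ (Er eq) eb)
  ; right-0   = λ {i} eq eb → let u , v , t⊑ , _ , Er = edges (cR⇒⊑ i eq) in
                  subst (λ t → _ ∈ vertices (right t)) (sym (subtree-node sT t⊑)) (∈ᵗ⇒∈ (proj₂ (Er eq) eb))
  }
  where
  open Embedding E
  sT = proj₁ T∈
  injective : ∀ {i j} → i ∈[ k p ] → j ∈[ k p ] → f i ≡ f j → i ≡ j
  injective {i} {j} i∈ j∈ eq with <-cmp i j
  ... | tri< i<j _ _ =
    contradiction (monotone (label⇒∈ (P∈𝒯k p) i∈) (label⇒∈ (P∈𝒯k p) j∈) i<j) (<-irrefl eq)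
  ... | tri≈ _ i≡j _ = i≡j
  ... | tri> _ _ j<i =
    contradiction (monotone (label⇒∈ (P∈𝒯k p) j∈) (label⇒∈ (P∈𝒯k p) i∈) j<i) (<-irrefl (sym eq))
  node⇒⊑ : ∀ i {t} → subtree (P p) i ≡ t → t ≢ ε → node (left t) i (right t) ⊑ P p
  node⇒⊑ i {ε} eq t≢ε = contradiction refl t≢ε
  node⇒⊑ i {node l x r} eq _ with subtree-label (P p) i eq
  ... | refl = subst (_⊑ P p) eq (subtree-⊑ (P p) i)
  cL⇒⊑ : ∀ i {j} → cL (P p) i ≡ just j → node (L (P p) i) i (R (P p) i) ⊑ P p
  cL⇒⊑ i eq = node⇒⊑ i refl (λ ε≡ → case trans (sym eq) (cong (root ∘ left) ε≡) of λ ())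
  cR⇒⊑ : ∀ i {j} → cR (P p) i ≡ just j → node (L (P p) i) i (R (P p) i) ⊑ P p
  cR⇒⊑ i eq = node⇒⊑ i refl (λ ε≡ → case trans (sym eq) (cong (root ∘ right) ε≡) of λ ())

below⇒Contains : ∀ {n T r} p → T ∈𝒯 n → root (P p) ≡ just r → below (e p) (P p) T ≡ true → Contains n T p
below⇒Contains {T = T} p T∈ eq m with P p in eqP
below⇒Contains {T = T} p T∈ refl m | node l a r =
  let f , E = below⇒Embedding (e p) T (subst SearchTree eqP (proj₁ (P∈𝒯k p))) (proj₁ T∈) m
  in Embedding⇒Contains {f = f} T∈ (subst (λ Q → Embedding (e p) f Q T) (sym eqP) E)

-- Friendly patterns

-- What friendliness says about the right branch, in a form suited to recursion down that branch.
-- `last` is the vertex k with condition (iii); `more` holds condition (ii): the edge to the next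
-- branch vertex may be contiguous only if that vertex is the last one.
data Spine (e : ℕ → Bool) : Tree → Set where
  last : ∀ {x c z k} → (e k ≡ true → e c ≡ false) → Spine e (node (node x c z) k ε)
  more : ∀ {l a r} → Spine e r → (∀ {b} → root r ≡ just b → e b ≡ true → right r ≡ ε) →
         Spine e (node l a r)

child-∈ : ∀ {T i j} → Parent T i j → j ∈ᵗ T
child-∈ {T} {i} (inj₁ eq) = ∈-⊑ (L-⊑ T i) (root⇒∈ eq)
child-∈ {T} {i} (inj₂ eq) = ∈-⊑ (R-⊑ T i) (root⇒∈ eq)

module _ (p : Pattern) (F : Friendly p) where
  open Friendly F

  private
    sP : SearchTree (P p)
    sP = proj₁ (P∈𝒯k p)

    1≤ : ∀ i → i ∈ᵗ P p → 1 ≤ i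
    1≤ i i∈ = proj₁ (∈⇒label (P∈𝒯k p) i∈)

    ≤k : ∀ i → i ∈ᵗ P p → i ≤ k p
    ≤k i i∈ = proj₂ (∈⇒label (P∈𝒯k p) i∈)

    k∈P : k p ∈ᵗ P p
    k∈P = child-∈ (proj₂ k-has-parent)

    -- The descent along the right branch ends at k, because the largest label has no right child
    -- and lies in no left subtree. The premise on `B-R` remembers that the branch began at the
    -- root, as condition (ii) requires.
    spine : ∀ {r} → root (P p) ≡ just r → ∀ Q → Q ⊑ P p →
            (∀ {a} → root Q ≡ just a → B-R (P p) r a) → k p ∈ᵗ Q → Spine (e p) Q
    spine _ (node ε a ε) Q⊑ _ at-root =
      contradiction (cong (root ∘ left) (subtree-node sP Q⊑)) k-has-left-child
    spine _ (node (node x c z) a ε) Q⊑ _ at-root =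
      last (k-edges (cong (root ∘ left) (subtree-node sP Q⊑)))
    spine _ (node l a ε) Q⊑ _ (in-left k∈) =
      contradiction (left-< (SearchTree-⊑ Q⊑ sP) k∈) (≤⇒≯ (≤k _ (∈-⊑ Q⊑ at-root)))
    spine _ (node l a (node _ b _)) Q⊑ _ at-root =
      contradiction (right-> (SearchTree-⊑ Q⊑ sP) at-root) (≤⇒≯ (≤k _ (∈-⊑ Q⊑ (in-right at-root))))
    spine _ (node l a (node _ b _)) Q⊑ _ (in-left k∈) =
      contradiction (left-< (SearchTree-⊑ Q⊑ sP) k∈) (≤⇒≯ (≤k _ (∈-⊑ Q⊑ at-root)))
    spine {r} r≡ (node l a Q′@(node l′ b r′)) Q⊑ br (in-right k∈) =
      more (spine r≡ Q′ Q′⊑ (λ { refl → B-Rb }) k∈) λ { refl eb → edge r′ refl eb }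
      where
      Q′⊑ : Q′ ⊑ P p
      Q′⊑ = ⊑-trans (⊑-right ⊑-refl) Q⊑
      cRa : cR (P p) a ≡ just b
      cRa = cong (root ∘ right) (subtree-node sP Q⊑)
      B-Rb : B-R (P p) r b
      B-Rb = next (br refl) cRa
      -- Condition (ii) exempts the root of the pattern, so `b` has to be told apart from it: `b` is
      -- a right child, and the root is nobody's child.
      b≢r : b ≢ r
      b≢r refl with P p | root⇒node {P p} r≡ | sP | cRa
      ... | _ | _ , _ , refl | s | eq = ¬parent-of-root {i = a} s (inj₂ eq)
      edge : ∀ t → t ≡ r′ → e p b ≡ true → t ≡ ε
      edge ε            _    _  = refl
      edge (node _ _ _) refl eb = case trans (sym eb) (branch r≡ (B-Rb , has-right) b≢r) of λ ()
        where
        has-right : cR (P p) b ≢ nothing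
        has-right eq = case trans (sym eq) (cong (root ∘ right) (subtree-node sP Q′⊑)) of λ ()

  Friendly⇒root : ∃ λ r → root (P p) ≡ just r
  Friendly⇒root with P p | k∈P
  ... | node _ r _ | _ = r , refl

  Friendly⇒Spine : Spine (e p) (P p)
  Friendly⇒Spine with Friendly⇒root
  ... | r , eq = spine eq (P p) ⊑-refl (λ eq′ → subst (B-R (P p) r) (just-injective (trans (sym eq) eq′)) here) k∈P

  -- Without a right subtree the root would carry the largest label k, but k has a parent.
  Friendly⇒right : right (P p) ≢ ε
  Friendly⇒right eq with P p | sP | ≤k | k∈P | k-has-parent
  Friendly⇒right refl | node l a ε | s | _  | at-root    | i , par = ¬parent-of-root {i = i} s par
  Friendly⇒right refl | node l a ε | s | ≤k | in-left k∈ | _ =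
    contradiction (left-< s k∈) (≤⇒≯ (≤k _ at-root))

  -- The root and its right child are two labels, the smaller of which is at least 1. This handles
  -- trees with one vertex and absorbs constants in the time bounds.
  Friendly⇒2≤k : 2 ≤ k p
  Friendly⇒2≤k with P p | sP | ≤k | Friendly⇒right | 1≤
  ... | ε | _ | _ | r≢ε | _ = contradiction refl r≢ε
  ... | node l a ε | _ | _ | r≢ε | _ = contradiction refl r≢ε
  ... | node l a (node _ b _) | s | ≤k | _ | lab =
    ≤-trans (s≤s (lab _ at-root)) (≤-trans (right-> s at-root) (≤k _ (in-right at-root)))

-- Inserting the largest label on the right branch

height : Tree → ℕ
height ε            = 0
height (node _ _ r) = suc (height r)

-- At depth d of the right branch; a depth below the bottom means the bottom.
insert : ℕ → ℕ → Tree → Tree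
insert m zero    T            = node T m ε
insert m (suc d) ε            = node ε m ε
insert m (suc d) (node l i r) = node l i (insert m d r)

bottom top : ℕ → Tree → Tree
bottom m T = insert m (height T) T
top    m T = node T m ε

module _ (e : ℕ → Bool) (m : ℕ) where

  -- If the edge above the largest vertex k of Q is broken by m, then m itself
  -- can play the role of k.
  child-last : ∀ {Q b} → Spine e Q → root Q ≡ just b → e b ≡ true → right Q ≡ ε → ∀ d t →
    at e Q t ≡ true → at e Q (insert m d t) ≡ true
  child-last {node (node x c z) k ε} (last ec) refl ek refl zero (node u i v) a
    with e c | ec ek
  ... | false | refl = ∧-intro (below-left e (node x c z) {i = i} {z = v} (proj₁ (∧-elim a))) refl
  child-last {node _ _ ε} (more () _) _ _ _ _ _ _
  child-last {node _ _ ε} (last _) _ _ refl (suc d) (node _ _ _) a = a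

  below-insert : ∀ {Q} → Spine e Q → ∀ d t → below e Q t ≡ true → below e Q (insert m d t) ≡ true
  -- Inserting into the right subtree can only damage the edge to the right child of the pattern's
  -- root. If that edge is not contiguous, the occurrence below it may move; if it is, `Spine` makes
  -- the child the last branch vertex and `child-last` applies.
  at-insert : ∀ {Q} → Spine e Q → ∀ d {l i} r → at e Q (node l i r) ≡ true → at e Q (node l i (insert m d r)) ≡ true

  below-insert {Q} S zero t b = below-left e Q {i = m} {z = ε} b
  below-insert {Q} S (suc d) (node l i r) b with ∨-elim {at e Q (node l i r)} b
  ... | inj₁ b₀ = at⇒below e Q (at-insert S d r b₀)
  ... | inj₂ b′ with ∨-elim {below e Q l} b′
  ... | inj₁ b₁ = below-left e Q b₁
  ... | inj₂ b₂ = below-right e Q {l} {i} {insert m d r} (below-insert S d r b₂)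

  at-insert (last _) d r a = a
  at-insert (more {r = Q@(node _ b _)} S edge) d {l} r a with ∧-elim a
  ... | al , ar = ∧-intro al (go (e b) refl ar)
    where
    go : ∀ b? → e b ≡ b? → (if b? then at e Q r else below e Q r) ≡ true → child e Q (insert m d r) ≡ true
    go true  eb a = trans (cong (if_then at e Q (insert m d r) else below e Q (insert m d r)) eb)
                      (child-last S refl eb (edge refl eb) d r a)
    go false eb a = trans (cong (if_then at e Q (insert m d r) else below e Q (insert m d r)) eb)
                      (below-insert S d r a)

  child-ε : ∀ l b r → child e (node l b r) ε ≡ false
  child-ε _ b _ with e b
  ... | true  = refl
  ... | false = refl

  -- The root of such a pattern has a child, on the left in the case `last` and on the right in the
  -- case `more`, and a leaf offers no place for it.
  at-leaf : ∀ {Q} → Spine e Q → at e Q (node ε m ε) ≡ false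
  at-leaf (last {x} {c} {z} _) rewrite child-ε x c z = refl
  at-leaf (more {l = l} {r = node x c z} _ _) rewrite child-ε x c z with child e l ε
  ... | true  = refl
  ... | false = refl

  -- An occurrence can never use the new leaf: at `last` the right subtree of the tree is not
  -- inspected at all, and at `more` the recursion follows both right branches and could only end by
  -- matching the leaf.
  at-bottom⁻ : ∀ {Q} → Spine e Q → ∀ t → at e Q (bottom m t) ≡ true → at e Q t ≡ true
  below-bottom⁻ : ∀ {Q} → Spine e Q → ∀ t → below e Q (bottom m t) ≡ true → below e Q t ≡ true

  at-bottom⁻ S ε a = case trans (sym a) (at-leaf S) of λ ()
  at-bottom⁻ (last _) (node l i r) a = a
  at-bottom⁻ (more {r = Q@(node _ b _)} S _) (node l i r) a with ∧-elim a
  ... | al , ar = ∧-intro al (go (e b) refl ar)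
    where
    go : ∀ b? → e b ≡ b? → (if b? then at e Q (bottom m r) else below e Q (bottom m r)) ≡ true →
         child e Q r ≡ true
    go true  eb a = trans (cong (if_then at e Q r else below e Q r) eb) (at-bottom⁻ S r a)
    go false eb a = trans (cong (if_then at e Q r else below e Q r) eb) (below-bottom⁻ S r a)

  below-bottom⁻ {Q} S ε b rewrite at-leaf S = case b of λ ()
  below-bottom⁻ {Q} S t@(node l i r) b with ∨-elim {at e Q (bottom m t)} b
  ... | inj₁ b₀ = at⇒below e Q (at-bottom⁻ S t b₀)
  ... | inj₂ b′ with ∨-elim {below e Q l} b′
  ... | inj₁ b₁ = below-left e Q {i = i} {z = r} b₁
  ... | inj₂ b₂ = below-right e Q {l} {i} (below-bottom⁻ S r b₂)

  -- The new root has no right subtree while the pattern's root has one, so an occurrence is not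
  -- rooted there and lies within `t`.
  below-top⁻ : ∀ {Q} → Spine e Q → right Q ≢ ε → ∀ t → below e Q (top m t) ≡ true → below e Q t ≡ true
  below-top⁻ {node l a ε} S r≢ε t b = contradiction refl r≢ε
  below-top⁻ {Q@(node l a (node x c z))} S _ t b with ∨-elim {at e Q (top m t)} b
  ... | inj₁ b₀ = case trans (sym (proj₂ (∧-elim {child e l t} b₀))) (child-ε x c z) of λ ()
  ... | inj₂ b′ with ∨-elim {below e Q t} b′
  ... | inj₁ b₁ = b₁

insert-vertices : ∀ m d T → vertices (insert m d T) ≡ vertices T ++ [ m ]
insert-vertices m zero    T            = refl
insert-vertices m (suc d) ε            = refl
insert-vertices m (suc d) (node l i r) =
  trans (cong (λ vs → vertices l ++ i ∷ vs) (insert-vertices m d r)) (sym (++-assoc (vertices l) _ _))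

insert-SearchTree : ∀ {m} d {T} → SearchTree T → (∀ {i} → i ∈ᵗ T → i < m) → SearchTree (insert m d T)
insert-SearchTree zero {T} sT <m = All.tabulate (λ i∈ → <m (∈⇒∈ᵗ T i∈)) , [] , sT , tt
insert-SearchTree (suc d) {ε} sT <m = [] , [] , tt , tt
insert-SearchTree {m} (suc d) {node l i r} (<i , i< , sl , sr) <m =
  <i , subst (All (i <_)) (sym (insert-vertices m d r)) (++⁺ i< (<m at-root ∷ [])) , sl ,
  insert-SearchTree d sr (λ j∈ → <m (in-right j∈))

insert-SearchTree⁻ : ∀ {m} d {T} → SearchTree (insert m d T) → SearchTree T
insert-SearchTree⁻ zero (_ , _ , sT , _) = sT
insert-SearchTree⁻ (suc d) {ε} _ = tt
insert-SearchTree⁻ {m} (suc d) {node l i r} (<i , i< , sl , sr) =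
  <i , proj₁ (++⁻ (vertices r) (subst (All (i <_)) (insert-vertices m d r) i<)) , sl , insert-SearchTree⁻ d sr

insert-∈ : ∀ m d T {i} → i ∈ᵗ T → i ∈ᵗ insert m d T
insert-∈ m d T i∈ = ∈⇒∈ᵗ _ (subst (_ ∈_) (sym (insert-vertices m d T)) (∈-++⁺ˡ (∈ᵗ⇒∈ i∈)))

insert-∈-max : ∀ m d T → m ∈ᵗ insert m d T
insert-∈-max m d T = ∈⇒∈ᵗ _ (subst (m ∈_) (sym (insert-vertices m d T)) (∈-++⁺ʳ (vertices T) (here refl)))

insert-∈⁻ : ∀ m d T {i} → i ∈ᵗ insert m d T → i ∈ᵗ T ⊎ i ≡ m
insert-∈⁻ m d T i∈ with ∈-++⁻ (vertices T) (subst (_ ∈_) (insert-vertices m d T) (∈ᵗ⇒∈ i∈))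
... | inj₁ i∈T         = inj₁ (∈⇒∈ᵗ T i∈T)
... | inj₂ (here refl) = inj₂ refl

∈𝒯-intro : ∀ {n T} → SearchTree T → (∀ {i} → i ∈ᵗ T → i ∈[ n ]) → (∀ {i} → i ∈[ n ] → i ∈ᵗ T) → T ∈𝒯 n
∈𝒯-intro {T = T} sT to from = sT , λ i → mk⇔ (λ i∈ → to (∈⇒∈ᵗ T i∈)) (λ i∈ → ∈ᵗ⇒∈ (from i∈))

insert-∈𝒯 : ∀ {n T} d → T ∈𝒯 n → insert (suc n) d T ∈𝒯 suc n
insert-∈𝒯 {n} {T} d T∈ =
  ∈𝒯-intro (insert-SearchTree d (proj₁ T∈) (λ i∈ → s≤s (proj₂ (∈⇒label T∈ i∈)))) to from
  where
  to : ∀ {i} → i ∈ᵗ insert (suc n) d T → i ∈[ suc n ]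
  to i∈ with insert-∈⁻ (suc n) d T i∈
  ... | inj₁ i∈T  = let 1≤i , i≤n = ∈⇒label T∈ i∈T in 1≤i , m≤n⇒m≤1+n i≤n
  ... | inj₂ refl = s≤s z≤n , ≤-refl
  from : ∀ {i} → i ∈[ suc n ] → i ∈ᵗ insert (suc n) d T
  from (1≤i , i≤m) with m≤n⇒m<n∨m≡n i≤m
  ... | inj₁ (s≤s i≤n) = insert-∈ (suc n) d T (label⇒∈ T∈ (1≤i , i≤n))
  ... | inj₂ refl      = insert-∈-max (suc n) d T

insert-max-∉ : ∀ {m} d T → SearchTree (insert m d T) → ¬ m ∈ᵗ T
insert-max-∉ zero T s m∈ = <-irrefl refl (left-< s m∈)
insert-max-∉ {m} (suc d) (node l i r) s at-root = <-irrefl refl (right-> s (insert-∈-max m d r))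
insert-max-∉ {m} (suc d) (node l i r) s (in-left m∈) =
  <-irrefl refl (<-trans (left-< s m∈) (right-> s (insert-∈-max m d r)))
insert-max-∉ (suc d) (node l i r) (_ , _ , _ , sr) (in-right m∈) = insert-max-∉ d r sr m∈

insert-∈𝒯⁻ : ∀ {n T} d → insert (suc n) d T ∈𝒯 suc n → T ∈𝒯 n
insert-∈𝒯⁻ {n} {T} d T⁺∈ = ∈𝒯-intro (insert-SearchTree⁻ d (proj₁ T⁺∈)) to from
  where
  to : ∀ {i} → i ∈ᵗ T → i ∈[ n ]
  to i∈ with ∈⇒label T⁺∈ (insert-∈ (suc n) d T i∈)
  ... | 1≤i , i≤m with m≤n⇒m<n∨m≡n i≤m
  ... | inj₁ (s≤s i≤n) = 1≤i , i≤n
  ... | inj₂ refl      = contradiction i∈ (insert-max-∉ d T (proj₁ T⁺∈))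
  from : ∀ {i} → i ∈[ n ] → i ∈ᵗ T
  from (1≤i , i≤n) with insert-∈⁻ (suc n) d T (label⇒∈ T⁺∈ (1≤i , m≤n⇒m≤1+n i≤n))
  ... | inj₁ i∈T  = i∈T
  ... | inj₂ refl = contradiction i≤n (<-irrefl refl)

-- The largest label lies on the right branch and has no right child, so removing it only puts its
-- left subtree in its place.
∃insert : ∀ {m T} → SearchTree T → m ∈ᵗ T → (∀ {i} → i ∈ᵗ T → i ≤ m) →
  ∃₂ λ d T′ → d ≤ height T′ × T ≡ insert m d T′
∃insert {T = node l _ ε} _ at-root _ = 0 , l , z≤n , refl
∃insert {T = node l _ (node _ _ _)} sT at-root ≤m =
  contradiction (right-> sT at-root) (≤⇒≯ (≤m (in-right at-root)))
∃insert sT (in-left m∈) ≤m = contradiction (left-< sT m∈) (≤⇒≯ (≤m at-root))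
∃insert {T = node l x r} (_ , _ , _ , sr) (in-right m∈) ≤m =
  let d , r′ , d≤h , eq = ∃insert sr m∈ (λ i∈ → ≤m (in-right i∈))
  in suc d , node l x r′ , s≤s d≤h , cong (node l x) eq

∈𝒯⇒insert : ∀ {n T} → T ∈𝒯 suc n → ∃₂ λ d T′ → d ≤ height T′ × T ≡ insert (suc n) d T′
∈𝒯⇒insert T∈ = ∃insert (proj₁ T∈) (label⇒∈ T∈ (s≤s z≤n , ≤-refl)) (λ i∈ → proj₂ (∈⇒label T∈ i∈))

node-injective : ∀ {l i r l′ i′ r′} → node l i r ≡ node l′ i′ r′ → l ≡ l′ × i ≡ i′ × r ≡ r′
node-injective refl = refl , refl , refl

-- The depth at which `m` occurs on the right branch can be read off the result. The bounds are
-- essential, as all depths beyond the height mean the bottom.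
insert-injective : ∀ {m d d′ T T′} → ¬ m ∈ᵗ T → ¬ m ∈ᵗ T′ → d ≤ height T → d′ ≤ height T′ →
  insert m d T ≡ insert m d′ T′ → d ≡ d′ × T ≡ T′
insert-injective {d = zero} {zero} m∉ m∉′ _ _ eq = refl , proj₁ (node-injective eq)
insert-injective {d = zero} {suc d′} {T′ = node l i r} m∉ m∉′ _ _ eq =
  contradiction (subst (_∈ᵗ node l i r) (sym (proj₁ (proj₂ (node-injective eq)))) at-root) m∉′
insert-injective {d = suc d} {zero} {T = node l i r} m∉ m∉′ _ _ eq =
  contradiction (subst (_∈ᵗ node l i r) (proj₁ (proj₂ (node-injective eq))) at-root) m∉
insert-injective {d = suc d} {suc d′} {node l i r} {node _ _ _} m∉ m∉′ (s≤s d≤) (s≤s d′≤) eq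
  with node-injective eq
... | refl , refl , eq′ with insert-injective (λ m∈ → m∉ (in-right m∈)) (λ m∈ → m∉′ (in-right m∈)) d≤ d′≤ eq′
... | refl , refl = refl , refl

-- The languages of pattern-avoiding trees

module _ {n : ℕ} {p : Pattern} (F : Friendly p) where
  private
    r≡ = proj₂ (Friendly⇒root p F)
    S = Friendly⇒Spine p F

  Contains-insert : ∀ {T} d → T ∈𝒯 n → Contains n T p → Contains (suc n) (insert (suc n) d T) p
  Contains-insert {T} d T∈ c = below⇒Contains p (insert-∈𝒯 d T∈) r≡
    (below-insert (e p) (suc n) S d T (Contains⇒below T∈ c r≡))

  Contains-bottom⁻ : ∀ {T} → T ∈𝒯 n → Contains (suc n) (bottom (suc n) T) p → Contains n T p
  Contains-bottom⁻ {T} T∈ c = below⇒Contains p T∈ r≡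
    (below-bottom⁻ (e p) (suc n) S T (Contains⇒below (insert-∈𝒯 (height T) T∈) c r≡))

  Contains-top⁻ : ∀ {T} → T ∈𝒯 n → Contains (suc n) (top (suc n) T) p → Contains n T p
  Contains-top⁻ {T} T∈ c = below⇒Contains p T∈ r≡
    (below-top⁻ (e p) (suc n) S (Friendly⇒right p F) T (Contains⇒below (insert-∈𝒯 0 T∈) c r≡))

Contains? : ∀ {n T p} → Friendly p → T ∈𝒯 n → Dec (Contains n T p)
Contains? {n} {T} {p} F T∈ with below (e p) (P p) T in eq
... | true  = yes (below⇒Contains p T∈ (proj₂ (Friendly⇒root p F)) eq)
... | false = no (λ c → case trans (sym eq) (Contains⇒below T∈ c (proj₂ (Friendly⇒root p F))) of λ ())

avoidance-map : ∀ {n n′ T T′ ps} → (∀ {p} → Friendly p → Contains n′ T′ p → Contains n T p) →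
  All Friendly ps → All (λ p → ¬ Contains n T p) ps → All (λ p → ¬ Contains n′ T′ p) ps
avoidance-map f Fs av = All.zipWith (λ { (F , ¬c) c → ¬c (f F c) }) (Fs , av)

module _ {n : ℕ} {ps : List Pattern} (Fs : All Friendly ps) where

  𝒯-bottom : ∀ {T} → 𝒯 n ps T → 𝒯 (suc n) ps (bottom (suc n) T)
  𝒯-bottom {T} (T∈ , av) = insert-∈𝒯 (height T) T∈ , avoidance-map (λ F → Contains-bottom⁻ F T∈) Fs av

  𝒯-top : ∀ {T} → 𝒯 n ps T → 𝒯 (suc n) ps (top (suc n) T)
  𝒯-top (T∈ , av) = insert-∈𝒯 0 T∈ , avoidance-map (λ F → Contains-top⁻ F T∈) Fs av

  𝒯-insert⁻ : ∀ {T} d → 𝒯 (suc n) ps (insert (suc n) d T) → 𝒯 n ps T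
  𝒯-insert⁻ d (T⁺∈ , av) =
    insert-∈𝒯⁻ d T⁺∈ , avoidance-map (λ F → Contains-insert F d (insert-∈𝒯⁻ d T⁺∈)) Fs av

  𝒯-dec : ∀ {T} → T ∈𝒯 n → Dec (𝒯 n ps T)
  𝒯-dec {T} T∈ = go Fs
    where
    go : ∀ {qs} → All Friendly qs → Dec (T ∈𝒯 n × All (λ p → ¬ Contains n T p) qs)
    go [] = yes (T∈ , [])
    go (F ∷ Fs) with Contains? F T∈ | go Fs
    ... | yes c | _ = no (λ (_ , av) → All.head av c)
    ... | no ¬c | yes (_ , av) = yes (T∈ , ¬c ∷ av)
    ... | no ¬c | no ¬av = no (λ (_ , av) → ¬av (T∈ , All.tail av))

-- Slides of the largest label and of the other labels

≡ᵇ-refl : ∀ i → (i ≡ᵇ i) ≡ true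
≡ᵇ-refl zero    = refl
≡ᵇ-refl (suc i) = ≡ᵇ-refl i

≢⇒≡ᵇ : ∀ {i j} → i ≢ j → (i ≡ᵇ j) ≡ false
≢⇒≡ᵇ {zero}  {zero}  i≢j = contradiction refl i≢j
≢⇒≡ᵇ {zero}  {suc j} _   = refl
≢⇒≡ᵇ {suc i} {zero}  _   = refl
≢⇒≡ᵇ {suc i} {suc j} i≢j = ≢⇒≡ᵇ (i≢j ∘ cong suc)

update-≡ : ∀ {A : Set} (a : ℕ → A) i v → (a [ i ↦ v ]) i ≡ v
update-≡ a i v rewrite ≡ᵇ-refl i = refl

update-≢ : ∀ {A : Set} (a : ℕ → A) i v {j} → j ≢ i → (a [ i ↦ v ]) j ≡ a j
update-≢ a i v j≢i rewrite ≢⇒≡ᵇ j≢i = refl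

update-cong : ∀ {A : Set} (a b : ℕ → A) {v w} i j → a j ≡ b j → v ≡ w → (a [ i ↦ v ]) j ≡ (b [ i ↦ w ]) j
update-cong a b i j aj≡bj v≡w with j ≡ᵇ i
... | true  = v≡w
... | false = aj≡bj

turn-s-cong : ∀ {𝓛 𝓛′ n n′} j s s′ i → s i ≡ s′ i → s (j ∸ 1) ≡ s′ (j ∸ 1) →
  AlgorithmH.turn-s 𝓛 n j s i ≡ AlgorithmH.turn-s 𝓛′ n′ j s′ i
turn-s-cong j s s′ i si sj =
  update-cong (s [ j ↦ s (j ∸ 1) ]) (s′ [ j ↦ s′ (j ∸ 1) ]) (j ∸ 1) i (update-cong s s′ j i si sj) refl

-- Sweeps of the largest label between the two extremes

insert-up : ∀ m d T → suc d ≤ height T → UpRotation m (insert m (suc d) T) (insert m d T)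
insert-up m zero    (node l i r) _       = here
insert-up m (suc d) (node l i r) (s≤s d<) = inʳ (insert-up m d r d<)

¬up-top : ∀ {m T X} → ¬ m ∈ᵗ T → ¬ UpRotation m (insert m 0 T) X
¬up-top m∉ (inˡ ρ)  = m∉ (Rotation-∈ ↑ ρ)
¬up-top m∉ (inʳ ())

¬down-bottom : ∀ {m} T {X} → ¬ m ∈ᵗ T → ¬ UpRotation m X (bottom m T)
¬down-bottom ε m∉ (inˡ ())
¬down-bottom ε m∉ (inʳ ())
¬down-bottom (node _ _ _) m∉ here    = m∉ at-root
¬down-bottom (node _ _ _) m∉ (inˡ ρ) = m∉ (in-left (Rotation-∈ ↓ ρ))
¬down-bottom (node _ _ r) m∉ (inʳ ρ) = ¬down-bottom r (m∉ ∘ in-right) ρ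

start-of : Direction → ℕ → Tree → Tree
start-of ↑ = bottom
start-of ↓ = top

-- The last argument counts rotations whatever the direction, so that upward and downward sweeps
-- share all later arguments.
sweep-position : Direction → ℕ → Tree → ℕ → Tree
sweep-position ↑ m T t = insert m (height T ∸ t) T
sweep-position ↓ m T t = insert m t T

sweep-start : ∀ δ m T → sweep-position δ m T 0 ≡ start-of δ m T
sweep-start ↑ m T = refl
sweep-start ↓ m T = refl

sweep-end : ∀ δ m T → sweep-position δ m T (height T) ≡ start-of (opposite δ) m T
sweep-end ↑ m T = cong (λ d → insert m d T) (n∸n≡0 (height T))
sweep-end ↓ m T = refl

∸-suc′ : ∀ {t h} → t < h → h ∸ t ≡ suc (h ∸ suc t)
∸-suc′ {zero}  (s≤s _)   = refl
∸-suc′ {suc t} (s≤s t<h) = ∸-suc′ t<h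

sweep-rotation : ∀ δ m T {t} → t < height T → Rotation δ m (sweep-position δ m T t) (sweep-position δ m T (suc t))
sweep-rotation ↑ m T {t} t<h = subst (λ d → UpRotation m (insert m d T) (insert m (height T ∸ suc t) T))
  (sym (∸-suc′ t<h)) (insert-up m (height T ∸ suc t) T (subst (_≤ height T) (∸-suc′ t<h) (m∸n≤m (height T) t)))
sweep-rotation ↓ m T {t} t<h = insert-up m t T t<h

Rotation-reverse : ∀ δ {j T T′} → Rotation δ j T T′ → Rotation (opposite δ) j T′ T
Rotation-reverse ↑ ρ = ρ
Rotation-reverse ↓ ρ = ρ

¬rotation-end : ∀ δ m T {X} → ¬ m ∈ᵗ T → ¬ Rotation δ m (sweep-position δ m T (height T)) X
¬rotation-end ↑ m T m∉ ρ rewrite n∸n≡0 (height T) = ¬up-top m∉ ρ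
¬rotation-end ↓ m T m∉ ρ = ¬down-bottom T m∉ ρ

¬rotation-start : ∀ δ m T {X} → ¬ m ∈ᵗ T → ¬ Rotation (opposite δ) m (sweep-position δ m T 0) X
¬rotation-start ↑ m T m∉ ρ = ¬down-bottom T m∉ ρ
¬rotation-start ↓ m T m∉ ρ = ¬up-top m∉ ρ

∃sweep-position : ∀ δ m T {d} → d ≤ height T → ∃ λ t → t ≤ height T × insert m d T ≡ sweep-position δ m T t
∃sweep-position ↑ m T {d} d≤h = height T ∸ d , m∸n≤m (height T) d , cong (λ d → insert m d T) (sym (m∸[m∸n]≡n d≤h))
∃sweep-position ↓ m T {d} d≤h = d , d≤h , refl

sweep-position-insert : ∀ δ m T {t} → t ≤ height T → ∃ λ d → d ≤ height T × sweep-position δ m T t ≡ insert m d T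
sweep-position-insert ↑ m T {t} t≤h = height T ∸ t , m∸n≤m (height T) t , refl
sweep-position-insert ↓ m T {t} t≤h = t , t≤h , refl

sweep-position-injective : ∀ δ m T {t u} → ¬ m ∈ᵗ T → t ≤ height T → u ≤ height T →
  sweep-position δ m T t ≡ sweep-position δ m T u → t ≡ u
sweep-position-injective ↑ m T {t} {u} m∉ t≤ u≤ eq =
  ∸-cancelˡ-≡ t≤ u≤ (proj₁ (insert-injective {T = T} m∉ m∉ (m∸n≤m (height T) t) (m∸n≤m (height T) u) eq))
sweep-position-injective ↓ m T m∉ t≤ u≤ eq = proj₁ (insert-injective {T = T} m∉ m∉ t≤ u≤ eq)

-- Insertion on the right branch alters right subtrees only. This is why left children, and with
-- them the turn conditions of smaller labels, survive it.
insert-node : ∀ m d {T l j r} → node l j r ⊑ T → ∃ λ r′ → node l j r′ ⊑ insert m d T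
insert-node m zero    p           = _ , ⊑-left p
insert-node m (suc d) ⊑-refl      = _ , ⊑-refl
insert-node m (suc d) (⊑-left p)  = _ , ⊑-left p
insert-node m (suc d) (⊑-right p) = let r′ , q = insert-node m d p in r′ , ⊑-right q

cL-node : ∀ {T l j r} → SearchTree T → node l j r ⊑ T → cL T j ≡ root l
cL-node sT p = cong (root ∘ left) (subtree-node sT p)

cR-node : ∀ {T l j r} → SearchTree T → node l j r ⊑ T → cR T j ≡ root r
cR-node sT p = cong (root ∘ right) (subtree-node sT p)

cL-insert : ∀ {m d T j} → SearchTree (insert m d T) → j ∈ᵗ T → cL (insert m d T) j ≡ cL T j
cL-insert {m} {d} {T} sT⁺ j∈ =
  let l , r , p = ∈⇒⊑ j∈
      r′ , q = insert-node m d p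
  in trans (cL-node sT⁺ q) (sym (cL-node (insert-SearchTree⁻ d sT⁺) p))

Parent-∈ : ∀ {T i j} → Parent T i j → i ∈ᵗ T
Parent-∈ {T} {i} par with subtree T i in eq
Parent-∈ {T} {i} (inj₁ ()) | ε
Parent-∈ {T} {i} (inj₂ ()) | ε
Parent-∈ {T} {i} par | node l x r with subtree-label T i eq
... | refl = ∈-⊑ (subst (_⊑ T) eq (subtree-⊑ T i)) at-root

-- Turns the comparison in the turn condition into a statement about left children, which insertion
-- preserves.
Parent->⇒cL : ∀ {T i j} → SearchTree T → Parent T i j → j < i → cL T i ≡ just j
Parent->⇒cL sT (inj₁ eq) _ = eq
Parent->⇒cL {T} {i} sT par@(inj₂ eq) j<i with ∈⇒⊑ (Parent-∈ {T} par)
... | l , r , p =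
  contradiction (right-> (SearchTree-⊑ p sT) (root⇒∈ (trans (sym (cR-node sT p)) eq))) (<-asym j<i)

insert-max-⊑ : ∀ m d T → d < height T → ∃₂ λ l x → ∃ λ r → node (node l x r) m ε ⊑ insert m d T
insert-max-⊑ m zero    (node l x r) _        = l , x , r , ⊑-refl
insert-max-⊑ m (suc d) (node l x r) (s≤s d<) = let a , b , c , p = insert-max-⊑ m d r d< in a , b , c , ⊑-right p

bottom-max-⊑ : ∀ m T → node ε m ε ⊑ bottom m T
bottom-max-⊑ m ε            = ⊑-refl
bottom-max-⊑ m (node _ _ r) = ⊑-right (bottom-max-⊑ m r)

module _ {n : ℕ} where
  open AlgorithmH

  Turn-end : ∀ {𝓛} δ {T} → T ∈𝒯 n → Turn 𝓛 (suc n) δ (suc n) (sweep-position δ (suc n) T (height T))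
  Turn-end ↑ {T} T∈ rewrite n∸n≡0 (height T) = inj₁ refl
  Turn-end ↓ {T} T∈ = cL-node (proj₁ (insert-∈𝒯 (height T) T∈)) (bottom-max-⊑ (suc n) T)

  ¬Turn-before-end : ∀ {𝓛} δ {T t} → T ∈𝒯 n → t < height T →
    ¬ Turn 𝓛 (suc n) δ (suc n) (sweep-position δ (suc n) T t)
  ¬Turn-before-end ↑ {T} {t} T∈ t<h (inj₁ eq) with height T ∸ t | ∸-suc′ t<h
  ¬Turn-before-end ↑ {node l i r} {t} T∈ t<h (inj₁ eq) | _ | refl =
    contradiction (proj₂ (∈⇒label T∈ (subst (_∈ᵗ node l i r) (just-injective eq) at-root))) (<-irrefl refl)
  ¬Turn-before-end ↑ {T} {t} T∈ t<h (inj₂ (i , par , i>m)) =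
    contradiction (proj₂ (∈⇒label (insert-∈𝒯 (height T ∸ t) T∈) (Parent-∈ par))) (<⇒≱ i>m)
  ¬Turn-before-end ↓ {T} {t} T∈ t<h eq =
    let _ , _ , _ , p = insert-max-⊑ (suc n) t T t<h
    in case trans (sym eq) (cL-node (proj₁ (insert-∈𝒯 t T∈)) p) of λ ()

start-of-up : ∀ δ {m j T X} → UpRotation j T X → UpRotation j (start-of δ m T) (start-of δ m X)
start-of-up ↓ ρ       = inˡ ρ
start-of-up ↑ here    = here
start-of-up ↑ (inˡ ρ) = inˡ ρ
start-of-up ↑ (inʳ ρ) = inʳ (start-of-up ↑ ρ)

-- At an extreme, `m` does not get in the way: at the top it has no right child to be rotated over
-- it, and at the bottom the only rotation involving it as a moving vertex is its own, which `j ≢ m`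
-- excludes.
start-of-up⁻ : ∀ δ {m j} T {X} → j ≢ m → UpRotation j (start-of δ m T) X →
  ∃ λ X′ → X ≡ start-of δ m X′ × UpRotation j T X′
start-of-up⁻ ↓ T j≢m (inˡ ρ) = _ , refl , ρ
start-of-up⁻ ↓ T j≢m (inʳ ())
start-of-up⁻ ↑ ε j≢m (inˡ ())
start-of-up⁻ ↑ ε j≢m (inʳ ())
start-of-up⁻ ↑ (node l i ε) j≢m here = contradiction refl j≢m
start-of-up⁻ ↑ (node l i (node Y j Z)) j≢m here = node (node l i Y) j Z , refl , here
start-of-up⁻ ↑ (node l i r) j≢m (inˡ ρ) = node _ i r , refl , inˡ ρ
start-of-up⁻ ↑ (node l i r) j≢m (inʳ ρ) with start-of-up⁻ ↑ r j≢m ρ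
... | r′ , refl , ρ′ = node l i r′ , refl , inʳ ρ′

start-of-down⁻ : ∀ δ {m j} T {X} → j ≢ m → UpRotation j X (start-of δ m T) →
  ∃ λ X′ → X ≡ start-of δ m X′ × UpRotation j X′ T
start-of-down⁻ ↓ T j≢m here = contradiction refl j≢m
start-of-down⁻ ↓ T j≢m (inˡ ρ) = _ , refl , ρ
start-of-down⁻ ↓ T j≢m (inʳ ())
start-of-down⁻ ↑ ε j≢m (inˡ ())
start-of-down⁻ ↑ ε j≢m (inʳ ())
start-of-down⁻ ↑ (node (node X i Y) j r) j≢m here = node X i (node Y j r) , refl , here
start-of-down⁻ ↑ (node l i r) j≢m (inˡ ρ) = node _ i r , refl , inˡ ρ
start-of-down⁻ ↑ (node l i r) j≢m (inʳ ρ) with start-of-down⁻ ↑ r j≢m ρ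
... | r′ , refl , ρ′ = node l i r′ , refl , inʳ ρ′

start-of-rotation : ∀ δ δ′ {m j T X} → Rotation δ′ j T X → Rotation δ′ j (start-of δ m T) (start-of δ m X)
start-of-rotation δ ↑ = start-of-up δ
start-of-rotation δ ↓ = start-of-up δ

start-of-rotation⁻ : ∀ δ δ′ {m j T X} → j ≢ m → Rotation δ′ j (start-of δ m T) X →
  ∃ λ X′ → X ≡ start-of δ m X′ × Rotation δ′ j T X′
start-of-rotation⁻ δ ↑ = start-of-up⁻ δ _
start-of-rotation⁻ δ ↓ = start-of-down⁻ δ _

start-of-slide : ∀ δ {δ′ m j d T X} → Slide δ′ j d T X → Slide δ′ j d (start-of δ m T) (start-of δ m X)
start-of-slide δ done = done
start-of-slide δ {δ′} (ρ ◅ ρs) = start-of-rotation δ δ′ ρ ◅ start-of-slide δ ρs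

start-of-slide⁻ : ∀ δ {δ′ m j d T X} → j ≢ m → Slide δ′ j d (start-of δ m T) X →
  ∃ λ X′ → X ≡ start-of δ m X′ × Slide δ′ j d T X′
start-of-slide⁻ δ j≢m done = _ , refl , done
start-of-slide⁻ δ {δ′} j≢m (ρ ◅ ρs) with start-of-rotation⁻ δ δ′ j≢m ρ
... | _ , refl , ρ′ with start-of-slide⁻ δ j≢m ρs
... | X′ , eq , ρs′ = X′ , eq , ρ′ ◅ ρs′

start-of-insert : ∀ δ m T → ∃ λ d → d ≤ height T × start-of δ m T ≡ insert m d T
start-of-insert ↑ m T = height T , ≤-refl , refl
start-of-insert ↓ m T = 0 , z≤n , refl

module _ {n : ℕ} {ps : List Pattern} (Fs : All Friendly ps) where

  𝒯-start-of : ∀ δ {T} → 𝒯 n ps T → 𝒯 (suc n) ps (start-of δ (suc n) T)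
  𝒯-start-of ↑ = 𝒯-bottom Fs
  𝒯-start-of ↓ = 𝒯-top Fs

  𝒯-start-of⁻ : ∀ δ {T} → 𝒯 (suc n) ps (start-of δ (suc n) T) → 𝒯 n ps T
  𝒯-start-of⁻ ↑ {T} = 𝒯-insert⁻ Fs (height T)
  𝒯-start-of⁻ ↓ = 𝒯-insert⁻ Fs 0

  -- Slides of `j` from an extreme insertion are the insertions of slides over `T`, and at an
  -- extreme membership in the two languages is equivalent. Hence shorter slides fail for n + 1
  -- exactly if they fail for n.
  start-of-minimal : ∀ δ {δ′ j T X} → j ≢ suc n → MinimalSlide (𝒯 n ps) δ′ j T X →
    MinimalSlide (𝒯 (suc n) ps) δ′ j (start-of δ (suc n) T) (start-of δ (suc n) X)
  start-of-minimal δ j≢m (d , 1≤d , ρs , X∈ , min) = d , 1≤d , start-of-slide δ ρs , 𝒯-start-of δ X∈ ,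
    λ d′ Y 1≤d′ d′<d πs Y∈ → case start-of-slide⁻ δ j≢m πs of λ where
      (Y′ , refl , πs′) → min d′ Y′ 1≤d′ d′<d πs′ (𝒯-start-of⁻ δ Y∈)

  start-of-minimal⁻ : ∀ δ {δ′ j T X} → j ≢ suc n →
    MinimalSlide (𝒯 (suc n) ps) δ′ j (start-of δ (suc n) T) X →
    ∃ λ X′ → X ≡ start-of δ (suc n) X′ × MinimalSlide (𝒯 n ps) δ′ j T X′
  start-of-minimal⁻ δ j≢m (d , 1≤d , ρs , X∈ , min) with start-of-slide⁻ δ j≢m ρs
  ... | X′ , refl , ρs′ = X′ , refl , d , 1≤d , ρs′ , 𝒯-start-of⁻ δ X∈ ,
    λ d′ Y 1≤d′ d′<d πs Y∈ → min d′ (start-of δ (suc n) Y) 1≤d′ d′<d (start-of-slide δ πs) (𝒯-start-of δ Y∈)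

module _ {n : ℕ} {𝓛 𝓛⁺ : Language} where
  open AlgorithmH

  private m = suc n

  start-of-∈𝒯 : ∀ δ {T} → T ∈𝒯 n → start-of δ m T ∈𝒯 m
  start-of-∈𝒯 ↑ {T} = insert-∈𝒯 (height T)
  start-of-∈𝒯 ↓ = insert-∈𝒯 0

  cL-start-of : ∀ δ {T j} → T ∈𝒯 n → j ∈ᵗ T → cL (start-of δ m T) j ≡ cL T j
  cL-start-of ↑ {T} T∈ = cL-insert {d = height T} (proj₁ (insert-∈𝒯 (height T) T∈))
  cL-start-of ↓ T∈ = cL-insert {d = 0} (proj₁ (insert-∈𝒯 0 T∈))

  -- Under a new root `m`, the old root becomes the left child of a larger vertex: the turn
  -- condition is then met by its other alternative, and its truth does not change.
  start-of-turn : ∀ δ δ′ {T j} → T ∈𝒯 n → j ∈ᵗ T → Turn 𝓛 n δ′ j T → Turn 𝓛⁺ m δ′ j (start-of δ m T)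
  start-of-turn δ ↓ T∈ j∈ eq = trans (cL-start-of δ T∈ j∈) eq
  start-of-turn ↑ ↑ {node _ _ _} T∈ j∈ (inj₁ eq) = inj₁ eq
  start-of-turn ↓ ↑ T∈ j∈ (inj₁ eq) =
    inj₂ (m , inj₁ (trans (cL-node (proj₁ (insert-∈𝒯 0 T∈)) ⊑-refl) eq) , s≤s (proj₂ (∈⇒label T∈ j∈)))
  start-of-turn δ ↑ {T} T∈ j∈ (inj₂ (i , par , j<i)) =
    inj₂ (i , inj₁ (trans (cL-start-of δ T∈ (Parent-∈ par)) (Parent->⇒cL (proj₁ T∈) par j<i)) , j<i)

  start-of-turn⁻ : ∀ δ δ′ {T j} → T ∈𝒯 n → j ∈ᵗ T → Turn 𝓛⁺ m δ′ j (start-of δ m T) → Turn 𝓛 n δ′ j T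
  start-of-turn⁻ δ ↓ T∈ j∈ eq = trans (sym (cL-start-of δ T∈ j∈)) eq
  start-of-turn⁻ ↑ ↑ {node _ _ _} T∈ j∈ (inj₁ eq) = inj₁ eq
  start-of-turn⁻ ↓ ↑ T∈ j∈ (inj₁ refl) = contradiction (proj₂ (∈⇒label T∈ j∈)) (<-irrefl refl)
  start-of-turn⁻ δ ↑ {T} {j} T∈ j∈ (inj₂ (i , par , j<i)) = go δ par
    where
    old : ∀ δ → Parent (start-of δ m T) i j → i ∈ᵗ T → Turn 𝓛 n ↑ j T
    old δ par i∈ = inj₂ (i , inj₁ (trans (sym (cL-start-of δ T∈ i∈))
      (Parent->⇒cL (proj₁ (start-of-∈𝒯 δ T∈)) par j<i)) , j<i)
    go : ∀ δ → Parent (start-of δ m T) i j → Turn 𝓛 n ↑ j T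
    go ↑ par with insert-∈⁻ m (height T) T (Parent-∈ par)
    ... | inj₁ i∈   = old ↑ par i∈
    ... | inj₂ refl = case trans (sym (Parent->⇒cL (proj₁ (start-of-∈𝒯 ↑ T∈)) par j<i))
                             (cL-node (proj₁ (start-of-∈𝒯 ↑ T∈)) (bottom-max-⊑ m T)) of λ ()
    go ↓ par with insert-∈⁻ m 0 T (Parent-∈ par)
    ... | inj₁ i∈   = old ↓ par i∈
    ... | inj₂ refl = inj₁ (trans (sym (cL-node (proj₁ (start-of-∈𝒯 ↓ T∈)) ⊑-refl))
                             (Parent->⇒cL (proj₁ (start-of-∈𝒯 ↓ T∈)) par j<i))

-- Algorithms H and S side by side

module Joint (𝓛 : Language) (n : ℕ) where
  open AlgorithmS 𝓛 using (NewSlide; NoneAbove)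
  module S = AlgorithmS 𝓛
  module H = AlgorithmH 𝓛 n
  open H using (Step; turn; keep; Turn; turn-s)

  -- A run of H, each step of which is also the forced choice of S when the trees in `V` have been
  -- visited, and which halts only where S finds no new slide. Runs of both algorithms can be read
  -- off.
  data Run (V : List Tree) : HState → List HState → Set where
    halt : ∀ {σ} → s σ n ≡ 1 → (∀ δ j T′ → ¬ NewSlide V δ j (tree σ) T′) → Run V σ [ σ ]
    step : ∀ {σ σ′ σs} → Step σ σ′ → tree σ′ ∉ V → NoneAbove V (s σ n) (tree σ) →
           (∀ T″ → ¬ NewSlide V (opposite (o σ (s σ n))) (s σ n) (tree σ) T″) →
           Run (tree σ′ ∷ V) σ′ σs → Run V σ (σ ∷ σs)

  -- The constructors of `Step` mention the array entries themselves. This version takes equations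
  -- for them, as the entries are known only up to a proof.
  step-turn : ∀ {V T T′ o s σs} j δ → s n ≡ j → o j ≡ δ → j ≢ 1 →
    MinimalSlide 𝓛 δ j T T′ → Turn δ j T′ → T′ ∉ V → NoneAbove V j T →
    (∀ T″ → ¬ NewSlide V (opposite δ) j T T″) →
    Run (T′ ∷ V) ⟨ T′ , o [ j ↦ opposite δ ] , turn-s j (s [ n ↦ n ]) ⟩ σs →
    Run V ⟨ T , o , s ⟩ (⟨ T , o , s ⟩ ∷ σs)
  step-turn _ _ refl refl j≢1 ms t fresh above opp run = step (turn j≢1 ms t) fresh above opp run

  step-keep : ∀ {V T T′ o s σs} j δ → s n ≡ j → o j ≡ δ → j ≢ 1 →
    MinimalSlide 𝓛 δ j T T′ → ¬ Turn δ j T′ → T′ ∉ V → NoneAbove V j T →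
    (∀ T″ → ¬ NewSlide V (opposite δ) j T T″) →
    Run (T′ ∷ V) ⟨ T′ , o , s [ n ↦ n ] ⟩ σs →
    Run V ⟨ T , o , s ⟩ (⟨ T , o , s ⟩ ∷ σs)
  step-keep _ _ refl refl j≢1 ms ¬t fresh above opp run = step (keep j≢1 ms ¬t) fresh above opp run

  Step-minimal : ∀ {σ σ′} → Step σ σ′ → MinimalSlide 𝓛 (o σ (s σ n)) (s σ n) (tree σ) (tree σ′)
  Step-minimal (turn _ ms _) = ms
  Step-minimal (keep _ ms _) = ms

  Step-≢1 : ∀ {σ σ′} → Step σ σ′ → s σ n ≢ 1
  Step-≢1 (turn j≢1 _ _) = j≢1
  Step-≢1 (keep j≢1 _ _) = j≢1

  Step-functional : ∀ {σ σ₁ σ₂} → SearchTree (tree σ) → Step σ σ₁ → Step σ σ₂ → σ₁ ≡ σ₂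
  Step-functional sT (turn _ ms₁ t₁) (turn _ ms₂ t₂) with MinimalSlide-functional {𝓛} sT ms₁ ms₂
  ... | refl = refl
  Step-functional sT (turn _ ms₁ t₁) (keep _ ms₂ ¬t₂) with MinimalSlide-functional {𝓛} sT ms₁ ms₂
  ... | refl = contradiction t₁ ¬t₂
  Step-functional sT (keep _ ms₁ ¬t₁) (turn _ ms₂ t₂) with MinimalSlide-functional {𝓛} sT ms₁ ms₂
  ... | refl = contradiction t₂ ¬t₁
  Step-functional sT (keep _ ms₁ ¬t₁) (keep _ ms₂ ¬t₂) with MinimalSlide-functional {𝓛} sT ms₁ ms₂
  ... | refl = refl

  Step-SearchTree : ∀ {σ σ′} → Step σ σ′ → SearchTree (tree σ) → SearchTree (tree σ′)
  Step-SearchTree st sT with Step-minimal st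
  ... | _ , _ , ρs , _ = Slide-SearchTree ρs sT

  H-functional : ∀ {σ σs σs′} → SearchTree (tree σ) → H.RunFrom σ σs → H.RunFrom σ σs′ → σs ≡ σs′
  H-functional sT (H.halt _) (H.halt _) = refl
  H-functional sT (H.halt eq) (st H.◅ _) = contradiction eq (Step-≢1 st)
  H-functional sT (st H.◅ _) (H.halt eq) = contradiction eq (Step-≢1 st)
  H-functional sT (st₁ H.◅ r₁) (st₂ H.◅ r₂) with Step-functional sT st₁ st₂
  ... | refl = cong (_ ∷_) (H-functional (Step-SearchTree st₁ sT) r₁ r₂)

  largest-unique : ∀ {V T j j′ δ δ′ X X′} → NoneAbove V j T → NewSlide V δ j T X →
    NoneAbove V j′ T → NewSlide V δ′ j′ T X′ → j ≡ j′
  largest-unique {j = j} {j′} na ns na′ ns′ with <-cmp j j′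
  ... | tri< j<j′ _ _ = contradiction ns′ (na _ j<j′ _ _)
  ... | tri≈ _ j≡j′ _ = j≡j′
  ... | tri> _ _ j′<j = contradiction ns (na′ _ j′<j _ _)

  ¬ambiguous : ∀ {V T j j′ δ T↑ T↓ T′} → NoneAbove V j T → NewSlide V ↑ j T T↑ → NewSlide V ↓ j T T↓ →
    NoneAbove V j′ T → NewSlide V δ j′ T T′ → ¬ (∀ T″ → ¬ NewSlide V (opposite δ) j′ T T″)
  ¬ambiguous {δ = δ} na ns↑ ns↓ na′ ns opp with largest-unique na ns↑ na′ ns | δ
  ... | refl | ↑ = opp _ ns↓
  ... | refl | ↓ = opp _ ns↑

  direction-unique : ∀ {V T j δ δ′ X′} → (∀ T″ → ¬ NewSlide V (opposite δ) j T T″) →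
    NewSlide V δ′ j T X′ → δ ≡ δ′
  direction-unique {δ = ↑} {↑} _ _ = refl
  direction-unique {δ = ↑} {↓} opp ns = contradiction ns (opp _)
  direction-unique {δ = ↓} {↑} opp ns = contradiction ns (opp _)
  direction-unique {δ = ↓} {↓} _ _ = refl

  S-functional : ∀ {V T Ts Ts′} → SearchTree T → S.RunFrom V T Ts → S.RunFrom V T Ts′ → Ts ≡ Ts′
  S-functional sT (S.none _) (S.none _) = refl
  -- Both constructors stop after `T`, so the lists agree and the contradiction between them need
  -- not be derived.
  S-functional sT (S.none _) (S.ambiguous _ _ _) = refl
  S-functional sT (S.none ¬ns) (S.slide _ ns _ _) = contradiction ns (¬ns _ _ _)
  S-functional sT (S.ambiguous _ _ _) (S.none _) = refl
  S-functional sT (S.ambiguous _ _ _) (S.ambiguous _ _ _) = refl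
  S-functional sT (S.ambiguous na ns↑ ns↓) (S.slide {δ} na′ ns opp _) =
    contradiction opp (¬ambiguous {δ = δ} na ns↑ ns↓ na′ ns)
  S-functional sT (S.slide _ ns _ _) (S.none ¬ns) = contradiction ns (¬ns _ _ _)
  S-functional sT (S.slide {δ} na′ ns opp _) (S.ambiguous na ns↑ ns↓) =
    contradiction opp (¬ambiguous {δ = δ} na ns↑ ns↓ na′ ns)
  S-functional {V} sT (S.slide {δ} na ns opp r) (S.slide {δ′} na′ ns′ opp′ r′)
    with largest-unique {V = V} {δ = δ} {δ′} na ns na′ ns′
  ... | refl with direction-unique {V = V} {δ = δ} {δ′} opp ns′
  ... | refl with MinimalSlide-functional {𝓛} {δ} sT (proj₁ ns) (proj₁ ns′)
  ... | refl = cong (_ ∷_) (S-functional (Slide-SearchTree (proj₁ (proj₂ (proj₂ (proj₁ ns)))) sT) r r′)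

  Run⇒H : ∀ {V σ σs} → Run V σ σs → H.RunFrom σ σs
  Run⇒H (halt eq _) = H.halt eq
  Run⇒H (step st _ _ _ run) = st H.◅ Run⇒H run

  Run⇒S : ∀ {V σ σs} → Run V σ σs → S.RunFrom V (tree σ) (map tree σs)
  Run⇒S (halt _ ¬ns) = S.none ¬ns
  Run⇒S (step st fresh na opp run) = S.slide na (Step-minimal st , fresh) opp (Run⇒S run)

  -- A step only asserts that its tree is new with respect to the trees before it. The second
  -- component strengthens the claim to all later trees, which the induction needs.
  Run⇒fresh : ∀ {V σ σs} → Run V σ σs → tree σ ∈ V → Unique (map tree σs) × All (λ T → T ≡ tree σ ⊎ T ∉ V) (map tree σs)
  Run⇒fresh (halt _ _) _ = [] ∷ [] , inj₁ refl ∷ []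
  Run⇒fresh {V} {σ} (step {σ′ = σ′} {σs} _ fresh _ _ run) σ∈ with Run⇒fresh run (here refl)
  ... | unique , new = All.map (λ T∉ eq → T∉ (subst (_∈ V) eq σ∈)) new′ ∷ unique , inj₁ refl ∷ All.map inj₂ new′
    where
    new′ : All (_∉ V) (map tree σs)
    new′ = All.map (λ { (inj₁ refl) → fresh ; (inj₂ T∉) → T∉ ∘ there }) new

  Run⇒𝓛 : ∀ {V σ σs} → 𝓛 (tree σ) → Run V σ σs → All 𝓛 (map tree σs)
  Run⇒𝓛 T∈ (halt _ _) = T∈ ∷ []
  Run⇒𝓛 T∈ (step st _ _ _ run) = T∈ ∷ Run⇒𝓛 (proj₁ (proj₂ (proj₂ (proj₂ (Step-minimal st))))) run

-- Finds the next position of a sweep whose tree is in the language. The search ends at `h` at the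
-- latest, where `Q` holds; `f` is one less than the distance left to `h`.
least : ∀ {Q : ℕ → Set} {h} → (∀ {t} → t ≤ h → Dec (Q t)) → Q h → ∀ f t → t + suc f ≡ h →
  ∃ λ d → 1 ≤ d × t + d ≤ h × Q (t + d) × (∀ d′ → 1 ≤ d′ → d′ < d → ¬ Q (t + d′))
least {Q} {h} Q? Qh f t eq with Q? {t + 1} (≤-trans (+-monoʳ-≤ t (s≤s z≤n)) (≤-reflexive eq))
... | yes q = 1 , ≤-refl , ≤-trans (+-monoʳ-≤ t (s≤s z≤n)) (≤-reflexive eq) , q ,
              λ d′ 1≤d′ d′<1 → contradiction 1≤d′ (<⇒≱ d′<1)
least Q? Qh zero t refl | no ¬q = contradiction Qh ¬q
least {Q} {h} Q? Qh (suc f) t eq | no ¬q with least {Q} Q? Qh f (suc t) (trans (sym (+-suc t (suc f))) eq)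
... | d , 1≤d , ≤h , q , min = suc d , s≤s z≤n , subst (_≤ h) (sym (+-suc t d)) ≤h , subst Q (sym (+-suc t d)) q , min′
  where
  min′ : ∀ d′ → 1 ≤ d′ → d′ < suc d → ¬ Q (t + d′)
  min′ (suc zero)     _ _          = ¬q
  min′ (suc (suc d′)) _ (s≤s d′<d) = min (suc d′) (s≤s z≤n) d′<d ∘ subst Q (+-suc t (suc d′))

-- Lifting a joint run from n to n + 1

module Lift {n : ℕ} (1≤n : 1 ≤ n) {ps : List Pattern} (Fs : All Friendly ps) where

  private
    m = suc n
    𝓛 = 𝒯 n ps
    𝓛⁺ = 𝒯 m ps

  open Joint hiding (module H; module S)
  open AlgorithmS using (NewSlide; NoneAbove)
  open AlgorithmH using (Turn; turn-s; turn; keep)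

  NoneAbove-max : ∀ {V T} → T ∈𝒯 m → NoneAbove 𝓛⁺ V m T
  NoneAbove-max T∈ j m<j δ T′ (ms , _) =
    contradiction (proj₂ (∈⇒label T∈ (MinimalSlide-∈ {𝓛⁺} {δ} ms))) (<⇒≱ m<j)

  m≢1 : m ≢ 1
  m≢1 refl = contradiction 1≤n (<-irrefl refl)

  module Sweep {T : Tree} (T∈ : 𝓛 T) (δ : Direction) (o′ : ℕ → Direction) (s′ : ℕ → ℕ) where

    h = height T
    q = sweep-position δ m T

    m∉ : ¬ m ∈ᵗ T
    m∉ m∈ = contradiction (proj₂ (∈⇒label (proj₁ T∈) m∈)) (<-irrefl refl)

    q-∈𝒯 : ∀ {t} → t ≤ h → q t ∈𝒯 m
    q-∈𝒯 t≤h with sweep-position-insert δ m T t≤h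
    ... | d , _ , eq = subst (_∈𝒯 m) (sym eq) (insert-∈𝒯 d (proj₁ T∈))

    q-h : 𝓛⁺ (q h)
    q-h = subst 𝓛⁺ (sym (sweep-end δ m T)) (𝒯-start-of Fs (opposite δ) T∈)

    q-slide : ∀ d t → t + d ≤ h → Slide δ m d (q t) (q (t + d))
    q-slide zero    t _  = subst (λ u → Slide δ m 0 (q t) (q u)) (sym (+-identityʳ t)) done
    q-slide (suc d) t ≤h = sweep-rotation δ m T (≤-trans (s≤s (m≤m+n t d)) ≤h′) ◅
      subst (λ u → Slide δ m d (q (suc t)) (q u)) (sym (+-suc t d)) (q-slide d (suc t) ≤h′)
      where
      ≤h′ : suc t + d ≤ h
      ≤h′ = subst (_≤ h) (+-suc t d) ≤h

    -- Rotations are functional and the sweep consists of rotations, so a slide of `m` cannot leave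
    -- the sweep; it is stuck at the end position.
    forward : ∀ {d t X} → t ≤ h → Slide δ m d (q t) X → t + d ≤ h × X ≡ q (t + d)
    forward {t = t} t≤h done = subst (_≤ h) (sym (+-identityʳ t)) t≤h , cong q (sym (+-identityʳ t))
    forward {suc d} {t} t≤h (ρ ◅ ρs) with m≤n⇒m<n∨m≡n t≤h
    ... | inj₂ refl = contradiction ρ (¬rotation-end δ m T m∉)
    ... | inj₁ t<h with Rotation-functional δ (proj₁ (q-∈𝒯 t≤h)) ρ (sweep-rotation δ m T t<h)
    ... | refl with forward t<h ρs
    ... | ≤h , eq = subst (_≤ h) (sym (+-suc t d)) ≤h , trans eq (cong q (sym (+-suc t d)))

    backward : ∀ {d t X} → t ≤ h → Slide (opposite δ) m d (q t) X → ∃ λ u → u ≤ t × X ≡ q u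
    backward {t = t} t≤h done = t , ≤-refl , refl
    backward {t = zero} t≤h (ρ ◅ _) = contradiction ρ (¬rotation-start δ m T m∉)
    backward {t = suc t} t<h (ρ ◅ ρs)
      with Rotation-functional (opposite δ) (proj₁ (q-∈𝒯 t<h)) ρ (Rotation-reverse δ (sweep-rotation δ m T t<h))
    ... | refl with backward (≤-trans (n≤1+n t) t<h) ρs
    ... | u , u≤t , eq = u , m≤n⇒m≤1+n u≤t , eq

    -- The state right after `m` has turned. The turn moves the entry of `n` to `m`, so H now reads
    -- the vertex that the smaller run would slide, and it resets the entry of `n` to `n`, which is
    -- what H5 does in the smaller run.
    record End (σ : HState) : Set where
      field
        tree-end : tree σ ≡ q h
        o-max    : o σ m ≡ opposite δ
        s-max    : s σ m ≡ s′ n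
        o-old    : ∀ i → i ∈[ n ] → o σ i ≡ o′ i
        s-old    : ∀ i → i ∈[ n ] → s σ i ≡ (s′ [ n ↦ n ]) i

    -- The run is built from the back: `K` supplies the run that follows the sweep, and `C` stands
    -- for the trees which that run covers. `g` is fuel; every step advances the position by at
    -- least one.
    sweep : {C : Tree → Set} → ∀ g t σ V → h ≤ t + g → t < h →
      tree σ ≡ q t → o σ m ≡ δ → s σ m ≡ m →
      (∀ i → i ∈[ n ] → o σ i ≡ o′ i) → (∀ i → i ∈[ n ] → s σ i ≡ s′ i) →
      (∀ u → t < u → u ≤ h → q u ∉ V) →
      (∀ u → u ≤ t → 𝓛⁺ (q u) → q u ∈ V) →
      (∀ σ₁ V₁ → End σ₁ → (∀ {X} → X ∈ V → X ∈ V₁) →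
         (∀ {X} → X ∈ V₁ → X ∈ V ⊎ ∃ λ u → u ≤ h × X ≡ q u) →
         (∀ u → u ≤ h → 𝓛⁺ (q u) → q u ∈ V₁) →
         ∃ λ σs → Run 𝓛⁺ m V₁ σ₁ σs × tree σ₁ ∈ map tree σs × (∀ {X} → C X → X ∈ map tree σs)) →
      ∃ λ σs → Run 𝓛⁺ m V σ σs × (∀ u → t ≤ u → u ≤ h → 𝓛⁺ (q u) → q u ∈ map tree σs) ×
               (∀ {X} → C X → X ∈ map tree σs)
    sweep zero t σ V h≤t t<h _ _ _ _ _ _ _ _ = contradiction (subst (h ≤_) (+-identityʳ t) h≤t) (<⇒≱ t<h)
    sweep (suc g) t σ V h≤t+g t<h refl om sm oA sA fresh seen K
      with least {𝓛⁺ ∘ q} (λ t≤h → 𝒯-dec Fs (q-∈𝒯 t≤h)) q-h (h ∸ suc t) t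
             (trans (+-suc t (h ∸ suc t)) (m+[n∸m]≡n t<h))
    ... | d , 1≤d , u≤h , u∈ , min = go (m≤n⇒m<n∨m≡n u≤h)
      where
      u = t + d
      t≤h : t ≤ h
      t≤h = ≤-trans (m≤m+n t d) u≤h
      t<u : t < u
      t<u = subst (_≤ u) (+-comm t 1) (+-monoʳ-≤ t 1≤d)
      ms : MinimalSlide 𝓛⁺ δ m (q t) (q u)
      ms = d , 1≤d , q-slide d t u≤h , u∈ , λ d′ X 1≤d′ d′<d ρs X∈ →
        min d′ 1≤d′ d′<d (subst 𝓛⁺ (proj₂ (forward t≤h ρs)) X∈)
      opp : ∀ X → ¬ NewSlide 𝓛⁺ V (opposite δ) m (q t) X
      -- Slides in the opposite direction only lead back to earlier positions of this sweep, all of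
      -- which have been visited if they are in the language.
      opp X ((_ , _ , ρs , X∈ , _) , X∉) with backward t≤h ρs
      ... | v , v≤t , refl = X∉ (seen v v≤t X∈)
      -- Positions strictly between `t` and `u` are outside the language by the choice of `u`.
      seen′ : ∀ v → v ≤ u → 𝓛⁺ (q v) → q v ∈ q u ∷ V
      seen′ v v≤u v∈ with m≤n⇒m<n∨m≡n v≤u | v ≤? t
      ... | inj₂ refl | _       = here refl
      ... | inj₁ _    | yes v≤t = there (seen v v≤t v∈)
      ... | inj₁ v<u  | no  v≰t = contradiction (subst (𝓛⁺ ∘ q) (sym v≡) v∈)
        (min (v ∸ t) (m<n⇒0<n∸m (≰⇒> v≰t)) (+-cancelˡ-< t (v ∸ t) d (subst (_< u) (sym v≡) v<u)))
        where
        v≡ : t + (v ∸ t) ≡ v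
        v≡ = m+[n∸m]≡n (<⇒≤ (≰⇒> v≰t))
      covered : ∀ {σs′} → (∀ v → u ≤ v → v ≤ h → 𝓛⁺ (q v) → q v ∈ map tree σs′) →
        ∀ v → t ≤ v → v ≤ h → 𝓛⁺ (q v) → q v ∈ map tree (σ ∷ σs′)
      covered cov v t≤v v≤h v∈ with m≤n⇒m<n∨m≡n t≤v | u ≤? v
      ... | inj₂ refl | _       = here refl
      ... | inj₁ _    | yes u≤v = there (cov v u≤v v≤h v∈)
      ... | inj₁ t<v  | no  u≰v with seen′ v (<⇒≤ (≰⇒> u≰v)) v∈
      ...   | here eq   = contradiction (sweep-position-injective δ m T m∉ v≤h u≤h eq) (<⇒≢ (≰⇒> u≰v))
      ...   | there v∈V = contradiction v∈V (fresh v t<v v≤h)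
      m≢ : ∀ {i} → i ∈[ n ] → i ≢ m
      m≢ (_ , i≤n) refl = contradiction i≤n (<-irrefl refl)
      go : u < h ⊎ u ≡ h → _
      go (inj₂ u≡h) with K σ₁ (q u ∷ V) end there
                           (λ { (here refl) → inj₂ (u , u≤h , refl) ; (there X∈) → inj₁ X∈ })
                           (λ v v≤h → seen′ v (subst (v ≤_) (sym u≡h) v≤h))
        where
        σ₁ = ⟨ q u , o σ [ m ↦ opposite δ ] , turn-s 𝓛⁺ m m (s σ [ m ↦ m ]) ⟩
        end : End σ₁
        end = record
          { tree-end = cong q u≡h
          ; o-max    = update-≡ (o σ) m (opposite δ)
          ; s-max    = trans (update-≢ ((s σ [ m ↦ m ]) [ m ↦ _ ]) n n {m} (λ ()))
                       (trans (update-≡ (s σ [ m ↦ m ]) m _)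
                       (trans (update-≢ (s σ) m m (<⇒≢ (n<1+n n))) (sA n (1≤n , ≤-refl))))
          ; o-old    = λ i i∈ → trans (update-≢ (o σ) m (opposite δ) (m≢ i∈)) (oA i i∈)
          ; s-old    = λ i i∈ → update-cong ((s σ [ m ↦ m ]) [ m ↦ _ ]) s′ n i
                         (trans (update-≢ (s σ [ m ↦ m ]) m _ (m≢ i∈))
                         (trans (update-≢ (s σ) m m (m≢ i∈)) (sA i i∈))) refl
          }
      ... | σs , run , end∈ , cov = σ ∷ σs ,
        step-turn 𝓛⁺ m m δ sm om m≢1 ms (subst (Turn 𝓛⁺ m δ m) (cong q (sym u≡h)) (Turn-end {𝓛 = 𝓛⁺} δ (proj₁ T∈)))
          (fresh u t<u u≤h) (NoneAbove-max (q-∈𝒯 t≤h)) opp run ,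
        covered {σs} (λ v u≤v v≤h _ → subst (λ w → q w ∈ map tree σs)
          (≤-antisym u≤v (subst (v ≤_) (sym u≡h) v≤h)) end∈) ,
        λ {_} c → there (cov c)
      go (inj₁ u<h) with sweep g u ⟨ q u , o σ , s σ [ m ↦ m ] ⟩ (q u ∷ V)
                           (≤-trans h≤t+g (subst (_≤ u + g) (sym (+-suc t g)) (+-monoˡ-≤ g t<u))) u<h refl om (update-≡ (s σ) m m)
                           oA (λ i i∈ → trans (update-≢ (s σ) m m (m≢ i∈)) (sA i i∈))
                           (λ { v u<v v≤h (here eq) → contradiction (sweep-position-injective δ m T m∉ v≤h u≤h eq) (>⇒≢ u<v)
                              ; v u<v v≤h (there v∈) → fresh v (<-trans t<u u<v) v≤h v∈ })
                           seen′
                           (λ σ₁ V₁ E V⊆ V₁⊆ → K σ₁ V₁ E (V⊆ ∘ there) (λ X∈ → case V₁⊆ X∈ of λ where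
                              (inj₁ (here refl)) → inj₂ (u , u≤h , refl)
                              (inj₁ (there X∈V)) → inj₁ X∈V
                              (inj₂ X≡q)         → inj₂ X≡q))
      ... | σs , run , cov , covC = σ ∷ σs ,
        step-keep 𝓛⁺ m m δ sm om m≢1 ms (¬Turn-before-end {𝓛 = 𝓛⁺} δ (proj₁ T∈) u<h)
          (fresh u t<u u≤h) (NoneAbove-max (q-∈𝒯 t≤h)) opp run ,
        covered {σs} cov , λ {_} c → there (covC c)

same-or-opposite : ∀ δ δ′ → δ′ ≡ δ ⊎ δ′ ≡ opposite δ
same-or-opposite ↑ ↑ = inj₁ refl
same-or-opposite ↑ ↓ = inj₂ refl
same-or-opposite ↓ ↑ = inj₂ refl
same-or-opposite ↓ ↓ = inj₁ refl

module _ {n : ℕ} (1≤n : 1 ≤ n) {ps : List Pattern} (Fs : All Friendly ps) where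

  private
    m = suc n
    𝓛 = 𝒯 n ps
    𝓛⁺ = 𝒯 m ps
    module Lift′ = Lift 1≤n Fs

  open Lift′ using (module Sweep; m≢1; NoneAbove-max)
  open Joint hiding (module H; module S)
  open AlgorithmS using (NewSlide; NoneAbove)
  open AlgorithmH using (Turn; turn-s; turn; keep)

  record Start (δ : Direction) (σ′ σ : HState) : Set where
    field
      tree-start : tree σ ≡ start-of δ m (tree σ′)
      o-max      : o σ m ≡ δ
      s-max      : s σ m ≡ m
      o-old      : ∀ i → i ∈[ n ] → o σ i ≡ o σ′ i
      s-old      : ∀ i → i ∈[ n ] → s σ i ≡ s σ′ i

  InsertedInto : List Tree → Tree → Set
  InsertedInto Ys X = ∃₂ λ Y d → Y ∈ Ys × d ≤ height Y × X ≡ insert m d Y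

  ≢m : ∀ {i} → i ∈[ n ] → i ≢ m
  ≢m (_ , i≤n) refl = contradiction i≤n (<-irrefl refl)

  max∉ : ∀ {T} → 𝓛 T → ¬ m ∈ᵗ T
  max∉ T∈ m∈ = ≢m (∈⇒label (proj₁ T∈) m∈) refl

  -- Since n is at least 1, top and bottom are different positions, so every sweep makes at least
  -- one step and ends with a turn.
  0<height : ∀ {T} → 𝓛 T → 0 < height T
  0<height {ε}          T∈ = case label⇒∈ (proj₁ T∈) (≤-refl , 1≤n) of λ ()
  0<height {node _ _ _} _  = s≤s z≤n

  -- The two premises on `V` are the invariants between the levels at the start of a sweep: apart
  -- from the present tree, `V` consists of trees over other members of `V′`, and it is complete
  -- over them. The continuation receives them in the simpler form valid at the end of the sweep.
  sweep-through : ∀ {V′ σ′} {C : Tree → Set} (T∈ : 𝓛 (tree σ′)) → tree σ′ ∈ V′ → All 𝓛 V′ →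
    ∀ {δ σ V} → Start δ σ′ σ → tree σ ∈ V →
    (∀ {X} → X ∈ V → X ≡ tree σ ⊎ ∃₂ λ Y d → Y ∈ V′ × Y ≢ tree σ′ × d ≤ height Y × X ≡ insert m d Y) →
    (∀ {Y} → Y ∈ V′ → Y ≡ tree σ′ ⊎ (∀ d → d ≤ height Y → 𝓛⁺ (insert m d Y) → insert m d Y ∈ V)) →
    (∀ σ₁ V₁ → Sweep.End T∈ δ (o σ′) (s σ′) σ₁ →
       (∀ {X} → X ∈ V₁ → InsertedInto V′ X) →
       (∀ {X} → InsertedInto V′ X → 𝓛⁺ X → X ∈ V₁) →
       (∀ δ′ j X → NewSlide 𝓛⁺ V₁ δ′ j (tree σ₁) X → j ≢ m × ∃ λ X′ → NewSlide 𝓛 V′ δ′ j (tree σ′) X′) →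
       ∃ λ σs → Run 𝓛⁺ m V₁ σ₁ σs × (∀ {X} → C X → X ∈ map tree σs)) →
    ∃ λ σs → Run 𝓛⁺ m V σ σs ×
      (∀ d → d ≤ height (tree σ′) → 𝓛⁺ (insert m d (tree σ′)) → insert m d (tree σ′) ∈ map tree σs) ×
      (∀ {X} → C X → X ∈ map tree σs)
  sweep-through {V′} {σ′} {C} T∈ T∈V′ V′⊆ {δ} {σ} {V} st σ∈V old seen K =
    let σs , run , cov , covC = sweep {C} h 0 σ V ≤-refl (0<height T∈)
          (trans (Start.tree-start st) (sym (sweep-start δ m T)))
          (Start.o-max st) (Start.s-max st) (Start.o-old st) (Start.s-old st) fresh seen₀ K′
    in σs , run ,
       (λ d d≤h d∈ → let t , t≤h , eq = ∃sweep-position δ m T d≤h in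
          subst (_∈ map tree σs) (sym eq) (cov t z≤n t≤h (subst 𝓛⁺ eq d∈))) ,
       covC
    where
    T = tree σ′
    open Sweep T∈ δ (o σ′) (s σ′)
    σ≡q0 : tree σ ≡ q 0
    σ≡q0 = trans (Start.tree-start st) (sym (sweep-start δ m T))
    fresh : ∀ u → 0 < u → u ≤ h → q u ∉ V
    fresh u 0<u u≤h q∈ with old q∈
    ... | inj₁ eq = contradiction (sweep-position-injective δ m T m∉ u≤h z≤n (trans eq σ≡q0)) (>⇒≢ 0<u)
    ... | inj₂ (Y , d , Y∈ , Y≢T , d≤h , eq) =
      let d′ , d′≤h , eq′ = sweep-position-insert δ m T u≤h
      in Y≢T (sym (proj₂ (insert-injective {T = T} m∉ (max∉ (All.lookup V′⊆ Y∈)) d′≤h d≤h (trans (sym eq′) eq))))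
    seen₀ : ∀ u → u ≤ 0 → 𝓛⁺ (q u) → q u ∈ V
    seen₀ zero _ _ = subst (_∈ V) σ≡q0 σ∈V
    K′ : ∀ σ₁ V₁ → End σ₁ → (∀ {X} → X ∈ V → X ∈ V₁) →
         (∀ {X} → X ∈ V₁ → X ∈ V ⊎ ∃ λ u → u ≤ h × X ≡ q u) →
         (∀ u → u ≤ h → 𝓛⁺ (q u) → q u ∈ V₁) →
         ∃ λ σs → Run 𝓛⁺ m V₁ σ₁ σs × tree σ₁ ∈ map tree σs × (∀ {X} → C X → X ∈ map tree σs)
    K′ σ₁ V₁ E V⊆ V₁⊆ seen₁ with K σ₁ V₁ E only all new
      where
      inserted : ∀ {u X} → u ≤ h → X ≡ q u → InsertedInto V′ X
      inserted u≤h refl = let d , d≤h , eq = sweep-position-insert δ m T u≤h in T , d , T∈V′ , d≤h , eq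
      only : ∀ {X} → X ∈ V₁ → InsertedInto V′ X
      only X∈ with V₁⊆ X∈
      ... | inj₂ (u , u≤h , eq) = inserted u≤h eq
      ... | inj₁ X∈V with old X∈V
      ... | inj₁ eq = inserted z≤n (trans eq σ≡q0)
      ... | inj₂ (Y , d , Y∈ , _ , d≤h , eq) = Y , d , Y∈ , d≤h , eq
      all : ∀ {X} → InsertedInto V′ X → 𝓛⁺ X → X ∈ V₁
      all (Y , d , Y∈ , d≤h , refl) X∈ with seen Y∈
      ... | inj₂ vis  = V⊆ (vis d d≤h X∈)
      ... | inj₁ refl = let t , t≤h , eq = ∃sweep-position δ m T d≤h in
                        subst (_∈ V₁) (sym eq) (seen₁ t t≤h (subst 𝓛⁺ eq X∈))
      -- At the end of a sweep, `m` cannot go on, and going back yields positions of the same sweep.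
      slide-max : ∀ δ′ X {d} → 1 ≤ d → Slide δ′ m d (q h) X → ∃ λ u → u ≤ h × X ≡ q u
      slide-max δ′ X 1≤d ρs with same-or-opposite δ δ′
      ... | inj₁ refl = contradiction (proj₁ (forward ≤-refl ρs)) (<⇒≱ (m<m+n h 1≤d))
      ... | inj₂ refl = backward ≤-refl ρs
      -- If the projected tree had been visited on the lower level, completeness of `V₁` would put
      -- its insertion `X` among the visited trees.
      new : ∀ δ′ j X → NewSlide 𝓛⁺ V₁ δ′ j (tree σ₁) X → j ≢ m × ∃ λ X′ → NewSlide 𝓛 V′ δ′ j (tree σ′) X′
      new δ′ j X (ms@(d , 1≤d , ρs , X∈ , _) , X∉) with j ≟ m
      ... | yes refl =
        let u , u≤h , eq = slide-max δ′ X 1≤d (subst (λ t → Slide δ′ m d t X) (End.tree-end E) ρs)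
        in contradiction (subst (_∈ V₁) (sym eq) (seen₁ u u≤h (subst 𝓛⁺ eq X∈))) X∉
      ... | no j≢m with start-of-minimal⁻ Fs (opposite δ) j≢m
              (subst (λ t → MinimalSlide 𝓛⁺ δ′ j t X) (trans (End.tree-end E) (sweep-end δ m T)) ms)
      ... | X′ , refl , ms′ = j≢m , X′ , ms′ , λ X′∈ →
        let d , d≤h , eq = start-of-insert (opposite δ) m X′ in X∉ (all (X′ , d , X′∈ , d≤h , eq) X∈)
    ... | σs , run , cov = σs , run , head∈ run , cov
      where
      head∈ : ∀ {V σ σs} → Run 𝓛⁺ m V σ σs → tree σ ∈ map tree σs
      head∈ (halt _ _)         = here refl
      head∈ (step _ _ _ _ _) = here refl

  -- Each visit of the smaller run is replaced by a sweep over its tree, in alternating directions,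
  -- and each of its steps by the same slide performed at the extreme that the sweep has reached.
  lift : ∀ {V′ σ′ σs′} → Run 𝓛 n V′ σ′ σs′ → 𝓛 (tree σ′) → tree σ′ ∈ V′ → All 𝓛 V′ →
    ∀ {δ σ V} → Start δ σ′ σ → tree σ ∈ V →
    (∀ {X} → X ∈ V → X ≡ tree σ ⊎ ∃₂ λ Y d → Y ∈ V′ × Y ≢ tree σ′ × d ≤ height Y × X ≡ insert m d Y) →
    (∀ {Y} → Y ∈ V′ → Y ≡ tree σ′ ⊎ (∀ d → d ≤ height Y → 𝓛⁺ (insert m d Y) → insert m d Y ∈ V)) →
    ∃ λ σs → Run 𝓛⁺ m V σ σs × (∀ {X} → InsertedInto (map tree σs′) X × 𝓛⁺ X → X ∈ map tree σs)
  lift (halt s′n≡1 ¬ns) T∈ T∈V′ V′⊆ st σ∈ old seen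
    -- After the last sweep nothing is left to cover.
    with sweep-through {C = λ _ → ⊥} T∈ T∈V′ V′⊆ st σ∈ old seen
           (λ σ₁ V₁ E only all new → [ σ₁ ] ,
              halt (trans (Sweep.End.s-max E) s′n≡1)
                (λ δ′ j X ns → ¬ns δ′ j _ (proj₂ (proj₂ (new δ′ j X ns)))) ,
              λ {_} ())
  ... | σs , run , cov , _ = σs , run , λ { ((_ , d , here refl , d≤h , refl) , X∈) → cov d d≤h X∈ }
  lift {V′} {σ′} (step {σ′ = σ″} {σs = σs′} st′ fresh na opp run′) T∈ T∈V′ V′⊆ {δ} {σ} {V} st σ∈ old seen
    with sweep-through {C = λ X → InsertedInto (map tree σs′) X × 𝓛⁺ X} T∈ T∈V′ V′⊆ st σ∈ old seen K
    where
    T = tree σ′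
    T″ = tree σ″
    j = s σ′ n
    δ₁ = opposite δ
    ms = Step-minimal 𝓛 n st′
    T″∈ : 𝓛 T″
    T″∈ = proj₁ (proj₂ (proj₂ (proj₂ ms)))
    j∈T : j ∈ᵗ T
    j∈T = MinimalSlide-∈ {𝓛} {o σ′ j} ms
    j∈T″ : j ∈ᵗ T″
    j∈T″ = ∈⇒∈ᵗ _ (subst (j ∈_) (Slide-vertices (proj₁ (proj₂ (proj₂ ms)))) (∈ᵗ⇒∈ j∈T))
    j∈ : j ∈[ n ]
    j∈ = ∈⇒label (proj₁ T∈) j∈T
    j≢1 : j ≢ 1
    j≢1 = Step-≢1 𝓛 n st′
    j-1∈ : (j ∸ 1) ∈[ n ]
    j-1∈ = m<n⇒0<n∸m (≤∧≢⇒< (proj₁ j∈) (j≢1 ∘ sym)) , ≤-trans (m∸n≤m j 1) (proj₂ j∈)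
    K : ∀ σ₁ V₁ → Sweep.End T∈ δ (o σ′) (s σ′) σ₁ →
       (∀ {X} → X ∈ V₁ → InsertedInto V′ X) →
       (∀ {X} → InsertedInto V′ X → 𝓛⁺ X → X ∈ V₁) →
       (∀ δ′ j X → NewSlide 𝓛⁺ V₁ δ′ j (tree σ₁) X → j ≢ m × ∃ λ X′ → NewSlide 𝓛 V′ δ′ j T X′) →
       ∃ λ σs → Run 𝓛⁺ m V₁ σ₁ σs × (∀ {X} → InsertedInto (map tree σs′) X × 𝓛⁺ X → X ∈ map tree σs)
    K σ₁ V₁ E only all new = go st′ run′
      where
      module E = Sweep.End E
      tree≡ : tree σ₁ ≡ start-of δ₁ m T
      tree≡ = trans E.tree-end (sweep-end δ m T)
      X = start-of δ₁ m T″
      ms⁺ : MinimalSlide 𝓛⁺ (o σ′ j) j (tree σ₁) X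
      ms⁺ = subst (λ t → MinimalSlide 𝓛⁺ (o σ′ j) j t X) (sym tree≡) (start-of-minimal Fs δ₁ (≢m j∈) ms)
      -- A visited tree lies over some member of `V′`, and the tree that it lies over is unique; for
      -- `X` this is the new tree `T″`.
      X∉ : X ∉ V₁
      X∉ X∈ with only X∈
      ... | Y , d , Y∈ , d≤h , eq =
        let d′ , d′≤h , eq′ = start-of-insert δ₁ m T″
        in fresh (subst (_∈ V′)
             (proj₂ (insert-injective {T = Y} (max∉ (All.lookup V′⊆ Y∈)) (max∉ T″∈) d≤h d′≤h (trans (sym eq) eq′))) Y∈)
      above : NoneAbove 𝓛⁺ V₁ j (tree σ₁)
      above j′ j<j′ δ′ X ns = let _ , X′ , ns′ = new δ′ j′ X ns in na j′ j<j′ δ′ X′ ns′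
      opp⁺ : ∀ X → ¬ NewSlide 𝓛⁺ V₁ (opposite (o σ′ j)) j (tree σ₁) X
      opp⁺ X ns = let _ , X′ , ns′ = new _ j X ns in opp X′ ns′
      s-same : ∀ i → i ∈[ n ] → (s σ₁ [ m ↦ m ]) i ≡ (s σ′ [ n ↦ n ]) i
      s-same i i∈ = trans (update-≢ (s σ₁) m m (≢m i∈)) (E.s-old i i∈)
      rest : ∀ {σ₂} → Start δ₁ σ″ σ₂ → Run 𝓛 n (T″ ∷ V′) σ″ σs′ →
        ∃ λ σs → Run 𝓛⁺ m (X ∷ V₁) σ₂ σs × (∀ {X} → InsertedInto (map tree σs′) X × 𝓛⁺ X → X ∈ map tree σs)
      rest st₂ run = lift run T″∈ (here refl) (T″∈ ∷ V′⊆) st₂ (here (Start.tree-start st₂))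
        (λ { (here refl) → inj₁ (sym (Start.tree-start st₂))
           ; (there X∈) → let Y , d , Y∈ , d≤h , eq = only X∈ in
               inj₂ (Y , d , there Y∈ , (λ { refl → fresh Y∈ }) , d≤h , eq) })
        (λ { (here refl) → inj₁ refl ; (there Y∈) → inj₂ (λ d d≤h d∈ → there (all (_ , d , Y∈ , d≤h , refl) d∈)) })
      go : Joint.H.Step 𝓛 n σ′ σ″ → Run 𝓛 n (T″ ∷ V′) σ″ σs′ →
        ∃ λ σs → Run 𝓛⁺ m V₁ σ₁ σs × (∀ {X} → InsertedInto (map tree σs′) X × 𝓛⁺ X → X ∈ map tree σs)
      go (turn _ _ t) run with rest {⟨ X , o σ₁ [ j ↦ opposite (o σ′ j) ] , turn-s 𝓛⁺ m j (s σ₁ [ m ↦ m ]) ⟩} st₂ run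
        where
        st₂ : Start δ₁ σ″ _
        st₂ = record
          { tree-start = refl
          ; o-max      = trans (update-≢ (o σ₁) j _ (≢m j∈ ∘ sym)) E.o-max
          ; s-max      = trans (update-≢ ((s σ₁ [ m ↦ m ]) [ j ↦ _ ]) (j ∸ 1) (j ∸ 1) {m} (≢m j-1∈ ∘ sym))
                           (trans (update-≢ (s σ₁ [ m ↦ m ]) j _ {m} (≢m j∈ ∘ sym)) (update-≡ (s σ₁) m m))
          ; o-old      = λ i i∈ → update-cong (o σ₁) (o σ′) j i (E.o-old i i∈) refl
          ; s-old      = λ i i∈ → turn-s-cong {𝓛⁺} {𝓛} {m} {n} j (s σ₁ [ m ↦ m ]) (s σ′ [ n ↦ n ]) i
                           (s-same i i∈) (s-same (j ∸ 1) j-1∈)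
          }
      ... | σs , run⁺ , cov = σ₁ ∷ σs ,
        step-turn 𝓛⁺ m j (o σ′ j) E.s-max (E.o-old j j∈) j≢1 ms⁺
          (start-of-turn {𝓛 = 𝓛} {𝓛⁺} δ₁ (o σ′ j) (proj₁ T″∈) j∈T″ t) X∉ above opp⁺ run⁺ , λ {_} c → there (cov c)
      go (keep _ _ ¬t) run with rest {⟨ X , o σ₁ , s σ₁ [ m ↦ m ] ⟩} st₂ run
        where
        st₂ : Start δ₁ σ″ _
        st₂ = record
          { tree-start = refl
          ; o-max      = E.o-max
          ; s-max      = update-≡ (s σ₁) m m
          ; o-old      = E.o-old
          ; s-old      = s-same
          }
      ... | σs , run⁺ , cov = σ₁ ∷ σs ,
        step-keep 𝓛⁺ m j (o σ′ j) E.s-max (E.o-old j j∈) j≢1 ms⁺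
          (¬t ∘ start-of-turn⁻ {𝓛 = 𝓛} {𝓛⁺} δ₁ (o σ′ j) (proj₁ T″∈) j∈T″) X∉ above opp⁺ run⁺ , λ {_} c → there (cov c)
  ... | σs , run , cov , covC = σs , run , λ where
    ((_ , d , here refl , d≤h , refl) , X∈)  → cov d d≤h X∈
    ((Y , d , there Y∈ , d≤h , eq) , X∈)     → covC ((Y , d , Y∈ , d≤h , eq) , X∈)

-- The order of the trees

-- The initial tree is a bottom insertion, so the run for n + 1 begins with an upward sweep over the
-- initial tree for n.
rightPath-bottom : ∀ a n → rightPathFrom a (suc n) ≡ bottom (a + n) (rightPathFrom a n)
rightPath-bottom a zero    = cong (λ i → node ε i ε) (sym (+-identityʳ a))
rightPath-bottom a (suc n) = cong (node ε a) (trans (rightPath-bottom (suc a) n)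
  (cong (λ i → bottom i (rightPathFrom (suc a) n)) (sym (+-suc a n))))

module _ {ps : List Pattern} (Fs : All Friendly ps) where

  ∈𝒯1 : ∀ {T} → T ∈𝒯 1 → T ≡ node ε 1 ε
  ∈𝒯1 T∈ with ∈𝒯⇒insert T∈
  ... | d , T′ , d≤h , refl with T′ | insert-∈𝒯⁻ {0} d T∈
  ∈𝒯1 T∈ | zero , _ , _ , refl | ε | _ = refl
  ∈𝒯1 T∈ | _ , _ , _ , refl | node _ _ _ | T′∈ = case ∈⇒label T′∈ at-root of λ { (s≤s z≤n , ()) }

  -- A friendly pattern has at least two vertices, and these cannot be mapped injectively to a
  -- single label.
  𝒯1 : 𝒯 1 ps (node ε 1 ε)
  𝒯1 = ε⁺∈ , All.map (λ {p} F c → too-big p F c) Fs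
    where
    ε⁺∈ : node ε 1 ε ∈𝒯 1
    ε⁺∈ = insert-∈𝒯 {0} {ε} 0 (∈𝒯-intro tt (λ ()) (λ { (s≤s z≤n , ()) }))
    too-big : ∀ p → Friendly p → ¬ Contains 1 (node ε 1 ε) p
    too-big p F c = case injective {1} {2} (≤-refl , ≤-trans (n≤1+n 1) 2≤k) (n≤1+n 1 , 2≤k) (trans (f1 1∈) (sym (f1 2∈))) of λ ()
      where
      open Contains c
      2≤k = Friendly⇒2≤k p F
      1∈ : 1 ∈[ k p ]
      1∈ = ≤-refl , ≤-trans (n≤1+n 1) 2≤k
      2∈ : 2 ∈[ k p ]
      2∈ = n≤1+n 1 , 2≤k
      f1 : ∀ {i} → i ∈[ k p ] → f i ≡ 1
      f1 i∈ = let 1≤f , f≤1 = f-range i∈ in ≤-antisym f≤1 1≤f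

  𝒯-rightPath : ∀ n → 𝒯 (suc n) ps (rightPath (suc n))
  𝒯-rightPath zero    = 𝒯1
  𝒯-rightPath (suc n) = subst (𝒯 (suc (suc n)) ps) (sym (rightPath-bottom 1 (suc n))) (𝒯-bottom Fs (𝒯-rightPath n))

  joint-run : ∀ n → ∃ λ σs → Joint.Run (𝒯 (suc n) ps) (suc n) [ rightPath (suc n) ] (AlgorithmH.H1 (𝒯 (suc n) ps) (suc n)) σs ×
    (∀ {T} → 𝒯 (suc n) ps T → T ∈ map tree σs)
  joint-run zero = [ AlgorithmH.H1 (𝒯 1 ps) 1 ] , Joint.halt refl no-slide , λ T∈ → here (∈𝒯1 (proj₁ T∈))
    where
    no-rotation : ∀ δ {j T′} → ¬ Rotation δ j (node ε 1 ε) T′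
    no-rotation ↑ (inˡ ())
    no-rotation ↑ (inʳ ())
    no-rotation ↓ (inˡ ())
    no-rotation ↓ (inʳ ())
    no-slide : ∀ δ j T′ → ¬ AlgorithmS.NewSlide (𝒯 1 ps) [ rightPath 1 ] δ j (rightPath 1) T′
    no-slide δ j T′ ((_ , _ , ρ ◅ _ , _) , _) = no-rotation δ ρ
  joint-run (suc n) with joint-run n
  ... | σs′ , run′ , cov′ with lift (s≤s z≤n) Fs run′ (𝒯-rightPath n) (here refl) (𝒯-rightPath n ∷ [])
        -- The initial arrays do not depend on the number of vertices, so old entries agree by
        -- definition; the initial direction is the one of an upward sweep.
        (record { tree-start = rightPath-bottom 1 (suc n) ; o-max = refl ; s-max = refl ; o-old = λ _ _ → refl ; s-old = λ _ _ → refl })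
        (here refl) (λ { (here eq) → inj₁ eq ; (there ()) }) (λ { (here eq) → inj₁ eq ; (there ()) })
  ... | σs , run , cov = σs , run , λ T∈ → let d , T′ , d≤h , eq = ∈𝒯⇒insert (proj₁ T∈) in
    cov ((T′ , d , cov′ (𝒯-insert⁻ Fs d (subst (𝒯 _ ps) eq T∈)) , d≤h , eq) , T∈)

-- A program logic with time bounds

-- A total correctness triple with a time bound. Quantifying over the clock and the log makes
-- triples composable; the log is unchanged, so the triple is for code that performs no visit.
record Within (c : Program) (b : ℕ) (μ : Memory) (Q : Memory → Set) : Set where
  constructor within
  field
    {final}  : Memory
    time     : ℕ
    executes : ∀ t ℓ → c / config μ t ℓ ⇓ config final (time + t) ℓ
    time≤    : time ≤ b
    post     : Q final

open Within

weaken : ∀ {c b b′ μ Q Q′} → b ≤ b′ → (∀ {μ′} → Q μ′ → Q′ μ′) → Within c b μ Q → Within c b′ μ Q′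
weaken b≤b′ Q⇒Q′ (within t ex t≤b q) = within t ex (≤-trans t≤b b≤b′) (Q⇒Q′ q)

assign-rule : ∀ {a i j v μ Q} → Q (write μ a (eval i μ) (eval j μ) (eval v μ)) →
  Within (assign a i j v) (1 + cost i + cost j + cost v) μ Q
assign-rule q = within _ (λ t ℓ → assign) ≤-refl q

shift : ∀ {c κ μ ℓ} a b t → c / κ ⇓ config μ (a + (b + t)) ℓ → c / κ ⇓ config μ ((b + a) + t) ℓ
shift {c} {κ} {μ} {ℓ} a b t = subst (λ u → c / κ ⇓ config μ u ℓ)
  (trans (sym (+-assoc a b t)) (cong (_+ t) (+-comm a b)))

infixr 4 _⨾-rule_

_⨾-rule_ : ∀ {c₁ c₂ b₁ b₂ μ Q R} → Within c₁ b₁ μ R → (∀ {μ′} → R μ′ → Within c₂ b₂ μ′ Q) →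
  Within (c₁ ⨾ c₂) (b₁ + b₂) μ Q
_⨾-rule_ {c₁} {c₂} {b₁} {b₂} {μ} (within t₁ ex₁ t₁≤ r) w with w r
... | within t₂ ex₂ t₂≤ q = within (t₁ + t₂)
  (λ t ℓ → seq (ex₁ t ℓ) (shift t₂ t₁ t (ex₂ (t₁ + t) ℓ)))
  (+-mono-≤ t₁≤ t₂≤) q

if-yes-rule : ∀ {b c₁ c₂ B μ Q} → eval b μ ≢ 0 → Within c₁ B μ Q → Within (ifnz b c₁ c₂) (1 + cost b + B) μ Q
if-yes-rule {b} neq (within t ex t≤ q) =
  within (1 + cost b + t) (λ u ℓ → if-yes neq (shift t (1 + cost b) u (ex (1 + cost b + u) ℓ))) (+-monoʳ-≤ (1 + cost b) t≤) q

if-no-rule : ∀ {b c₁ c₂ B μ Q} → eval b μ ≡ 0 → Within c₂ B μ Q → Within (ifnz b c₁ c₂) (1 + cost b + B) μ Q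
if-no-rule {b} eq (within t ex t≤ q) =
  within (1 + cost b + t) (λ u ℓ → if-no eq (shift t (1 + cost b) u (ex (1 + cost b + u) ℓ))) (+-monoʳ-≤ (1 + cost b) t≤) q

if-rule : ∀ {b c₁ c₂ B μ Q} → (eval b μ ≢ 0 → Within c₁ B μ Q) → (eval b μ ≡ 0 → Within c₂ B μ Q) →
  Within (ifnz b c₁ c₂) (1 + cost b + B) μ Q
if-rule {b} {μ = μ} w₁ w₂ with eval b μ ≟ 0
... | yes eq = if-no-rule eq (w₂ eq)
... | no neq = if-yes-rule neq (w₁ neq)

exit-rule : ∀ {b c μ Q} → eval b μ ≡ 0 → Q μ → Within (while b c) (1 + cost b) μ Q
exit-rule eq q = within _ (λ t ℓ → exit eq) ≤-refl q

loop-rule : ∀ {b c B B′ μ Q R} → eval b μ ≢ 0 → Within c B μ R →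
  (∀ {μ′} → R μ′ → Within (while b c) B′ μ′ Q) → Within (while b c) (1 + cost b + B + B′) μ Q
loop-rule {b} {c} {B} {B′} neq (within t₁ ex₁ t₁≤ r) w with w r
... | within t₂ ex₂ t₂≤ q = within (1 + cost b + t₁ + t₂)
  (λ t ℓ → loop neq (shift t₁ (1 + cost b) t (ex₁ (1 + cost b + t) ℓ))
             (shift t₂ (1 + cost b + t₁) t (ex₂ (1 + cost b + t₁ + t) ℓ)))
  (+-mono-≤ (+-monoʳ-≤ (1 + cost b) t₁≤) t₂≤) q

spares : (ℕ → Bool) → Program → Bool
spares S skip             = true
spares S visit            = true
spares S (assign a _ _ _) = not (S a)
spares S (c₁ ⨾ c₂)        = spares S c₁ ∧ spares S c₂
spares S (ifnz _ c₁ c₂)   = spares S c₁ ∧ spares S c₂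
spares S (while _ c)      = spares S c

Keeps : (ℕ → Bool) → Memory → Memory → Set
Keeps S μ μ′ = ∀ a → S a ≡ true → ∀ i j → μ′ a i j ≡ μ a i j

Keeps-refl : ∀ {S μ} → Keeps S μ μ
Keeps-refl _ _ _ _ = refl

Keeps-trans : ∀ {S μ μ′ μ″} → Keeps S μ μ′ → Keeps S μ′ μ″ → Keeps S μ μ″
Keeps-trans K K′ a Sa i j = trans (K′ a Sa i j) (K a Sa i j)

spared : ∀ S {c κ κ′} → spares S c ≡ true → c / κ ⇓ κ′ → Keeps S (memory κ) (memory κ′)
spared S _ skip = Keeps-refl
spared S _ visit = Keeps-refl
spared S {assign a _ _ _} eq assign a′ Sa′ i j with a′ ≡ᵇ a in a′≡ᵇa
... | false = refl
... | true rewrite ≡ᵇ⇒≡ a′ a (subst IsTrue (sym a′≡ᵇa) tt) | Sa′ = case eq of λ ()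
spared S {c₁ ⨾ c₂} eq (seq d₁ d₂) = let eq₁ , eq₂ = ∧-elim eq in
  Keeps-trans {S} (spared S {c₁} eq₁ d₁) (spared S {c₂} eq₂ d₂)
spared S {ifnz _ c₁ c₂} eq (if-yes {κ = config _ _ _} _ d) = spared S {c₁} (proj₁ (∧-elim eq)) d
spared S {ifnz _ c₁ c₂} eq (if-no {κ = config _ _ _} _ d) = spared S {c₂} (proj₂ (∧-elim {spares S c₁} eq)) d
spared S {while b c} eq (loop {κ = config _ _ _} _ d d′) =
  Keeps-trans {S} (spared S {c} eq d) (spared S {while b c} eq d′)
spared S eq (exit {κ = config _ _ _} _) = Keeps-refl

-- `spares` inspects the program text only, so for a concrete program its premise is proved by
-- `refl`. All facts about untouched arrays are obtained in this way.
frame : ∀ S {c b μ Q} → spares S c ≡ true → Within c b μ Q → Within c b μ (λ μ′ → Q μ′ × Keeps S μ μ′)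
frame S eq (within t ex t≤ q) = within t ex t≤ (q , spared S eq (ex 0 []))

<⇒<ᵇ′ : ∀ {a b} → a < b → (a <ᵇ b) ≡ true
<⇒<ᵇ′ {a} {b} a<b with a <ᵇ b in eq
... | true  = refl
... | false = ⊥-elim (subst IsTrue eq (<⇒<ᵇ a<b))

≮⇒<ᵇ : ∀ {a b} → ¬ a < b → (a <ᵇ b) ≡ false
≮⇒<ᵇ {a} {b} a≮b with a <ᵇ b in eq
... | false = refl
... | true  = contradiction (<ᵇ⇒< a b (subst IsTrue (sym eq) tt)) a≮b

-- There are k iterations and k + 1 tests. A test takes 7 + `cost lim` operations, and the final one
-- is charged with a body too, to keep the bound a plain product.
count-rule : ∀ {c lim body B μ k} (Inv : ℕ → Memory → Set) →
  (∀ {a μ} → Inv a μ → μ c 0 0 ≡ a) → (∀ {a μ} → Inv a μ → eval lim μ ≡ k) →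
  (∀ {a μ} → a ∈[ k ] → Inv a μ → Within body B μ (Inv (suc a))) →
  Inv 1 μ → Within (while (read c (lit 0) (lit 0) less (lim ⊕ lit 1)) body)
              (suc k * (7 + cost lim + B)) μ (Inv (suc k))
count-rule {c} {lim} {body} {B} {k = k} Inv counter limit iteration = go k 1 ≤-refl refl
  where
  W = while (read c (lit 0) (lit 0) less (lim ⊕ lit 1)) body
  cond-cost : 1 + cost (read c (lit 0) (lit 0) less (lim ⊕ lit 1)) ≡ 7 + cost lim
  cond-cost = cong (6 +_) (+-comm (cost lim) 1)
  cond-value : ∀ {a μ} → Inv a μ → eval (read c (lit 0) (lit 0) less (lim ⊕ lit 1)) μ ≡ bit (a <ᵇ k + 1)
  cond-value I rewrite counter I | limit I = refl
  go : ∀ f a → 1 ≤ a → f + a ≡ k + 1 → ∀ {μ} → Inv a μ → Within W (suc f * (7 + cost lim + B)) μ (Inv (suc k))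
  go zero a _ refl {μ} I = weaken
    (≤-trans (≤-reflexive cond-cost) (≤-trans (m≤m+n (7 + cost lim) B) (≤-reflexive (sym (+-identityʳ _))))) id
    (exit-rule (trans (cond-value I) (cong bit (≮⇒<ᵇ {k + 1} (<-irrefl refl)))) (subst (λ a → Inv a μ) (+-comm k 1) I))
  go (suc f) a 1≤a eq {μ} I = weaken (≤-reflexive (cong (λ w → w + B + suc f * (7 + cost lim + B)) cond-cost)) id
    (loop-rule (λ eq₀ → case trans (sym eq₀) (trans (cond-value I) (cong bit (<⇒<ᵇ′ a<k+1))) of λ ())
      (iteration (1≤a , ≤-pred (subst (a <_) (+-comm k 1) a<k+1)) I)
      (go f (suc a) (s≤s z≤n) (trans (+-suc f a) eq)))
    where
    a<k+1 : a < k + 1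
    a<k+1 = subst (a <_) eq (s≤s (m≤n+m a f))

assign-then : ∀ {a i j v c b μ Q} → Within c b (write μ a (eval i μ) (eval j μ) (eval v μ)) Q →
  Within (assign a i j v ⨾ c) (1 + cost i + cost j + cost v + b) μ Q
assign-then {a} {i} {j} {v} {μ = μ} w =
  assign-rule {Q = _≡ write μ a (eval i μ) (eval j μ) (eval v μ)} refl ⨾-rule λ { refl → w }

write-≡ : ∀ μ a i j v → write μ a i j v a i j ≡ v
write-≡ μ a i j v rewrite ≡ᵇ-refl a | ≡ᵇ-refl i | ≡ᵇ-refl j = refl

write-≢ : ∀ μ a i j v {i′} j′ → i′ ≢ i → write μ a i j v a i′ j′ ≡ μ a i′ j′
write-≢ μ a i j v j′ i′≢i rewrite ≡ᵇ-refl a | ≢⇒≡ᵇ i′≢i = refl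

write-≢₂ : ∀ μ a i j v i′ {j′} → j′ ≢ j → write μ a i j v a i′ j′ ≡ μ a i′ j′
write-≢₂ μ a i j v i′ j′≢j rewrite ≡ᵇ-refl a | ≢⇒≡ᵇ j′≢j with i′ ≡ᵇ i
... | true  = refl
... | false = refl

var : ℕ → Expr
var a = read a (lit 0) (lit 0)

set : ℕ → Expr → Program
set a v = assign a (lit 0) (lit 0) v

write-hit : ∀ μ a i j v {i′ j′ w} → i′ ≡ i → j′ ≡ j → v ≡ w → write μ a i j v a i′ j′ ≡ w
write-hit μ a i j v refl refl refl = write-≡ μ a i j v

-- Locating and rotating a vertex in the stored tree

#j #d #bad #t #x #sp #st #B #D #a #at #p #q #y : ℕ
#j   = 12
#d   = 13
#bad = 14
#t   = 15
#x   = 16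
#sp  = 17
#st  = 18
#B   = 19
#D   = 20
#a   = 21
#at  = 22
#p   = 23
#q   = 24
#y   = 25

leftOf rightOf : Expr → Expr
leftOf  i = read #T-left i (lit 0)
rightOf i = read #T-right i (lit 0)

-- Defined by recursion on the tree instead of by lookups for all labels, so that the effect of a
-- rotation can be followed down to the place where it happens.
Stored : Memory → Tree → Set
Stored μ ε            = ⊤
Stored μ (node l i r) =
  μ #T-left i 0 ≡ pointer (root l) × μ #T-right i 0 ≡ pointer (root r) × Stored μ l × Stored μ r

Stored-frame : ∀ {μ μ′} t → (∀ {i} → i ∈ᵗ t → μ′ #T-left i 0 ≡ μ #T-left i 0 × μ′ #T-right i 0 ≡ μ #T-right i 0) →
  Stored μ t → Stored μ′ t
Stored-frame ε same _ = tt
Stored-frame (node l i r) same (eqₗ , eqᵣ , sl , sr) =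
  trans (proj₁ (same at-root)) eqₗ , trans (proj₂ (same at-root)) eqᵣ ,
  Stored-frame l (same ∘ in-left) sl , Stored-frame r (same ∘ in-right) sr

Stored-Keeps : ∀ {S μ μ′} t → S #T-left ≡ true → S #T-right ≡ true → Keeps S μ μ′ → Stored μ t → Stored μ′ t
Stored-Keeps t Sl Sr K = Stored-frame t (λ {i} _ → K #T-left Sl i 0 , K #T-right Sr i 0)

Stored-⊑ : ∀ {μ t u} → t ⊑ u → Stored μ u → Stored μ t
Stored-⊑ ⊑-refl      su                = su
Stored-⊑ (⊑-left p)  (_ , _ , sl , _) = Stored-⊑ p sl
Stored-⊑ (⊑-right p) (_ , _ , _ , sr) = Stored-⊑ p sr

size : Tree → ℕ
size ε            = 0
size (node l _ r) = suc (size l + size r)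

-- The grandparent and the parent of j in a tree whose root has the parent p
-- and the grandparent q.
ancestors : Tree → ℕ → ℕ → ℕ → ℕ × ℕ
ancestors ε            j q p = q , p
ancestors (node l x r) j q p with <-cmp j x
... | tri< _ _ _ = ancestors l j p x
... | tri≈ _ _ _ = q , p
... | tri> _ _ _ = ancestors r j p x

ancestors-< : ∀ {l x r j q p} → j < x → ancestors (node l x r) j q p ≡ ancestors l j p x
ancestors-< {x = x} {j = j} j<x with <-cmp j x
... | tri< _ _ _   = refl
... | tri≈ j≮x _ _ = contradiction j<x j≮x
... | tri> j≮x _ _ = contradiction j<x j≮x

ancestors-> : ∀ {l x r j q p} → x < j → ancestors (node l x r) j q p ≡ ancestors r j p x
ancestors-> {x = x} {j = j} x<j with <-cmp j x
... | tri< _ _ x≮j = contradiction x<j x≮j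
... | tri≈ _ _ x≮j = contradiction x<j x≮j
... | tri> _ _ _   = refl

ancestors-≡ : ∀ {l j r q p} → ancestors (node l j r) j q p ≡ (q , p)
ancestors-≡ {j = j} with <-cmp j j
... | tri< _ j≢j _ = contradiction refl j≢j
... | tri≈ _ _ _   = refl
... | tri> _ j≢j _ = contradiction refl j≢j

-- The tree is stored below a virtual root n + 1, whose left child is the root:
-- then every rotated vertex has a grandparent, and j is the root or a left
-- child exactly if its parent is larger.
find-step find-loop find : Program
find-step = set #q (var #p) ⨾ (set #p (var #x) ⨾
  ifnz (var #j less var #x) (set #x (leftOf (var #x))) (set #x (rightOf (var #x))))
find-loop = while (lit 1 ⊖ (var #x equals var #j)) find-step
find      = set #x (var #n ⊕ lit 1) ⨾ (set #p (lit 0) ⨾ find-loop)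

find-spares : ℕ → Bool
find-spares a = a <ᵇ 16

-- Each vertex on the search path costs 10 operations for the test and 28 for the body, and the path
-- has at most `size t` vertices; the last test adds 10.
find-loop-correct : ∀ t {μ j} → SearchTree t → j ∈ᵗ t → Stored μ t →
  μ #x 0 0 ≡ pointer (root t) → μ #j 0 0 ≡ j →
  Within find-loop (size t * 38 + 10) μ
    (λ μ′ → (μ′ #q 0 0 , μ′ #p 0 0) ≡ ancestors t j (μ #q 0 0) (μ #p 0 0))
find-loop-correct (node l x r) {μ} {j} sT@(_ , _ , sl , sr) j∈ (eqₗ , eqᵣ , stl , str) x≡ j≡ with <-cmp j x
... | tri≈ _ refl _ = weaken (m≤n+m 10 (suc (size l + size r) * 38)) id (exit-rule stop refl)
  where
  stop : 1 ∸ bit (μ #x 0 0 ≡ᵇ μ #j 0 0) ≡ 0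
  stop rewrite x≡ | j≡ | ≡ᵇ-refl j = refl
... | tri< j<x j≢x _ = weaken bound (λ eq → eq) (loop-rule continue body λ ((q≡ , p≡ , x≡) , K) →
    weaken ≤-refl (λ eq → trans eq (cong₂ (ancestors l j) q≡ p≡))
      (find-loop-correct l sl (below-root j∈) (Stored-Keeps {find-spares} l refl refl K stl) x≡ (trans (K #j refl 0 0) j≡)))
  where
  below-root : j ∈ᵗ node l x r → j ∈ᵗ l
  below-root at-root       = contradiction refl j≢x
  below-root (in-left j∈)  = j∈
  below-root (in-right j∈) = contradiction (right-> sT j∈) (<-asym j<x)
  Next : Memory → Set
  Next μ′ = μ′ #q 0 0 ≡ μ #p 0 0 × μ′ #p 0 0 ≡ x × μ′ #x 0 0 ≡ pointer (root l)
  continue : 1 ∸ bit (μ #x 0 0 ≡ᵇ μ #j 0 0) ≢ 0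
  continue rewrite x≡ | j≡ | ≢⇒≡ᵇ (j≢x ∘ sym) = λ ()
  body : Within find-step 28 μ (λ μ′ → Next μ′ × Keeps find-spares μ μ′)
  body = frame find-spares {Q = Next} refl (assign-then (assign-then (if-rule
      (λ _ → assign-rule (refl , x≡ , trans (cong (λ i → μ #T-left i 0) x≡) eqₗ))
      (λ eq → case trans (sym eq) (trans (cong₂ (λ a b → bit (a <ᵇ b)) j≡ x≡) (cong bit (<⇒<ᵇ′ j<x))) of λ ()))))
  bound : 38 + (size l * 38 + 10) ≤ suc (size l + size r) * 38 + 10
  bound = subst (_≤ suc (size l + size r) * 38 + 10) (+-assoc 38 (size l * 38) 10)
    (+-monoˡ-≤ 10 (*-monoˡ-≤ 38 (s≤s (m≤m+n (size l) (size r)))))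
... | tri> _ j≢x x<j = weaken bound (λ eq → eq) (loop-rule continue body λ ((q≡ , p≡ , x≡) , K) →
    weaken ≤-refl (λ eq → trans eq (cong₂ (ancestors r j) q≡ p≡))
      (find-loop-correct r sr (below-root j∈) (Stored-Keeps {find-spares} r refl refl K str) x≡ (trans (K #j refl 0 0) j≡)))
  where
  below-root : j ∈ᵗ node l x r → j ∈ᵗ r
  below-root at-root       = contradiction refl j≢x
  below-root (in-left j∈)  = contradiction (left-< sT j∈) (<-asym x<j)
  below-root (in-right j∈) = j∈
  Next : Memory → Set
  Next μ′ = μ′ #q 0 0 ≡ μ #p 0 0 × μ′ #p 0 0 ≡ x × μ′ #x 0 0 ≡ pointer (root r)
  continue : 1 ∸ bit (μ #x 0 0 ≡ᵇ μ #j 0 0) ≢ 0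
  continue rewrite x≡ | j≡ | ≢⇒≡ᵇ (j≢x ∘ sym) = λ ()
  body : Within find-step 28 μ (λ μ′ → Next μ′ × Keeps find-spares μ μ′)
  body = frame find-spares {Q = Next} refl (assign-then (assign-then (if-rule
      (λ neq → contradiction (trans (cong₂ (λ a b → bit (a <ᵇ b)) j≡ x≡) (cong bit (≮⇒<ᵇ (<-asym x<j)))) neq)
      (λ _ → assign-rule (refl , x≡ , trans (cong (λ i → μ #T-right i 0) x≡) eqᵣ)))))
  bound : 38 + (size r * 38 + 10) ≤ suc (size l + size r) * 38 + 10
  bound = subst (_≤ suc (size l + size r) * 38 + 10) (+-assoc 38 (size r * 38) 10)
    (+-monoˡ-≤ 10 (*-monoˡ-≤ 38 (s≤s (m≤n+m (size r) (size l)))))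

-- Here i is the parent of j and g its grandparent, whose child pointer changes.
data UpAt (j g i : ℕ) : Tree → Tree → Set where
  hereˡ : ∀ {X Y Z W} → UpAt j g i (node (node X i (node Y j Z)) g W) (node (node (node X i Y) j Z) g W)
  hereʳ : ∀ {X Y Z W} → UpAt j g i (node W g (node X i (node Y j Z))) (node W g (node (node X i Y) j Z))
  inˡ   : ∀ {l l′ x r} → UpAt j g i l l′ → UpAt j g i (node l x r) (node l′ x r)
  inʳ   : ∀ {l x r r′} → UpAt j g i r r′ → UpAt j g i (node l x r) (node l x r′)

mutual
  UpRotation⇒UpAtˡ : ∀ {j T T′ x r} → UpRotation j T T′ → ∃₂ λ g i → UpAt j g i (node T x r) (node T′ x r)
  UpRotation⇒UpAtˡ here    = _ , _ , hereˡ
  UpRotation⇒UpAtˡ (inˡ ρ) = let g , i , u = UpRotation⇒UpAtˡ ρ in g , i , inˡ u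
  UpRotation⇒UpAtˡ (inʳ ρ) = let g , i , u = UpRotation⇒UpAtʳ ρ in g , i , inˡ u

  UpRotation⇒UpAtʳ : ∀ {j T T′ x l} → UpRotation j T T′ → ∃₂ λ g i → UpAt j g i (node l x T) (node l x T′)
  UpRotation⇒UpAtʳ here    = _ , _ , hereʳ
  UpRotation⇒UpAtʳ (inˡ ρ) = let g , i , u = UpRotation⇒UpAtˡ ρ in g , i , inʳ u
  UpRotation⇒UpAtʳ (inʳ ρ) = let g , i , u = UpRotation⇒UpAtʳ ρ in g , i , inʳ u

UpAt-root : ∀ {j g i T T′} → UpAt j g i T T′ → root T ≡ root T′
UpAt-root hereˡ   = refl
UpAt-root hereʳ   = refl
UpAt-root (inˡ _) = refl
UpAt-root (inʳ _) = refl

UpAt-∈ : ∀ {j g i T T′} → UpAt j g i T T′ → j ∈ᵗ T × g ∈ᵗ T × i ∈ᵗ T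
UpAt-∈ hereˡ   = in-left (in-right at-root) , at-root , in-left at-root
UpAt-∈ hereʳ   = in-right (in-right at-root) , at-root , in-right at-root
UpAt-∈ (inˡ u) = let a , b , c = UpAt-∈ u in in-left a , in-left b , in-left c
UpAt-∈ (inʳ u) = let a , b , c = UpAt-∈ u in in-right a , in-right b , in-right c

UpAt-∈′ : ∀ {j g i T T′} → UpAt j g i T T′ → j ∈ᵗ T′ × g ∈ᵗ T′ × i ∈ᵗ T′
UpAt-∈′ hereˡ   = in-left at-root , at-root , in-left (in-left at-root)
UpAt-∈′ hereʳ   = in-right at-root , at-root , in-right (in-left at-root)
UpAt-∈′ (inˡ u) = let a , b , c = UpAt-∈′ u in in-left a , in-left b , in-left c
UpAt-∈′ (inʳ u) = let a , b , c = UpAt-∈′ u in in-right a , in-right b , in-right c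

UpAt-ancestors : ∀ {j g i T T′ q p} → SearchTree T → UpAt j g i T T′ → ancestors T j q p ≡ (g , i)
UpAt-ancestors {j} sT@(_ , _ , sl , _) hereˡ =
  trans (ancestors-< (left-< sT (in-right at-root))) (trans (ancestors-> (right-> sl at-root)) (ancestors-≡ {j = j}))
UpAt-ancestors {j} sT@(_ , _ , _ , sr) hereʳ =
  trans (ancestors-> (right-> sT (in-right at-root))) (trans (ancestors-> (right-> sr at-root)) (ancestors-≡ {j = j}))
UpAt-ancestors sT@(_ , _ , sl , _) (inˡ u) = trans (ancestors-< (left-< sT (proj₁ (UpAt-∈ u)))) (UpAt-ancestors sl u)
UpAt-ancestors sT@(_ , _ , _ , sr) (inʳ u) = trans (ancestors-> (right-> sT (proj₁ (UpAt-∈ u)))) (UpAt-ancestors sr u)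

UpAt-parent : ∀ {j g i T T′ q p} → SearchTree T′ → UpAt j g i T T′ → proj₂ (ancestors T′ j q p) ≡ g
UpAt-parent {j} sT hereˡ = cong proj₂ (trans (ancestors-< (left-< sT at-root)) (ancestors-≡ {j = j}))
UpAt-parent {j} sT hereʳ = cong proj₂ (trans (ancestors-> (right-> sT at-root)) (ancestors-≡ {j = j}))
UpAt-parent sT@(_ , _ , sl , _) (inˡ u) =
  trans (cong proj₂ (ancestors-< (left-< sT (proj₁ (UpAt-∈′ u))))) (UpAt-parent sl u)
UpAt-parent sT@(_ , _ , _ , sr) (inʳ u) =
  trans (cong proj₂ (ancestors-> (right-> sT (proj₁ (UpAt-∈′ u))))) (UpAt-parent sr u)

-- Only cells of `j`, its parent `i` and its grandparent `g` may change. The effects are guarded by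
-- inequalities because a later write could overwrite an earlier one if two of the three coincided;
-- the search tree property shows that they do not.
module _ (μ μ′ : Memory) {j g i : ℕ}
  (others : ∀ x → x ≢ j → x ≢ g → x ≢ i → μ′ #T-left x 0 ≡ μ #T-left x 0 × μ′ #T-right x 0 ≡ μ #T-right x 0)
  (right-j : j ≢ i → j ≢ g → μ′ #T-right j 0 ≡ μ #T-right j 0)
  (left-i : i ≢ j → i ≢ g → μ′ #T-left i 0 ≡ μ #T-left i 0)
  where

  private
    same : ∀ {t} → (∀ {x} → x ∈ᵗ t → x ≢ j × x ≢ g × x ≢ i) → Stored μ t → Stored μ′ t
    same {t} apart = Stored-frame t (λ x∈ → let x≢j , x≢g , x≢i = apart x∈ in others _ x≢j x≢g x≢i)

    sameˡ : ∀ {l x r} → SearchTree (node l x r) → j ∈ᵗ l → g ∈ᵗ l → i ∈ᵗ l → Stored μ r → Stored μ′ r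
    sameˡ sT j∈ g∈ i∈ = same (λ y∈ → apart y∈ j∈ , apart y∈ g∈ , apart y∈ i∈)
      where
      apart : ∀ {y z} → y ∈ᵗ _ → z ∈ᵗ _ → y ≢ z
      apart y∈ z∈ = >⇒≢ (<-trans (left-< sT z∈) (right-> sT y∈))

    sameʳ : ∀ {l x r} → SearchTree (node l x r) → j ∈ᵗ r → g ∈ᵗ r → i ∈ᵗ r → Stored μ l → Stored μ′ l
    sameʳ sT j∈ g∈ i∈ = same (λ y∈ → apart y∈ j∈ , apart y∈ g∈ , apart y∈ i∈)
      where
      apart : ∀ {y z} → y ∈ᵗ _ → z ∈ᵗ _ → y ≢ z
      apart y∈ z∈ = <⇒≢ (<-trans (left-< sT y∈) (right-> sT z∈))

    rootˡ : ∀ {l x r} → SearchTree (node l x r) → j ∈ᵗ l → g ∈ᵗ l → i ∈ᵗ l → x ≢ j × x ≢ g × x ≢ i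
    rootˡ sT j∈ g∈ i∈ = >⇒≢ (left-< sT j∈) , >⇒≢ (left-< sT g∈) , >⇒≢ (left-< sT i∈)

    rootʳ : ∀ {l x r} → SearchTree (node l x r) → j ∈ᵗ r → g ∈ᵗ r → i ∈ᵗ r → x ≢ j × x ≢ g × x ≢ i
    rootʳ sT j∈ g∈ i∈ = <⇒≢ (right-> sT j∈) , <⇒≢ (right-> sT g∈) , <⇒≢ (right-> sT i∈)

    inside : ∀ {X Y Z g} → SearchTree (node X i (node Y j Z)) → g ≢ i → g ≢ j →
      (∀ {x} → x ∈ᵗ node X i (node Y j Z) → x ≢ g) →
      (∀ {x} → x ∈ᵗ X → x ≢ j × x ≢ g × x ≢ i) × (∀ {x} → x ∈ᵗ Y → x ≢ j × x ≢ g × x ≢ i) ×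
      (∀ {x} → x ∈ᵗ Z → x ≢ j × x ≢ g × x ≢ i) × i ≢ j
    inside s@(_ , _ , _ , s′) g≢i g≢j ≢g =
      (λ x∈ → <⇒≢ (<-trans (left-< s x∈) (right-> s at-root)) , ≢g (in-left x∈) , <⇒≢ (left-< s x∈)) ,
      (λ x∈ → <⇒≢ (left-< s′ x∈) , ≢g (in-right (in-left x∈)) , >⇒≢ (right-> s (in-left x∈))) ,
      (λ x∈ → >⇒≢ (right-> s′ x∈) , ≢g (in-right (in-right x∈)) , >⇒≢ (right-> s (in-right x∈))) ,
      <⇒≢ (right-> s at-root)

  Stored-up : μ′ #T-left j 0 ≡ i → (i ≢ g → μ′ #T-right i 0 ≡ μ #T-left j 0) →
    (j < g → i ≢ g → μ′ #T-left g 0 ≡ j × μ′ #T-right g 0 ≡ μ #T-right g 0) →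
    (g < j → i ≢ g → μ′ #T-right g 0 ≡ j × μ′ #T-left g 0 ≡ μ #T-left g 0) →
    ∀ {T T′} → SearchTree T → UpAt j g i T T′ → Stored μ T → Stored μ′ T′
  Stored-up left-j right-i <g g< sT@(_ , _ , sl , _) (hereˡ {X} {Y} {Z} {W})
    (_ , g-r , (i-l , i-r , stX , (j-l , j-r , stY , stZ)) , stW) =
    let ≢g = λ {x} (x∈ : x ∈ᵗ node X i (node Y j Z)) → <⇒≢ (left-< sT x∈)
        apartX , apartY , apartZ , i≢j = inside {g = g} sl (≢g at-root ∘ sym) (≢g (in-right at-root) ∘ sym) ≢g
        g-l′ , g-r′ = <g (left-< sT (in-right at-root)) (≢g at-root)
        i≢g = ≢g at-root
        j≢g = ≢g (in-right at-root)
    in g-l′ , trans g-r′ g-r ,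
       (left-j , trans (right-j (i≢j ∘ sym) j≢g) j-r ,
         (trans (left-i i≢j i≢g) i-l , trans (right-i i≢g) j-l , same apartX stX , same apartY stY) , same apartZ stZ) ,
       same (λ w∈ → >⇒≢ (<-trans (left-< sT (in-right at-root)) (right-> sT w∈)) , >⇒≢ (right-> sT w∈) ,
                     >⇒≢ (<-trans (left-< sT at-root) (right-> sT w∈))) stW
  Stored-up left-j right-i <g g< sT@(_ , _ , _ , sr) (hereʳ {X} {Y} {Z} {W})
    (g-l , _ , stW , (i-l , i-r , stX , (j-l , j-r , stY , stZ))) =
    let ≢g = λ {x} (x∈ : x ∈ᵗ node X i (node Y j Z)) → >⇒≢ (right-> sT x∈)
        apartX , apartY , apartZ , i≢j = inside {g = g} sr (≢g at-root ∘ sym) (≢g (in-right at-root) ∘ sym) ≢g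
        g-r′ , g-l′ = g< (right-> sT (in-right at-root)) (≢g at-root)
        i≢g = ≢g at-root
        j≢g = ≢g (in-right at-root)
    in trans g-l′ g-l , g-r′ ,
       same (λ w∈ → <⇒≢ (<-trans (left-< sT w∈) (right-> sT (in-right at-root))) , <⇒≢ (left-< sT w∈) ,
                     <⇒≢ (<-trans (left-< sT w∈) (right-> sT at-root))) stW ,
       (left-j , trans (right-j (i≢j ∘ sym) j≢g) j-r ,
         (trans (left-i i≢j i≢g) i-l , trans (right-i i≢g) j-l , same apartX stX , same apartY stY) , same apartZ stZ)
  Stored-up left-j right-i <g g< sT@(_ , _ , sl , _) (inˡ u) (x-l , x-r , stl , str) =
    let j∈ , g∈ , i∈ = UpAt-∈ u
        x≢j , x≢g , x≢i = rootˡ sT j∈ g∈ i∈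
        same-l , same-r = others _ x≢j x≢g x≢i
    in trans same-l (trans x-l (cong pointer (UpAt-root u))) , trans same-r x-r ,
       Stored-up left-j right-i <g g< sl u stl , sameˡ sT j∈ g∈ i∈ str
  Stored-up left-j right-i <g g< sT@(_ , _ , _ , sr) (inʳ u) (x-l , x-r , stl , str) =
    let j∈ , g∈ , i∈ = UpAt-∈ u
        x≢j , x≢g , x≢i = rootʳ sT j∈ g∈ i∈
        same-l , same-r = others _ x≢j x≢g x≢i
    in trans same-l x-l , trans same-r (trans x-r (cong pointer (UpAt-root u))) ,
       sameʳ sT j∈ g∈ i∈ stl , Stored-up left-j right-i <g g< sr u str

  Stored-down : (j ≢ g → μ′ #T-left j 0 ≡ μ #T-right i 0) → (i ≢ g → μ′ #T-right i 0 ≡ j) →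
    (j < g → i ≢ g → μ′ #T-left g 0 ≡ i × μ′ #T-right g 0 ≡ μ #T-right g 0) →
    (g < j → i ≢ g → μ′ #T-right g 0 ≡ i × μ′ #T-left g 0 ≡ μ #T-left g 0) →
    ∀ {T T′} → SearchTree T′ → UpAt j g i T T′ → Stored μ T′ → Stored μ′ T
  Stored-down left-j right-i <g g< sT@(_ , _ , sl , _) (hereˡ {X} {Y} {Z} {W})
    (_ , g-r , (j-l , j-r , (i-l , i-r , stX , stY) , stZ) , stW) =
    let sl′ = DownRotation-SearchTree here sl
        ≢g = λ {x} (x∈ : x ∈ᵗ node (node X i Y) j Z) → <⇒≢ (left-< sT x∈)
        i≢g = ≢g (in-left at-root)
        j≢g = ≢g at-root
        apartX , apartY , apartZ , i≢j = inside {g = g} sl′ (i≢g ∘ sym) (j≢g ∘ sym)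
          (λ { at-root → i≢g ; (in-left x∈) → ≢g (in-left (in-left x∈)) ; (in-right at-root) → j≢g
             ; (in-right (in-left x∈)) → ≢g (in-left (in-right x∈)) ; (in-right (in-right x∈)) → ≢g (in-right x∈) })
        g-l′ , g-r′ = <g (left-< sT at-root) i≢g
    in g-l′ , trans g-r′ g-r ,
       (trans (left-i i≢j i≢g) i-l , right-i i≢g , same apartX stX ,
         (trans (left-j j≢g) i-r , trans (right-j (i≢j ∘ sym) j≢g) j-r , same apartY stY , same apartZ stZ)) ,
       same (λ w∈ → >⇒≢ (<-trans (left-< sT at-root) (right-> sT w∈)) , >⇒≢ (right-> sT w∈) ,
                     >⇒≢ (<-trans (left-< sT (in-left at-root)) (right-> sT w∈))) stW
  Stored-down left-j right-i <g g< sT@(_ , _ , _ , sr) (hereʳ {X} {Y} {Z} {W})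
    (g-l , _ , stW , (j-l , j-r , (i-l , i-r , stX , stY) , stZ)) =
    let sr′ = DownRotation-SearchTree here sr
        ≢g = λ {x} (x∈ : x ∈ᵗ node (node X i Y) j Z) → >⇒≢ (right-> sT x∈)
        i≢g = ≢g (in-left at-root)
        j≢g = ≢g at-root
        apartX , apartY , apartZ , i≢j = inside {g = g} sr′ (i≢g ∘ sym) (j≢g ∘ sym)
          (λ { at-root → i≢g ; (in-left x∈) → ≢g (in-left (in-left x∈)) ; (in-right at-root) → j≢g
             ; (in-right (in-left x∈)) → ≢g (in-left (in-right x∈)) ; (in-right (in-right x∈)) → ≢g (in-right x∈) })
        g-r′ , g-l′ = g< (right-> sT at-root) i≢g
    in trans g-l′ g-l , g-r′ ,
       same (λ w∈ → <⇒≢ (<-trans (left-< sT w∈) (right-> sT at-root)) , <⇒≢ (left-< sT w∈) ,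
                     <⇒≢ (<-trans (left-< sT w∈) (right-> sT (in-left at-root)))) stW ,
       (trans (left-i i≢j i≢g) i-l , right-i i≢g , same apartX stX ,
         (trans (left-j j≢g) i-r , trans (right-j (i≢j ∘ sym) j≢g) j-r , same apartY stY , same apartZ stZ))
  Stored-down left-j right-i <g g< sT@(_ , _ , sl , _) (inˡ u) (x-l , x-r , stl , str) =
    let j∈ , g∈ , i∈ = UpAt-∈′ u
        x≢j , x≢g , x≢i = rootˡ sT j∈ g∈ i∈
        same-l , same-r = others _ x≢j x≢g x≢i
    in trans same-l (trans x-l (cong pointer (sym (UpAt-root u)))) , trans same-r x-r ,
       Stored-down left-j right-i <g g< sl u stl , sameˡ sT j∈ g∈ i∈ str
  Stored-down left-j right-i <g g< sT@(_ , _ , _ , sr) (inʳ u) (x-l , x-r , stl , str) =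
    let j∈ , g∈ , i∈ = UpAt-∈′ u
        x≢j , x≢g , x≢i = rootʳ sT j∈ g∈ i∈
        same-l , same-r = others _ x≢j x≢g x≢i
    in trans same-l x-l , trans same-r (trans x-r (cong pointer (sym (UpAt-root u)))) ,
       sameʳ sT j∈ g∈ i∈ stl , Stored-down left-j right-i <g g< sr u str

UpAt-left : ∀ {μ j g i T T′} → UpAt j g i T T′ → Stored μ T′ → μ #T-left j 0 ≡ i
UpAt-left hereˡ   (_ , _ , (eq , _) , _)  = eq
UpAt-left hereʳ   (_ , _ , _ , (eq , _))  = eq
UpAt-left (inˡ u) (_ , _ , st , _)        = UpAt-left u st
UpAt-left (inʳ u) (_ , _ , _ , st)        = UpAt-left u st

-- The comparison uses `j` even when another vertex becomes the child: both lie in the same subtree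
-- of `parent`, hence on the same side.
relink : Expr → Expr → Program
relink parent child = ifnz (var #j less parent)
  (assign #T-left parent (lit 0) child) (assign #T-right parent (lit 0) child)

rotate-up rotate-down rotate : Program
rotate-up   = assign #T-right (var #p) (lit 0) (leftOf (var #j)) ⨾
              (assign #T-left (var #j) (lit 0) (var #p) ⨾ relink (var #q) (var #j))
rotate-down = set #y (leftOf (var #j)) ⨾
              (assign #T-left (var #j) (lit 0) (rightOf (var #y)) ⨾
              (assign #T-right (var #y) (lit 0) (var #j) ⨾ relink (var #p) (var #y)))
rotate      = find ⨾ ifnz (var #d) rotate-down rotate-up

bit-≢0 : ∀ {a b} → bit (a <ᵇ b) ≢ 0 → a < b
bit-≢0 {a} {b} neq with a <ᵇ b in eq
... | true  = <ᵇ⇒< a b (subst IsTrue (sym eq) tt)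
... | false = contradiction refl neq

bit-≡0 : ∀ {a b} → bit (a <ᵇ b) ≡ 0 → ¬ a < b
bit-≡0 {a} {b} eq a<b rewrite <⇒<ᵇ′ a<b = case eq of λ ()

rotate-up-correct : ∀ {μ T T′} → SearchTree T → UpAt (μ #j 0 0) (μ #q 0 0) (μ #p 0 0) T T′ → Stored μ T →
  Within rotate-up 34 μ (λ μ′ → Stored μ′ T′)
rotate-up-correct {μ} {T} {T′} sT u st = assign-then (assign-then (if-rule
  (λ neq → let j<g = bit-≢0 neq ; j≢g = <⇒≢ j<g in assign-rule
    (Stored-up μ (write μ₂ #T-left g 0 j)
      (λ x x≢j x≢g x≢i → trans (write-≢ μ₂ #T-left g 0 j 0 x≢g) (write-≢ μ₁ #T-left j 0 i 0 x≢j) ,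
                          write-≢ μ #T-right i 0 _ 0 x≢i)
      (λ j≢i _ → write-≢ μ #T-right i 0 _ 0 j≢i)
      (λ i≢j i≢g → trans (write-≢ μ₂ #T-left g 0 j 0 i≢g) (write-≢ μ₁ #T-left j 0 i 0 i≢j))
      (trans (write-≢ μ₂ #T-left g 0 j 0 j≢g) (write-≡ μ₁ #T-left j 0 i))
      (λ _ → write-≡ μ #T-right i 0 _)
      (λ _ i≢g → write-≡ μ₂ #T-left g 0 j , write-≢ μ #T-right i 0 _ 0 (i≢g ∘ sym))
      (λ g<j → contradiction j<g (<-asym g<j))
      sT u st))
  (λ eq → let j≮g = bit-≡0 eq in assign-rule
    (Stored-up μ (write μ₂ #T-right g 0 j)
      (λ x x≢j x≢g x≢i → write-≢ μ₁ #T-left j 0 i 0 x≢j ,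
                          trans (write-≢ μ₂ #T-right g 0 j 0 x≢g) (write-≢ μ #T-right i 0 _ 0 x≢i))
      (λ j≢i j≢g → trans (write-≢ μ₂ #T-right g 0 j 0 j≢g) (write-≢ μ #T-right i 0 _ 0 j≢i))
      (λ i≢j _ → write-≢ μ₁ #T-left j 0 i 0 i≢j)
      (write-≡ μ₁ #T-left j 0 i)
      (λ i≢g → trans (write-≢ μ₂ #T-right g 0 j 0 i≢g) (write-≡ μ #T-right i 0 _))
      (λ j<g → contradiction j<g j≮g)
      (λ g<j _ → write-≡ μ₂ #T-right g 0 j , write-≢ μ₁ #T-left j 0 i 0 (<⇒≢ g<j))
      sT u st))))
  where
  j = μ #j 0 0
  g = μ #q 0 0
  i = μ #p 0 0
  μ₁ = write μ #T-right i 0 (μ #T-left j 0)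
  μ₂ = write μ₁ #T-left j 0 i

rotate-down-correct : ∀ {μ T T′} → SearchTree T′ → UpAt (μ #j 0 0) (μ #p 0 0) (μ #T-left (μ #j 0 0) 0) T T′ →
  Stored μ T′ → Within rotate-down 42 μ (λ μ′ → Stored μ′ T)
rotate-down-correct {μ} {T} {T′} sT u st = assign-then (assign-then (assign-then (if-rule
  (λ neq → let j<g = bit-≢0 neq ; j≢g = <⇒≢ j<g in assign-rule
    (Stored-down μ (write μ₃ #T-left g 0 i)
      (λ x x≢j x≢g x≢i → trans (write-≢ μ₃ #T-left g 0 i 0 x≢g) (write-≢ μ₁ #T-left j 0 (μ #T-right i 0) 0 x≢j) ,
                          write-≢ μ₂ #T-right i 0 j 0 x≢i)
      (λ j≢i _ → write-≢ μ₂ #T-right i 0 j 0 j≢i)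
      (λ i≢j i≢g → trans (write-≢ μ₃ #T-left g 0 i 0 i≢g) (write-≢ μ₁ #T-left j 0 (μ #T-right i 0) 0 i≢j))
      (λ _ → trans (write-≢ μ₃ #T-left g 0 i 0 j≢g) (write-≡ μ₁ #T-left j 0 (μ #T-right i 0)))
      (λ _ → write-≡ μ₂ #T-right i 0 j)
      (λ _ i≢g → write-≡ μ₃ #T-left g 0 i , write-≢ μ₂ #T-right i 0 j 0 (i≢g ∘ sym))
      (λ g<j → contradiction j<g (<-asym g<j))
      sT u st))
  (λ eq → let j≮g = bit-≡0 eq in assign-rule
    (Stored-down μ (write μ₃ #T-right g 0 i)
      (λ x x≢j x≢g x≢i → write-≢ μ₁ #T-left j 0 (μ #T-right i 0) 0 x≢j ,
                          trans (write-≢ μ₃ #T-right g 0 i 0 x≢g) (write-≢ μ₂ #T-right i 0 j 0 x≢i))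
      (λ j≢i j≢g → trans (write-≢ μ₃ #T-right g 0 i 0 j≢g) (write-≢ μ₂ #T-right i 0 j 0 j≢i))
      (λ i≢j _ → write-≢ μ₁ #T-left j 0 (μ #T-right i 0) 0 i≢j)
      (λ _ → write-≡ μ₁ #T-left j 0 (μ #T-right i 0))
      (λ i≢g → trans (write-≢ μ₃ #T-right g 0 i 0 i≢g) (write-≡ μ₂ #T-right i 0 j))
      (λ j<g → contradiction j<g j≮g)
      (λ g<j _ → write-≡ μ₃ #T-right g 0 i , write-≢ μ₁ #T-left j 0 (μ #T-right i 0) 0 (<⇒≢ g<j))
      sT u st)))))
  where
  j = μ #j 0 0
  g = μ #p 0 0
  i = μ #T-left j 0
  μ₁ = write μ #y 0 0 i
  μ₂ = write μ₁ #T-left j 0 (μ #T-right i 0)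
  μ₃ = write μ₂ #T-right i 0 j

find-correct : ∀ {n T μ j} → SearchTree (top (suc n) T) → j ∈ᵗ T → Stored μ (top (suc n) T) →
  μ #n 0 0 ≡ n → μ #j 0 0 ≡ j →
  Within find (size T * 38 + 60) μ (λ μ′ →
    (∃ λ q → (μ′ #q 0 0 , μ′ #p 0 0) ≡ ancestors (top (suc n) T) j q 0) × Keeps find-spares μ μ′)
find-correct {n} {T} {μ} {j} sT j∈ st n≡ j≡ = frame find-spares
  {Q = λ μ′ → ∃ λ q → (μ′ #q 0 0 , μ′ #p 0 0) ≡ ancestors (top (suc n) T) j q 0} refl
  (weaken (≤-reflexive bound) id
  (assign-then {i = lit 0} {lit 0} {var #n ⊕ lit 1} (assign-then {i = lit 0} {lit 0} {lit 0}
  (weaken ≤-refl (λ {μ′} eq → μ #q 0 0 , eq) (find-loop-correct (top (suc n) T) sT (in-left j∈)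
    (Stored-frame {μ} (top (suc n) T) (λ _ → refl , refl) st) (trans (cong (_+ 1) n≡) (+-comm n 1)) j≡)))))
  where
  bound : 12 + (suc (size T + 0) * 38 + 10) ≡ size T * 38 + 60
  bound rewrite +-identityʳ (size T) | +-comm (size T * 38) 60 | +-comm (size T * 38) 10 = refl

rotate-spares : ℕ → Bool
rotate-spares a = (a <ᵇ 16) ∧ (not (a ≡ᵇ #T-left) ∧ not (a ≡ᵇ #T-right))

rotate-correct : ∀ δ {n T T′ μ j} → SearchTree (top (suc n) T) → Rotation δ j T T′ → Stored μ (top (suc n) T) →
  μ #n 0 0 ≡ n → μ #j 0 0 ≡ j → μ #d 0 0 ≡ direction δ →
  Within rotate (size T * 38 + 106) μ (λ μ′ → Stored μ′ (top (suc n) T′) × Keeps rotate-spares μ μ′)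
rotate-correct δ {n} {T} {T′} {μ} {j} sT ρ st n≡ j≡ d≡ = frame rotate-spares
  {Q = λ μ′ → Stored μ′ (top (suc n) T′)} refl
  (weaken (≤-reflexive (+-assoc (size T * 38) 60 46)) id
  (find-correct sT (Rotation-∈ δ ρ) st n≡ j≡ ⨾-rule λ {μ₁} ((q , anc) , K) →
    go δ ρ d≡ {μ₁} q anc (trans (K #d refl 0 0) refl) (trans (K #j refl 0 0) j≡)
      (Stored-Keeps {find-spares} (top (suc n) T) refl refl K st)))
  where
  go : ∀ δ → Rotation δ j T T′ → μ #d 0 0 ≡ direction δ → ∀ {μ₁} q →
    (μ₁ #q 0 0 , μ₁ #p 0 0) ≡ ancestors (top (suc n) T) j q 0 → μ₁ #d 0 0 ≡ μ #d 0 0 → μ₁ #j 0 0 ≡ j →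
    Stored μ₁ (top (suc n) T) → Within (ifnz (var #d) rotate-down rotate-up) 46 μ₁ (λ μ′ → Stored μ′ (top (suc n) T′))
  go ↑ ρ d≡ {μ₁} q anc d₁≡ j₁≡ st₁ with UpRotation⇒UpAtˡ {x = suc n} {r = ε} ρ
  ... | g , i , u = if-rule (λ neq → contradiction (trans d₁≡ d≡) neq)
    -- The 34 operations of the upward case are padded to the 42 of the downward one, as the
    -- branches share a bound.
    (λ _ → weaken (m≤m+n 34 8) id (rotate-up-correct sT
      (subst (λ j → UpAt j (μ₁ #q 0 0) (μ₁ #p 0 0) _ _) (sym j₁≡)
      (subst₂ (λ g i → UpAt j g i _ _) (sym (cong proj₁ anc′)) (sym (cong proj₂ anc′)) u)) st₁))
    where
    anc′ : (μ₁ #q 0 0 , μ₁ #p 0 0) ≡ (g , i)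
    anc′ = trans anc (UpAt-ancestors sT u)
  go ↓ ρ d≡ {μ₁} q anc d₁≡ j₁≡ st₁ with UpRotation⇒UpAtˡ {x = suc n} {r = ε} ρ
  ... | g , i , u = if-rule
    (λ _ → rotate-down-correct sT
      (subst (λ j → UpAt j (μ₁ #p 0 0) (μ₁ #T-left j 0) _ _) (sym j₁≡)
      (subst₂ (λ g i → UpAt j g i _ _) (sym (trans (cong proj₂ anc) (UpAt-parent sT u))) (sym (UpAt-left u st₁)) u)) st₁)
    (λ eq → case trans (sym eq) (trans d₁≡ d≡) of λ ())

ancestors-parent : ∀ {T i j l r q p} → SearchTree T → node l i r ⊑ T → root l ≡ just j →
  proj₂ (ancestors T j q p) ≡ i
ancestors-parent {j = j} {l = node _ _ _} sT ⊑-refl refl =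
  cong proj₂ (trans (ancestors-< (left-< sT at-root)) (ancestors-≡ {j = j}))
ancestors-parent sT@(_ , _ , sl , _) (⊑-left p) eq =
  trans (cong proj₂ (ancestors-< (left-< sT (∈-⊑ p (in-left (root⇒∈ eq)))))) (ancestors-parent sl p eq)
ancestors-parent sT@(_ , _ , _ , sr) (⊑-right p) eq =
  trans (cong proj₂ (ancestors-> (right-> sT (∈-⊑ p (in-left (root⇒∈ eq)))))) (ancestors-parent sr p eq)

ancestors-⊑ : ∀ {l x r j q p} → SearchTree (node l x r) → j ∈ᵗ node l x r → j ≢ x →
  ∃₂ λ l′ r′ → node l′ (proj₂ (ancestors (node l x r) j q p)) r′ ⊑ node l x r ×
               (root l′ ≡ just j ⊎ root r′ ≡ just j)
ancestors-⊑ sT at-root j≢x = contradiction refl j≢x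
ancestors-⊑ {node l′ y r′} {x} {r} {j} {q} {p} sT@(_ , _ , sl , _) (in-left j∈) j≢x
  rewrite ancestors-< {node l′ y r′} {x} {r} {j} {q} {p} (left-< sT j∈) = go (j ≟ y)
  where
  go : Dec (j ≡ y) → ∃₂ λ a b → node a (proj₂ (ancestors (node l′ y r′) j p x)) b ⊑ node (node l′ y r′) x r ×
                                (root a ≡ just j ⊎ root b ≡ just j)
  go (yes refl) rewrite ancestors-≡ {l′} {j} {r′} {p} {x} = _ , _ , ⊑-refl , inj₁ refl
  go (no j≢y) = let a , b , s , eq = ancestors-⊑ {q = p} {x} sl j∈ j≢y in a , b , ⊑-left s , eq
ancestors-⊑ {l} {x} {node l′ y r′} {j} {q} {p} sT@(_ , _ , _ , sr) (in-right j∈) j≢x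
  rewrite ancestors-> {l} {x} {node l′ y r′} {j} {q} {p} (right-> sT j∈) = go (j ≟ y)
  where
  go : Dec (j ≡ y) → ∃₂ λ a b → node a (proj₂ (ancestors (node l′ y r′) j p x)) b ⊑ node l x (node l′ y r′) ×
                                (root a ≡ just j ⊎ root b ≡ just j)
  go (yes refl) rewrite ancestors-≡ {l′} {j} {r′} {p} {x} = _ , _ , ⊑-refl , inj₂ refl
  go (no j≢y) = let a , b , s , eq = ancestors-⊑ {q = p} {x} sr j∈ j≢y in a , b , ⊑-right s , eq

module _ {𝓛 : Language} {n : ℕ} {T : Tree} {j q p : ℕ} (T∈ : T ∈𝒯 n) (j∈ : j ∈ᵗ T) where
  open AlgorithmH 𝓛 n using (Turn)

  private
    T⁺ = top (suc n) T
    sT⁺ = proj₁ (insert-∈𝒯 0 T∈)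
    parent = proj₂ (ancestors T⁺ j q p)

  Turn⇒parent> : Turn ↑ j T → j < parent
  Turn⇒parent> (inj₁ eq) =
    subst (j <_) (sym (ancestors-parent sT⁺ ⊑-refl eq)) (s≤s (proj₂ (∈⇒label T∈ j∈)))
  Turn⇒parent> (inj₂ (i , par , j<i)) =
    let l , r , s = ∈⇒⊑ (Parent-∈ {T} par)
        eq = trans (sym (cL-node (proj₁ T∈) s)) (Parent->⇒cL (proj₁ T∈) par j<i)
    in subst (j <_) (sym (ancestors-parent sT⁺ (⊑-left s) eq)) j<i

  parent>⇒Turn : j < parent → Turn ↑ j T
  parent>⇒Turn j<p with ancestors-⊑ {q = q} {p} sT⁺ (in-left j∈) (<⇒≢ (s≤s (proj₂ (∈⇒label T∈ j∈))))
  ... | l , r , s , inj₂ eq = contradiction (right-> (SearchTree-⊑ s sT⁺) (root⇒∈ eq)) (<-asym j<p)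
  ... | l , r , s , inj₁ eq = go s eq j<p
    where
    go : ∀ {i l r} → node l i r ⊑ T⁺ → root l ≡ just j → j < i → Turn ↑ j T
    go ⊑-refl     eq _   = inj₁ eq
    go (⊑-left s) eq j<i = inj₂ (_ , inj₁ (trans (cL-node (proj₁ T∈) s) eq) , j<i)

-- Testing the stored tree for a pattern

counter-limit : Expr
counter-limit = read #k (var #t) (lit 0)

-- The tables B and D hold the bits `below` and `child` of a subtree of T (first
-- index) and a subtree of P (second index), each named by its root, 0 for ε.
-- T is traversed in postorder: a stack entry is flagged once its children have
-- been pushed above it.  As `at` implies `below`, the truncated difference
-- B ⊖ e selects between the two for D.
zero-cell zero-loop cell process pop expand visit-top traverse match : Program
zero-cell = assign #B (lit 0) (var #a) (lit 0) ⨾ (assign #D (lit 0) (var #a) (lit 0) ⨾ set #a (var #a ⊕ lit 1))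
zero-loop = while (var #a less (counter-limit ⊕ lit 1)) zero-cell
cell      = set #at (lit 1 less (read #D (leftOf (var #x)) (read #P-left (var #t) (var #a)) ⊕
                                 read #D (rightOf (var #x)) (read #P-right (var #t) (var #a)))) ⨾
            (assign #B (var #x) (var #a) (lit 0 less (var #at ⊕
               (read #B (leftOf (var #x)) (var #a) ⊕ read #B (rightOf (var #x)) (var #a)))) ⨾
            (assign #D (var #x) (var #a) (lit 0 less (var #at ⊕
               (read #B (var #x) (var #a) ⊖ read #P-e (var #t) (var #a)))) ⨾
             set #a (var #a ⊕ lit 1)))
process   = assign #D (var #x) (lit 0) (lit 1) ⨾ (set #a (lit 1) ⨾
            while (var #a less (counter-limit ⊕ lit 1)) cell)
pop       = set #sp (var #sp ⊖ lit 1)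
expand    = assign #st (var #sp) (lit 1) (lit 1) ⨾
            (assign #st (var #sp ⊕ lit 1) (lit 0) (rightOf (var #x)) ⨾
            (assign #st (var #sp ⊕ lit 1) (lit 1) (lit 0) ⨾
            (assign #st (var #sp ⊕ lit 2) (lit 0) (leftOf (var #x)) ⨾
            (assign #st (var #sp ⊕ lit 2) (lit 1) (lit 0) ⨾
             set #sp (var #sp ⊕ lit 2)))))
visit-top = set #x (read #st (var #sp) (lit 0)) ⨾
            ifnz (read #st (var #sp) (lit 1)) (process ⨾ pop) (ifnz (var #x) expand pop)
traverse  = while (var #sp) visit-top
match     = assign #D (lit 0) (lit 0) (lit 1) ⨾ (set #a (lit 1) ⨾ (zero-loop ⨾
            (assign #st (lit 1) (lit 0) (leftOf (var #n ⊕ lit 1)) ⨾ (assign #st (lit 1) (lit 1) (lit 0) ⨾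
            (set #sp (lit 1) ⨾ traverse)))))

record PatternAt (μ : Memory) (t : ℕ) (p : Pattern) : Set where
  field
    k-cell  : μ #k t 0 ≡ k p
    P-root  : μ #P-root t 0 ≡ pointer (root (P p))
    P-left  : ∀ a → a ∈[ k p ] → μ #P-left t a ≡ pointer (cL (P p) a)
    P-right : ∀ a → a ∈[ k p ] → μ #P-right t a ≡ pointer (cR (P p) a)
    P-e     : ∀ a → a ∈[ k p ] → root (P p) ≢ just a → μ #P-e t a ≡ bit (e p a)

at-value : ∀ x y → bit (1 <ᵇ bit x + bit y) ≡ bit (x ∧ y)
at-value false false = refl
at-value false true  = refl
at-value true  false = refl
at-value true  true  = refl

below-value : ∀ x y z → bit (0 <ᵇ bit x + (bit y + bit z)) ≡ bit (x ∨ (y ∨ z))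
below-value true  y     z     = refl
below-value false true  z     = refl
below-value false false true  = refl
below-value false false false = refl

-- `v` is the content of a cell for `e`, which is arbitrary at the root of a pattern; so the
-- identity is needed for all numbers and not only for bits.
child-value : ∀ x y v → bit (0 <ᵇ bit x + (bit (x ∨ y) ∸ v)) ≡ bit (if 0 <ᵇ v then x else x ∨ y)
child-value true  y     zero    = refl
child-value false true  zero    = refl
child-value false false zero    = refl
child-value true  y     (suc v) = refl
child-value false true  (suc v) rewrite 0∸n≡0 v = refl
child-value false false (suc v) = refl

match-spares : ℕ → Bool
match-spares a = a <ᵇ 16

process-spares : ℕ → Bool
process-spares a = a <ᵇ 19

Keeps-weaken : ∀ {S S′ μ μ′} → (∀ a → S′ a ≡ true → S a ≡ true) → Keeps S μ μ′ → Keeps S′ μ μ′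
Keeps-weaken S′⊆S K a S′a = K a (S′⊆S a S′a)

<ᵇ-weaken : ∀ {b c} → b ≤ c → ∀ a → (a <ᵇ b) ≡ true → (a <ᵇ c) ≡ true
<ᵇ-weaken {b} b≤c a eq = <⇒<ᵇ′ (≤-trans (<ᵇ⇒< a b (subst IsTrue (sym eq) tt)) b≤c)

module Matcher {μ₀ : Memory} {t : ℕ} {p : Pattern} (env : PatternAt μ₀ t p) (t≡ : μ₀ #t 0 0 ≡ t) where
  open PatternAt env

  K : ℕ
  K = k p

  -- The edge labels as the program sees them. They may differ from `e p` at the root, where the
  -- cell is unconstrained.
  e′ : ℕ → Bool
  e′ a = 0 <ᵇ μ₀ #P-e t a

  sub : ℕ → Tree
  sub = subtree (P p)

  -- Only `D` has an entry for index 0: `cell` looks up the children of a pattern vertex in `D`, and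
  -- these may be missing.
  record Row (μ : Memory) (x : ℕ) (τ : Tree) : Set where
    field
      B-row : ∀ a → a ∈[ K ] → μ #B x a ≡ bit (below e′ (sub a) τ)
      D-row : ∀ a → a ≤ K → μ #D x a ≡ bit (child e′ (sub a) τ)

  open Row

  sub-0 : sub 0 ≡ ε
  sub-0 = subtree-∉ (P p) (0∉ (P∈𝒯k p))

  sub-node : ∀ {a} → a ∈[ K ] → ∃₂ λ l r → sub a ≡ node l a r × cL (P p) a ≡ root l × cR (P p) a ≡ root r ×
    sub (pointer (root l)) ≡ l × sub (pointer (root r)) ≡ r × pointer (root l) ≤ K × pointer (root r) ≤ K
  sub-node {a} a∈ =
    let l , r , s = ∈⇒⊑ (label⇒∈ (P∈𝒯k p) a∈)
        eq = subtree-node sP s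
    in l , r , eq , cong (root ∘ left) eq , cong (root ∘ right) eq ,
       subtree-pointer sP (0∉ (P∈𝒯k p)) (⊑-trans (⊑-left ⊑-refl) s) ,
       subtree-pointer sP (0∉ (P∈𝒯k p)) (⊑-trans (⊑-right ⊑-refl) s) ,
       pointer≤ (⊑-trans (⊑-left ⊑-refl) s) , pointer≤ (⊑-trans (⊑-right ⊑-refl) s)
    where
    sP = proj₁ (P∈𝒯k p)
    pointer≤ : ∀ {u} → u ⊑ P p → pointer (root u) ≤ K
    pointer≤ {ε}          _ = z≤n
    pointer≤ {node _ _ _} s = proj₂ (∈⇒label (P∈𝒯k p) (∈-⊑ s at-root))

  Row-same : ∀ {μ μ′ x τ} → (∀ a → μ′ #B x a ≡ μ #B x a) → (∀ a → μ′ #D x a ≡ μ #D x a) → Row μ x τ → Row μ′ x τ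
  Row-same B≡ D≡ row = record { B-row = λ a a∈ → trans (B≡ a) (B-row row a a∈) ; D-row = λ a a≤ → trans (D≡ a) (D-row row a a≤) }

  SameRow : Memory → Memory → ℕ → Set
  SameRow μ μ′ y = ∀ a → μ′ #B y a ≡ μ #B y a × μ′ #D y a ≡ μ #D y a

  SameRow-trans : ∀ {μ μ′ μ″ y} → SameRow μ μ′ y → SameRow μ′ μ″ y → SameRow μ μ″ y
  SameRow-trans same same′ a = trans (proj₁ (same′ a)) (proj₁ (same a)) , trans (proj₂ (same′ a)) (proj₂ (same a))

  module Process {μ : Memory} {x : ℕ} {l r : Tree} (kept : Keeps match-spares μ₀ μ) (x≡ : μ #x 0 0 ≡ x)
    (left≡ : μ₀ #T-left x 0 ≡ pointer (root l)) (right≡ : μ₀ #T-right x 0 ≡ pointer (root r))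
    (left≢ : pointer (root l) ≢ x) (right≢ : pointer (root r) ≢ x)
    (row-l : Row μ (pointer (root l)) l) (row-r : Row μ (pointer (root r)) r) where

    τ : Tree
    τ = node l x r

    record Inv (a : ℕ) (μ′ : Memory) : Set where
      field
        counter : μ′ #a 0 0 ≡ a
        keeps   : Keeps process-spares μ μ′
        others  : ∀ y → y ≢ x → SameRow μ μ′ y
        B-done  : ∀ b → 1 ≤ b → b < a → μ′ #B x b ≡ bit (below e′ (sub b) τ)
        D-done  : ∀ b → b < a → μ′ #D x b ≡ bit (child e′ (sub b) τ)

    open Inv

    stable : ∀ {μ′} → Keeps process-spares μ μ′ → Keeps match-spares μ₀ μ′
    stable K′ = Keeps-trans {match-spares} kept (Keeps-weaken {process-spares} (<ᵇ-weaken (m≤m+n 16 3)) K′)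

    module Cell {a : ℕ} {μ′ : Memory} (a∈ : a ∈[ K ]) (I : Inv a μ′) where
      k₀ : Keeps match-spares μ₀ μ′
      k₀ = stable (keeps I)

      ql qr : Tree
      ql = proj₁ (sub-node a∈)
      qr = proj₁ (proj₂ (sub-node a∈))

      sub-a : sub a ≡ node ql a qr
      sub-a = proj₁ (proj₂ (proj₂ (sub-node a∈)))

      X A L′ R′ PL PR PE : ℕ
      X  = μ′ #x 0 0
      A  = μ′ #a 0 0
      L′ = μ′ #T-left X 0
      R′ = μ′ #T-right X 0
      PL = μ′ #P-left (μ′ #t 0 0) A
      PR = μ′ #P-right (μ′ #t 0 0) A
      PE = μ′ #P-e (μ′ #t 0 0) A

      A≡ : A ≡ a
      A≡ = counter I
      X≡ : X ≡ x
      X≡ = trans (keeps I #x refl 0 0) x≡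
      T≡ : μ′ #t 0 0 ≡ t
      T≡ = trans (k₀ #t refl 0 0) t≡
      L′≡ : L′ ≡ pointer (root l)
      L′≡ = trans (k₀ #T-left refl X 0) (trans (cong (λ y → μ₀ #T-left y 0) X≡) left≡)
      R′≡ : R′ ≡ pointer (root r)
      R′≡ = trans (k₀ #T-right refl X 0) (trans (cong (λ y → μ₀ #T-right y 0) X≡) right≡)
      PL≡ : PL ≡ pointer (root ql)
      PL≡ = trans (k₀ #P-left refl _ A) (trans (cong₂ (μ₀ #P-left) T≡ A≡)
              (trans (P-left a a∈) (cong pointer (proj₁ (proj₂ (proj₂ (proj₂ (sub-node a∈))))))))
      PR≡ : PR ≡ pointer (root qr)
      PR≡ = trans (k₀ #P-right refl _ A) (trans (cong₂ (μ₀ #P-right) T≡ A≡)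
              (trans (P-right a a∈) (cong pointer (proj₁ (proj₂ (proj₂ (proj₂ (proj₂ (sub-node a∈)))))))))
      PE≡ : PE ≡ μ₀ #P-e t a
      PE≡ = trans (k₀ #P-e refl _ A) (cong₂ (μ₀ #P-e) T≡ A≡)

      v₁ v₂ v₃ : ℕ
      v₁ = bit (1 <ᵇ μ′ #D L′ PL + μ′ #D R′ PR)
      v₂ = bit (0 <ᵇ v₁ + (μ′ #B L′ A + μ′ #B R′ A))
      v₃ = bit (0 <ᵇ v₁ + (write μ′ #B X A v₂ #B X A ∸ PE))

      Dl : μ′ #D L′ PL ≡ bit (child e′ ql l)
      Dl = trans (cong₂ (μ′ #D) L′≡ PL≡) (trans (proj₂ (others I _ left≢ _))
             (trans (D-row row-l _ (proj₁ (proj₂ (proj₂ (proj₂ (proj₂ (proj₂ (proj₂ (proj₂ (sub-node a∈))))))))))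
               (cong (λ Q → bit (child e′ Q l)) (proj₁ (proj₂ (proj₂ (proj₂ (proj₂ (proj₂ (sub-node a∈))))))))))
      Dr : μ′ #D R′ PR ≡ bit (child e′ qr r)
      Dr = trans (cong₂ (μ′ #D) R′≡ PR≡) (trans (proj₂ (others I _ right≢ _))
             (trans (D-row row-r _ (proj₂ (proj₂ (proj₂ (proj₂ (proj₂ (proj₂ (proj₂ (proj₂ (sub-node a∈))))))))))
               (cong (λ Q → bit (child e′ Q r)) (proj₁ (proj₂ (proj₂ (proj₂ (proj₂ (proj₂ (proj₂ (sub-node a∈)))))))))))
      Bl : μ′ #B L′ A ≡ bit (below e′ (sub a) l)
      Bl = trans (cong₂ (μ′ #B) L′≡ A≡) (trans (proj₁ (others I _ left≢ _)) (B-row row-l a a∈))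
      Br : μ′ #B R′ A ≡ bit (below e′ (sub a) r)
      Br = trans (cong₂ (μ′ #B) R′≡ A≡) (trans (proj₁ (others I _ right≢ _)) (B-row row-r a a∈))

      v₁≡ : v₁ ≡ bit (at e′ (sub a) τ)
      v₁≡ = trans (cong₂ (λ u w → bit (1 <ᵇ u + w)) Dl Dr)
              (trans (at-value (child e′ ql l) (child e′ qr r)) (cong (λ Q → bit (at e′ Q τ)) (sym sub-a)))
      v₂≡ : v₂ ≡ bit (below e′ (sub a) τ)
      v₂≡ = trans (cong₂ (λ u w → bit (0 <ᵇ u + w)) v₁≡ (cong₂ _+_ Bl Br))
              (below-value (at e′ (sub a) τ) (below e′ (sub a) l) (below e′ (sub a) r))
      v₃≡ : v₃ ≡ bit (child e′ (sub a) τ)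
      v₃≡ = trans (cong₂ (λ u w → bit (0 <ᵇ u + w)) v₁≡
              (cong₂ _∸_ (trans (write-≡ μ′ #B X A v₂) v₂≡) PE≡))
              (trans (child-value (at e′ (sub a) τ) (below e′ (sub a) l ∨ below e′ (sub a) r) (μ₀ #P-e t a)) child≡)
        where
        child≡ : bit (if e′ a then at e′ (sub a) τ else below e′ (sub a) τ) ≡ bit (child e′ (sub a) τ)
        child≡ rewrite sub-a = refl

      ν : Memory
      ν = write (write (write (write μ′ #at 0 0 v₁) #B X A v₂) #D X A v₃) #a 0 0 (A + 1)

      next-keeps : Keeps process-spares μ ν → Inv (suc a) ν
      next-keeps kν = record
        { counter = trans (+-comm A 1) (cong suc A≡)
        ; keeps   = kν
        ; others  = λ y y≢x b →
            trans (write-≢ μ′ #B X A v₂ b (λ y≡X → y≢x (trans y≡X X≡))) (proj₁ (others I y y≢x b)) ,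
            trans (write-≢ μ′ #D X A v₃ b (λ y≡X → y≢x (trans y≡X X≡))) (proj₂ (others I y y≢x b))
        ; B-done  = B-done′
        ; D-done  = D-done′
        }
        where
        B-done′ : ∀ b → 1 ≤ b → b < suc a → write μ′ #B X A v₂ #B x b ≡ bit (below e′ (sub b) τ)
        B-done′ b 1≤b (s≤s b≤a) with m≤n⇒m<n∨m≡n b≤a
        ... | inj₁ b<a  = trans (write-≢₂ μ′ #B X A v₂ x (λ b≡A → <⇒≢ b<a (trans b≡A A≡))) (B-done I b 1≤b b<a)
        ... | inj₂ refl = write-hit μ′ #B X A v₂ (sym X≡) (sym A≡) v₂≡
        D-done′ : ∀ b → b < suc a → write μ′ #D X A v₃ #D x b ≡ bit (child e′ (sub b) τ)
        D-done′ b (s≤s b≤a) with m≤n⇒m<n∨m≡n b≤a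
        ... | inj₁ b<a  = trans (write-≢₂ μ′ #D X A v₃ x (λ b≡A → <⇒≢ b<a (trans b≡A A≡))) (D-done I b b<a)
        ... | inj₂ refl = write-hit μ′ #D X A v₃ (sym X≡) (sym A≡) v₃≡

    cell-correct : ∀ {a μ′} → a ∈[ K ] → Inv a μ′ → Within cell 100 μ′ (Inv (suc a))
    cell-correct {a} {μ′} a∈ I = weaken ≤-refl (λ { (refl , K′) → next-keeps (Keeps-trans {process-spares} (keeps I) K′) })
      (frame process-spares {Q = _≡ ν} refl (assign-then (assign-then (assign-then (assign-rule refl)))))
      where open Cell a∈ I

    process-correct : Within process (10 + suc K * 112) μ (λ μ′ →
      (Row μ′ x τ × (∀ y → y ≢ x → SameRow μ μ′ y)) × Keeps process-spares μ μ′)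
    process-correct = frame process-spares {Q = λ μ′ → Row μ′ x τ × (∀ y → y ≢ x → SameRow μ μ′ y)} refl
      (assign-then (assign-then (weaken ≤-refl finish (count-rule Inv counter limit cell-correct initial))))
      where
      X = μ #x 0 0
      limit : ∀ {a μ′} → Inv a μ′ → μ′ #k (μ′ #t 0 0) 0 ≡ K
      limit I = trans (stable (keeps I) #k refl _ 0)
        (trans (cong (λ u → μ₀ #k u 0) (trans (stable (keeps I) #t refl 0 0) t≡)) k-cell)
      finish : ∀ {μ′} → Inv (suc K) μ′ → Row μ′ x τ × (∀ y → y ≢ x → SameRow μ μ′ y)
      finish I = record { B-row = λ a (1≤a , a≤K) → B-done I a 1≤a (s≤s a≤K) ; D-row = λ a a≤K → D-done I a (s≤s a≤K) } , others I
      initial : Inv 1 (write (write μ #D X 0 1) #a 0 0 1)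
      initial = record
        { counter = refl
        ; keeps   = spared process-spares {c = assign #D (var #x) (lit 0) (lit 1) ⨾ set #a (lit 1)} {config μ 0 []} refl (seq assign assign)
        ; others  = λ y y≢x b → refl , write-≢ μ #D X 0 1 b (λ y≡X → y≢x (trans y≡X x≡))
        ; B-done  = λ b 1≤b b<1 → contradiction 1≤b (<⇒≱ b<1)
        ; D-done  = λ { zero _ → trans (write-hit μ #D X 0 1 (sym x≡) refl refl) (cong (λ Q → bit (child e′ Q τ)) (sym sub-0))
                      ; (suc b) (s≤s ()) }
        }

module Traversal {μ₀ : Memory} {t : ℕ} {p : Pattern} (env : PatternAt μ₀ t p) (t≡ : μ₀ #t 0 0 ≡ t) where
  open Matcher env t≡ public
  open PatternAt env

  -- A vertex is seen twice. Expanding it takes 76 operations including the loop test, and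
  -- processing it takes 36 besides the loop over its row, whose rounds cost 12 for the test and 100
  -- for the cell.
  node-cost : ℕ
  node-cost = 112 + suc K * 112

  traverse-cost : Tree → ℕ
  traverse-cost ε            = 30
  traverse-cost (node l _ r) = node-cost + (traverse-cost l + traverse-cost r)

  record Top (μ : Memory) (n : ℕ) (τ : Tree) : Set where
    field
      sp≡   : μ #sp 0 0 ≡ suc n
      item≡ : μ #st (suc n) 0 ≡ pointer (root τ)
      flag≡ : μ #st (suc n) 1 ≡ 0

  -- `stack` and `other` say what survives: entries beneath the present one, and the rows of
  -- vertices outside `τ`, among them row 0 and the row of a sibling.
  record Processed (μ : Memory) (n : ℕ) (τ : Tree) (μ′ : Memory) : Set where
    field
      keeps : Keeps match-spares μ₀ μ′
      sp≡   : μ′ #sp 0 0 ≡ n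
      stack : ∀ i c → i ≤ n → μ′ #st i c ≡ μ #st i c
      row   : Row μ′ (pointer (root τ)) τ
      other : ∀ y → ¬ y ∈ᵗ τ → SameRow μ μ′ y

  module Expand {μ : Memory} {n x : ℕ} {l r : Tree} (top-entry : Top μ n (node l x r))
    (kept : Keeps match-spares μ₀ μ) (left≡ : μ₀ #T-left x 0 ≡ pointer (root l))
    (right≡ : μ₀ #T-right x 0 ≡ pointer (root r)) where

    open Top top-entry

    S X : ℕ
    S = μ #sp 0 0
    X = μ #st S 0

    μ₁ μ₂ μ₃ μ₄ μ₅ μ₆ μ₇ : Memory
    μ₁ = write μ #x 0 0 X
    μ₂ = write μ₁ #st S 1 1
    μ₃ = write μ₂ #st (S + 1) 0 (μ #T-right X 0)
    μ₄ = write μ₃ #st (S + 1) 1 0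
    μ₅ = write μ₄ #st (S + 2) 0 (μ #T-left X 0)
    μ₆ = write μ₅ #st (S + 2) 1 0
    μ₇ = write μ₆ #sp 0 0 (S + 2)

    X≡ : X ≡ x
    X≡ = trans (cong (λ s → μ #st s 0) sp≡) item≡

    S+1≡ : suc (suc n) ≡ S + 1
    S+1≡ = trans (+-comm 1 (suc n)) (cong (_+ 1) (sym sp≡))

    S+2≡ : suc (suc (suc n)) ≡ S + 2
    S+2≡ = trans (+-comm 2 (suc n)) (cong (_+ 2) (sym sp≡))

    left-entry : Top μ₇ (suc (suc n)) l
    left-entry = record
      { sp≡   = sym S+2≡
      ; item≡ = trans (write-≢₂ μ₅ #st (S + 2) 1 0 (suc (suc (suc n))) {0} (λ ()))
                  (write-hit μ₄ #st (S + 2) 0 (μ #T-left X 0) S+2≡ refl (trans (kept #T-left refl X 0) (trans (cong (λ y → μ₀ #T-left y 0) X≡) left≡)))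
      ; flag≡ = write-hit μ₅ #st (S + 2) 1 0 S+2≡ refl refl
      }

    under-top : ∀ i c → i ≤ suc (suc n) → μ₇ #st i c ≡ μ₄ #st i c
    under-top i c i≤ = trans (write-≢ μ₅ #st (S + 2) 1 0 c i≢) (write-≢ μ₄ #st (S + 2) 0 (μ #T-left X 0) c i≢)
      where
      i≢ : i ≢ S + 2
      i≢ i≡ = <⇒≢ (s≤s i≤) (trans i≡ (sym S+2≡))

    right-item : μ₇ #st (suc (suc n)) 0 ≡ pointer (root r)
    right-item = trans (under-top _ 0 ≤-refl) (trans (write-≢₂ μ₃ #st (S + 1) 1 0 (suc (suc n)) {0} (λ ()))
      (write-hit μ₂ #st (S + 1) 0 (μ #T-right X 0) S+1≡ refl (trans (kept #T-right refl X 0) (trans (cong (λ y → μ₀ #T-right y 0) X≡) right≡))))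

    right-flag : μ₇ #st (suc (suc n)) 1 ≡ 0
    right-flag = trans (under-top _ 1 ≤-refl) (write-hit μ₃ #st (S + 1) 1 0 S+1≡ refl refl)

    under-right : ∀ i c → i ≤ suc n → μ₇ #st i c ≡ μ₂ #st i c
    under-right i c i≤ = trans (under-top i c (m≤n⇒m≤1+n i≤))
      (trans (write-≢ μ₃ #st (S + 1) 1 0 c i≢) (write-≢ μ₂ #st (S + 1) 0 (μ #T-right X 0) c i≢))
      where
      i≢ : i ≢ S + 1
      i≢ i≡ = <⇒≢ (s≤s i≤) (trans i≡ (sym S+1≡))

    own-item : μ₇ #st (suc n) 0 ≡ x
    own-item = trans (under-right (suc n) 0 ≤-refl) (trans (write-≢₂ μ₁ #st S 1 1 _ {0} (λ ())) item≡)

    own-flag : μ₇ #st (suc n) 1 ≡ 1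
    own-flag = trans (under-right (suc n) 1 ≤-refl) (write-hit μ₁ #st S 1 1 (sym sp≡) refl refl)

    rest : ∀ i c → i ≤ n → μ₇ #st i c ≡ μ #st i c
    rest i c i≤ = trans (under-right i c (m≤n⇒m≤1+n i≤))
      (write-≢ μ₁ #st S 1 1 c (λ i≡ → <⇒≢ (s≤s i≤) (trans i≡ sp≡)))

    expand-correct : x ≢ 0 → Within visit-top 72 μ (λ μ′ → μ′ ≡ μ₇ × Keeps match-spares μ μ′)
    expand-correct x≢0 = frame match-spares {Q = _≡ μ₇} refl (assign-then {v = read #st (var #sp) (lit 0)}
      (if-no-rule {B = 58} (trans (cong (λ s → μ #st s 1) sp≡) flag≡)
      (if-yes-rule {B = 54} (λ X≡0 → x≢0 (trans (sym X≡) X≡0))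
      (assign-then (assign-then (assign-then (assign-then (assign-then (assign-rule refl)))))))))

  -- The loop follows the stack and not the recursion of the tree. So the statement is in
  -- continuation style: the loop removes the top entry with all that this entails, and whatever the
  -- loop does afterwards costs `B`.
  traverse-correct : ∀ τ {μ n B Q} → SearchTree τ → ¬ 0 ∈ᵗ τ → Stored μ₀ τ → Keeps match-spares μ₀ μ →
    Row μ 0 ε → Top μ n τ → (∀ {μ′} → Processed μ n τ μ′ → Within traverse B μ′ Q) →
    Within traverse (traverse-cost τ + B) μ Q
  traverse-correct ε {μ} {n} {B} _ _ _ kept row₀ top-entry continue =
    loop-rule {B = 26} (λ eq → case trans (sym eq) sp≡ of λ ()) popped continue
    where
    open Top top-entry
    S = μ #sp 0 0
    ν = write (write μ #x 0 0 (μ #st S 0)) #sp 0 0 (S ∸ 1)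
    popped : Within visit-top 26 μ (Processed μ n ε)
    popped = weaken ≤-refl
      (λ { (refl , K′) → record
         { keeps = Keeps-trans {match-spares} kept K′ ; sp≡ = cong (_∸ 1) sp≡ ; stack = λ _ _ _ → refl
         ; row = Row-same (λ _ → refl) (λ _ → refl) row₀ ; other = λ _ _ _ → refl , refl } })
      (frame match-spares {Q = _≡ ν} refl (assign-then (if-no-rule (trans (cong (λ s → μ #st s 1) sp≡) flag≡)
        (if-no-rule (trans (cong (λ s → μ #st s 0) sp≡) item≡) (assign-rule refl)))))
  traverse-correct (node l x r) {μ} {n} {B} {Q} sτ@(_ , _ , sl , sr) 0∉τ st@(left≡ , right≡ , stl , str) kept row₀ top-entry continue =
    weaken (≤-reflexive bound) id
    (loop-rule {B = 72} (λ eq → case trans (sym eq) (Top.sp≡ top-entry) of λ ())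
      (expand-correct (λ { refl → 0∉τ at-root }))
      λ { (refl , K₁) →
        traverse-correct l sl (0∉τ ∘ in-left) stl (Keeps-trans {match-spares} kept K₁)
          (Row-same (λ _ → refl) (λ _ → refl) row₀) left-entry λ {μ₂} L →
        traverse-correct r sr (0∉τ ∘ in-right) str (Processed.keeps L)
          (Row-same {μ₇} (λ a → proj₁ (Processed.other L 0 (0∉τ ∘ in-left) a)) (λ a → proj₂ (Processed.other L 0 (0∉τ ∘ in-left) a))
            (Row-same {μ} {μ₇} (λ _ → refl) (λ _ → refl) row₀))
          (record { sp≡ = Processed.sp≡ L ; item≡ = trans (Processed.stack L _ 0 ≤-refl) right-item
                  ; flag≡ = trans (Processed.stack L _ 1 ≤-refl) right-flag }) λ {μ₃} R →
        last-visit L R })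
    where
    open Expand {l = l} {r} top-entry kept left≡ right≡
    last-visit : ∀ {ν₂ ν₃} → Processed μ₇ (suc (suc n)) l ν₂ → Processed ν₂ (suc n) r ν₃ →
      Within traverse (36 + suc K * 112 + B) ν₃ Q
    last-visit {ν₂} {ν₃} L R = loop-rule {B = 32 + suc K * 112} (λ eq → case trans (sym eq) R.sp≡ of λ ())
      (weaken ≤-refl id processed) continue
      where
      module L = Processed L
      module R = Processed R
      S′ = ν₃ #sp 0 0
      ν₄ = write ν₃ #x 0 0 (ν₃ #st S′ 0)
      item : ν₃ #st S′ 0 ≡ x
      item = trans (cong (λ s → ν₃ #st s 0) R.sp≡) (trans (R.stack _ 0 ≤-refl) (trans (L.stack _ 0 (n≤1+n _)) own-item))
      flag : ν₃ #st S′ 1 ≡ 1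
      flag = trans (cong (λ s → ν₃ #st s 1) R.sp≡) (trans (R.stack _ 1 ≤-refl) (trans (L.stack _ 1 (n≤1+n _)) own-flag))
      -- The row of `l` is not overwritten while `r` is processed: it is indexed by a label outside
      -- `r`, or by 0 if `l` is empty.
      row-l : Row ν₃ (pointer (root l)) l
      row-l = Row-same (λ a → proj₁ (R.other _ ∉r a)) (λ a → proj₂ (R.other _ ∉r a)) L.row
        where
        ∉r : ¬ pointer (root l) ∈ᵗ r
        ∉r = go l refl
          where
          go : ∀ l′ → l′ ≡ l → ¬ pointer (root l′) ∈ᵗ r
          go ε            _    y∈ = 0∉τ (in-right y∈)
          go (node _ _ _) refl y∈ = <-asym (left-< sτ at-root) (right-> sτ y∈)
      pointer≢ : ∀ u → (∀ {y} → y ∈ᵗ u → y ≢ x) → pointer (root u) ≢ x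
      pointer≢ ε            _  eq = 0∉τ (subst (_∈ᵗ node l x r) (sym eq) at-root)
      pointer≢ (node _ _ _) ≢x eq = ≢x at-root eq
      k₄ : Keeps match-spares ν₃ ν₄
      k₄ = spared match-spares {c = set #x (read #st (var #sp) (lit 0))} {config ν₃ 0 []} refl assign
      open Process {ν₄} {x} {l} {r} (Keeps-trans {match-spares} R.keeps k₄) item left≡ right≡
        (pointer≢ l (<⇒≢ ∘ left-< sτ)) (pointer≢ r (>⇒≢ ∘ right-> sτ))
        (Row-same (λ _ → refl) (λ _ → refl) row-l) (Row-same (λ _ → refl) (λ _ → refl) R.row)
      processed : Within visit-top (32 + suc K * 112) ν₃ (Processed μ n (node l x r))
      processed = weaken (≤-reflexive arith) id (assign-then {v = read #st (var #sp) (lit 0)}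
        (if-yes-rule (λ eq → case trans (sym flag) eq of λ ())
        (process-correct ⨾-rule λ {ν₅} ((row′ , others) , K₅) → assign-rule (record
          { keeps = Keeps-trans {match-spares} R.keeps (Keeps-trans {match-spares} k₄
                      (Keeps-trans {match-spares} (Keeps-weaken {process-spares} (<ᵇ-weaken (m≤m+n 16 3)) K₅)
                        (spared match-spares {c = pop} {config ν₅ 0 []} refl assign)))
          ; sp≡   = cong (_∸ 1) (trans (K₅ #sp refl 0 0) R.sp≡)
          ; stack = λ i c i≤n → trans (K₅ #st refl i c) (trans (R.stack i c (m≤n⇒m≤1+n i≤n))
                      (trans (L.stack i c (m≤n⇒m≤1+n (m≤n⇒m≤1+n i≤n))) (rest i c i≤n)))
          ; row   = Row-same (λ _ → refl) (λ _ → refl) row′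
          ; other = λ y y∉ → SameRow-trans {μ} {ν₂} {ν₅} (L.other y (y∉ ∘ in-left))
                      (SameRow-trans {ν₂} {ν₃} {ν₅} (R.other y (y∉ ∘ in-right))
                        (others y (λ { refl → y∉ at-root }))) }))))
        where
        arith : 8 + (6 + (10 + suc K * 112 + 8)) ≡ 32 + suc K * 112
        arith = cong (24 +_) (+-comm (suc K * 112) 8)
    bound : 76 + (traverse-cost l + (traverse-cost r + (36 + suc K * 112 + B))) ≡ node-cost + (traverse-cost l + traverse-cost r) + B
    bound = trans (cong (76 +_) (trans (sym (+-assoc (traverse-cost l) _ _)) (trans (sym (+-assoc _ (36 + suc K * 112) B))
      (cong (_+ B) (+-comm (traverse-cost l + traverse-cost r) (36 + suc K * 112)))))) refl


≤-slack : ∀ {a b} c → a + c ≡ b → a ≤ b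
≤-slack {a} c refl = m≤m+n a c

module _ {μ₀ : Memory} {t : ℕ} {p : Pattern} (env : PatternAt μ₀ t p) (t≡ : μ₀ #t 0 0 ≡ t) where
  open Traversal env t≡
  open PatternAt env

  -- A tree has one more empty subtree than vertices, and each costs 30; hence 142 = 112 + 30 per
  -- vertex and a further 30.
  traverse-cost-≡ : ∀ τ → traverse-cost τ ≡ size τ * (142 + suc K * 112) + 30
  traverse-cost-≡ ε = refl
  traverse-cost-≡ (node l _ r) rewrite traverse-cost-≡ l | traverse-cost-≡ r =
    solve 3 (λ a b c → (con 112 :+ c) :+ ((a :* (con 142 :+ c) :+ con 30) :+ (b :* (con 142 :+ c) :+ con 30))
                       := (con 142 :+ c) :+ (a :+ b) :* (con 142 :+ c) :+ con 30) refl (size l) (size r) (suc K * 112)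

  -- Row 0 belongs to the empty tree, which matches the empty pattern subtree and no other.
  record Zeroed (a : ℕ) (μ : Memory) : Set where
    field
      counter : μ #a 0 0 ≡ a
      keeps   : Keeps match-spares μ₀ μ
      D-0     : μ #D 0 0 ≡ 1
      B-zero  : ∀ b → 1 ≤ b → b < a → μ #B 0 b ≡ 0
      D-zero  : ∀ b → 1 ≤ b → b < a → μ #D 0 b ≡ 0

  open Zeroed

  zero-cell-correct : ∀ {a μ} → a ∈[ K ] → Zeroed a μ → Within zero-cell 20 μ (Zeroed (suc a))
  zero-cell-correct {a} {μ} (1≤a , _) Z = weaken ≤-refl (λ { (refl , K′) → record
      { counter = trans (+-comm A 1) (cong suc (counter Z))
      ; keeps   = Keeps-trans {match-spares} (keeps Z) K′
      ; D-0     = trans (write-≢₂ μ #D 0 A 0 0 (λ 0≡A → <⇒≢ 1≤a (trans 0≡A (counter Z)))) (D-0 Z)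
      ; B-zero  = λ b 1≤b b≤a → zeroed #B b b≤a (B-zero Z b 1≤b)
      ; D-zero  = λ b 1≤b b≤a → zeroed #D b b≤a (D-zero Z b 1≤b) } })
    (frame match-spares {Q = _≡ ν} refl (assign-then (assign-then (assign-rule refl))))
    where
    A = μ #a 0 0
    ν = write (write (write μ #B 0 A 0) #D 0 A 0) #a 0 0 (A + 1)
    zeroed : ∀ c b → b < suc a → (b < a → μ c 0 b ≡ 0) → write μ c 0 A 0 c 0 b ≡ 0
    zeroed c b (s≤s b≤a) old with m≤n⇒m<n∨m≡n b≤a
    ... | inj₁ b<a  = trans (write-≢₂ μ c 0 A 0 0 (λ b≡A → <⇒≢ b<a (trans b≡A (counter Z)))) (old b<a)
    ... | inj₂ refl = write-hit μ c 0 A 0 refl (sym (counter Z)) refl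

  Zeroed⇒Row : ∀ {μ} → Zeroed (suc K) μ → Row μ 0 ε
  Zeroed⇒Row Z = record
    { B-row = λ a (1≤a , a≤K) → B-zero Z a 1≤a (s≤s a≤K)
    ; D-row = λ { zero _ → trans (D-0 Z) (cong (λ Q → bit (child e′ Q ε)) (sym sub-0))
                ; (suc a) a≤K → trans (D-zero Z (suc a) (s≤s z≤n) (s≤s a≤K)) (sym (child≡0 (s≤s z≤n , a≤K))) }
    }
    where
    child≡0 : ∀ {a} → a ∈[ K ] → bit (child e′ (sub a) ε) ≡ 0
    child≡0 {a} a∈ = let l , r , eq , _ = sub-node a∈ in
      trans (cong (λ Q → bit (child e′ Q ε)) eq) (cong bit (child-ε e′ 0 l a r))

  match-correct : ∀ {n T} → SearchTree T → ¬ 0 ∈ᵗ T → Stored μ₀ (top (suc n) T) → μ₀ #n 0 0 ≡ n →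
    Within match (60 + (suc K * 32 + size T * (142 + suc K * 112))) μ₀
      (λ μ′ → Row μ′ (pointer (root T)) T × Keeps match-spares μ₀ μ′)
  match-correct {n} {T} sT 0∉T (root≡ , _ , stT , _) n≡ = frame match-spares {Q = λ μ′ → Row μ′ (pointer (root T)) T} refl
    (weaken (≤-reflexive bound) id
    (assign-then (assign-then {i = lit 0} {lit 0} {lit 1} (count-rule Zeroed counter limit zero-cell-correct initial ⨾-rule λ {μ} Z →
      assign-then {i = lit 1} {lit 0} {leftOf (var #n ⊕ lit 1)} (assign-then {i = lit 1} {lit 1} {lit 0} (assign-then {i = lit 0} {lit 0} {lit 1}
      (traverse-correct T {n = 0} sT 0∉T stT
        (Keeps-trans {match-spares} (keeps Z) (pushes μ))
        (Row-same (λ _ → refl) (λ _ → refl) (Zeroed⇒Row Z))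
        (record { sp≡ = refl ; item≡ = item Z ; flag≡ = refl })
        λ {μ′} R → exit-rule {Q = λ μ′ → Row μ′ (pointer (root T)) T} (Processed.sp≡ R) (Processed.row R))))))))
    where
    limit : ∀ {a μ} → Zeroed a μ → μ #k (μ #t 0 0) 0 ≡ K
    limit Z = trans (keeps Z #k refl _ 0) (trans (cong (λ u → μ₀ #k u 0) (trans (keeps Z #t refl 0 0) t≡)) k-cell)
    initial : Zeroed 1 (write (write μ₀ #D 0 0 1) #a 0 0 1)
    initial = record
      { counter = refl
      ; keeps   = spared match-spares {c = assign #D (lit 0) (lit 0) (lit 1) ⨾ set #a (lit 1)} {config μ₀ 0 []} refl (seq assign assign)
      ; D-0     = refl
      ; B-zero  = λ b 1≤b b<1 → contradiction 1≤b (<⇒≱ b<1)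
      ; D-zero  = λ b 1≤b b<1 → contradiction 1≤b (<⇒≱ b<1)
      }
    pushes : ∀ μ → Keeps match-spares μ _
    pushes μ = spared match-spares
      {c = assign #st (lit 1) (lit 0) (leftOf (var #n ⊕ lit 1)) ⨾ (assign #st (lit 1) (lit 1) (lit 0) ⨾ set #sp (lit 1))}
      {config μ 0 []} refl (seq assign (seq assign assign))
    item : ∀ {a μ} → Zeroed a μ → μ #T-left (μ #n 0 0 + 1) 0 ≡ pointer (root T)
    item {μ = μ} Z = trans (keeps Z #T-left refl _ 0) (trans (cong (λ i → μ₀ #T-left i 0)
      (trans (cong (_+ 1) (trans (keeps Z #n refl 0 0) n≡)) (+-comm n 1))) root≡)
    bound : 8 + (suc K * 32 + (18 + (traverse-cost T + 4))) ≡ 60 + (suc K * 32 + size T * (142 + suc K * 112))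
    bound rewrite traverse-cost-≡ T = solve 2 (λ a b → con 8 :+ (a :+ (con 18 :+ ((b :+ con 30) :+ con 4))) := con 60 :+ (a :+ b))
      refl (suc K * 32) (size T * (142 + suc K * 112))

  private
    p′ : Pattern
    p′ = record p { e = e′ }

    -- A vertex with a parent is not the root, so its cell is prescribed by the input. As
    -- containment consults only such vertices, it does not see the arbitrary value at the root.
    e′≡e : ∀ {i j} → Parent (P p) i j → e′ j ≡ e p j
    e′≡e {i} {j} par = trans (cong (0 <ᵇ_) (P-e j (∈⇒label (P∈𝒯k p) (child-∈ par)) (nonroot (proj₁ (P∈𝒯k p)) par))) (0<bit (e p j))
      where
      0<bit : ∀ b → (0 <ᵇ bit b) ≡ b
      0<bit true  = refl
      0<bit false = refl
      nonroot : ∀ {T} → SearchTree T → Parent T i j → root T ≢ just j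
      nonroot {node _ _ _} s par refl = ¬parent-of-root {i = i} s par

    Contains⇒′ : ∀ {n T} → Contains n T p → Contains n T p′
    Contains⇒′ c = record
      { f = f ; f-range = f-range ; injective = injective
      ; left-1  = λ eq ej → left-1 eq (trans (sym (e′≡e (inj₁ eq))) ej)
      ; left-0  = λ eq ej → left-0 eq (trans (sym (e′≡e (inj₁ eq))) ej)
      ; right-1 = λ eq ej → right-1 eq (trans (sym (e′≡e (inj₂ eq))) ej)
      ; right-0 = λ eq ej → right-0 eq (trans (sym (e′≡e (inj₂ eq))) ej)
      }
      where open Contains c

    Contains⇐′ : ∀ {n T} → Contains n T p′ → Contains n T p
    Contains⇐′ c = record
      { f = f ; f-range = f-range ; injective = injective
      ; left-1  = λ eq ej → left-1 eq (trans (e′≡e (inj₁ eq)) ej)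
      ; left-0  = λ eq ej → left-0 eq (trans (e′≡e (inj₁ eq)) ej)
      ; right-1 = λ eq ej → right-1 eq (trans (e′≡e (inj₂ eq)) ej)
      ; right-0 = λ eq ej → right-0 eq (trans (e′≡e (inj₂ eq)) ej)
      }
      where open Contains c

  Row-verdict : ∀ {n T μ} → Friendly p → T ∈𝒯 n → Row μ (pointer (root T)) T →
    let v = μ #B (pointer (root T)) (pointer (root (P p))) in (v ≡ 0 → ¬ Contains n T p) × (¬ Contains n T p → v ≡ 0)
  Row-verdict {n} {T} {μ} F T∈ row = verdict (Friendly⇒root p F)
    where
    verdict : (∃ λ r → root (P p) ≡ just r) →
      let v = μ #B (pointer (root T)) (pointer (root (P p))) in (v ≡ 0 → ¬ Contains n T p) × (¬ Contains n T p → v ≡ 0)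
    verdict (r , r≡) = (λ v≡0 c → case trans (sym v≡0) (trans v≡ (cong bit (Contains⇒below T∈ (Contains⇒′ c) r≡))) of λ ()) ,
      λ ¬c → trans v≡ (not-below ¬c (below e′ (P p) T) refl)
      where
      v≡ : μ #B (pointer (root T)) (pointer (root (P p))) ≡ bit (below e′ (P p) T)
      v≡ = trans (cong (μ #B (pointer (root T))) (cong pointer r≡))
        (trans (Row.B-row row r (∈⇒label (P∈𝒯k p) (root⇒∈ r≡)))
          (cong (λ Q → bit (below e′ Q T)) (subtree-child (proj₁ (P∈𝒯k p)) ⊑-refl r≡)))
      not-below : ¬ Contains n T p → ∀ b → below e′ (P p) T ≡ b → bit b ≡ 0
      not-below _  false _  = refl
      not-below ¬c true  eq = contradiction (Contains⇐′ (below⇒Contains p′ T∈ r≡ eq)) ¬c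

-- The results for the patterns are added up in `#bad`, so a final 0 means that every pattern is
-- avoided.
check-step check-loop check : Program
check-step = match ⨾ (set #bad (var #bad ⊕ read #B (leftOf (var #n ⊕ lit 1)) (read #P-root (var #t) (lit 0))) ⨾
             set #t (var #t ⊕ lit 1))
check-loop = while (var #t less var #ℓ) check-step
check      = set #bad (lit 0) ⨾ (set #t (lit 0) ⨾ check-loop)

check-spares : ℕ → Bool
check-spares a = a <ᵇ 14

PatternsAt : Memory → ℕ → List Pattern → Set
PatternsAt μ t []       = ⊤
PatternsAt μ t (p ∷ ps) = PatternAt μ t p × PatternsAt μ (suc t) ps

PatternsAt-Keeps : ∀ {S μ μ′} → (∀ a → (a <ᵇ 7) ≡ true → S a ≡ true) → Keeps S μ μ′ →
  ∀ t ps → PatternsAt μ t ps → PatternsAt μ′ t ps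
PatternsAt-Keeps S⊇ K t []       _          = tt
PatternsAt-Keeps S⊇ K t (p ∷ ps) (env , rest) = record
  { k-cell  = trans (K #k (S⊇ #k refl) t 0) k-cell
  ; P-root  = trans (K #P-root (S⊇ #P-root refl) t 0) P-root
  ; P-left  = λ a a∈ → trans (K #P-left (S⊇ #P-left refl) t a) (P-left a a∈)
  ; P-right = λ a a∈ → trans (K #P-right (S⊇ #P-right refl) t a) (P-right a a∈)
  ; P-e     = λ a a∈ a≢r → trans (K #P-e (S⊇ #P-e refl) t a) (P-e a a∈ a≢r)
  } , PatternsAt-Keeps S⊇ K (suc t) ps rest
  where open PatternAt env

-- The witness is the difference of the two sides, expanded in n - 1 and k - 1, where all its
-- coefficients are nonnegative; its constant 74 is 600 - 526, the gap at n = k = 1.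
iteration-cost : ∀ n k → 1 ≤ n → 1 ≤ k → 36 + (60 + (suc k * 32 + n * (142 + suc k * 112))) ≤ 600 * (n * k ^ 2)
iteration-cost (suc n) (suc k) _ _ = ≤-slack
  (600 * (n * (k * k)) + 1088 * (n * k) + 234 * n + 600 * (k * k) + 1056 * k + 74)
  (solve 2 (λ n k → con 36 :+ (con 60 :+ ((con 2 :+ k) :* con 32 :+ (con 1 :+ n) :* (con 142 :+ (con 2 :+ k) :* con 112)))
     :+ (con 600 :* (n :* (k :* k)) :+ con 1088 :* (n :* k) :+ con 234 :* n :+ con 600 :* (k :* k) :+ con 1056 :* k :+ con 74)
     := con 600 :* ((con 1 :+ n) :* ((con 1 :+ k) :* ((con 1 :+ k) :* con 1)))) refl n k)

-- `b` and `b′` are the contents of `#bad` before and after the tests. Both directions matter: a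
-- slide has to stop in the language and to go on outside it.
Verdict : ℕ → Tree → ℕ → List Pattern → ℕ → Set
Verdict n T b ps b′ =
  (b′ ≡ 0 → b ≡ 0 × All (λ p → ¬ Contains n T p) ps) × (b ≡ 0 → All (λ p → ¬ Contains n T p) ps → b′ ≡ 0)

module _ {n : ℕ} {T : Tree} (1≤n : 1 ≤ n) (T∈ : T ∈𝒯 n) (size≡ : size T ≡ n) where

  check-loop-correct : ∀ ps t {μ} → All Friendly ps → PatternsAt μ t ps → μ #t 0 0 ≡ t → μ #ℓ 0 0 ≡ t + length ps →
    μ #n 0 0 ≡ n → Stored μ (top (suc n) T) →
    Within check-loop (600 * (n * sumOfSquares ps) + 8) μ (λ μ′ → Verdict n T (μ #bad 0 0) ps (μ′ #bad 0 0))
  check-loop-correct [] t {μ} [] _ t≡ ℓ≡ n≡ st = weaken (m≤n+m 8 (600 * (n * 0))) id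
    (exit-rule (trans (cong₂ (λ a b → bit (a <ᵇ b)) t≡ (trans ℓ≡ (+-identityʳ t))) (cong bit (≮⇒<ᵇ {t} (<-irrefl refl))))
      ((λ b≡0 → b≡0 , []) , (λ b≡0 _ → b≡0)))
  check-loop-correct (p ∷ ps) t {μ} (F ∷ Fs) (env , envs) t≡ ℓ≡ n≡ st = weaken bound id
    (loop-rule (λ eq → case trans (sym eq) (trans (cong₂ (λ a b → bit (a <ᵇ b)) t≡ ℓ≡)
                          (cong bit (<⇒<ᵇ′ (m<m+n t {suc (length ps)} (s≤s z≤n))))) of λ ())
      (frame check-spares {Q = Next} refl (match-correct env t≡ {n} {T} (proj₁ T∈) (0∉ T∈) st n≡ ⨾-rule λ {μ₁} (row , K₁) →
        assign-then {i = lit 0} {lit 0} {var #bad ⊕ read #B (leftOf (var #n ⊕ lit 1)) (read #P-root (var #t) (lit 0))}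
          (assign-rule (step K₁ row))))
      λ {μ₂} ((t₂≡ , verdict) , K₂) → weaken ≤-refl (combine verdict)
        (check-loop-correct ps (suc t) Fs (PatternsAt-Keeps {check-spares} (<ᵇ-weaken (m≤m+n 7 7)) K₂ (suc t) ps envs) t₂≡
          (trans (K₂ #ℓ refl 0 0) (trans ℓ≡ (+-suc t (length ps)))) (trans (K₂ #n refl 0 0) n≡)
          (Stored-Keeps {check-spares} (top (suc n) T) refl refl K₂ st)))
    where
    open PatternAt env
    Next : Memory → Set
    Next μ′ = μ′ #t 0 0 ≡ suc t × Verdict n T (μ #bad 0 0) [ p ] (μ′ #bad 0 0)
    step : ∀ {μ₁} → Keeps match-spares μ μ₁ → Traversal.Row env t≡ μ₁ (pointer (root T)) T →
      μ₁ #t 0 0 + 1 ≡ suc t ×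
      Verdict n T (μ #bad 0 0) [ p ] (μ₁ #bad 0 0 + μ₁ #B (μ₁ #T-left (μ₁ #n 0 0 + 1) 0) (μ₁ #P-root (μ₁ #t 0 0) 0))
    step {μ₁} K₁ row = trans (+-comm _ 1) (cong suc (trans (K₁ #t refl 0 0) t≡)) ,
      (λ sum≡0 → trans (sym (K₁ #bad refl 0 0)) (m+n≡0⇒m≡0 _ sum≡0) ,
                 proj₁ verdict (trans (sym cell≡) (m+n≡0⇒n≡0 (μ₁ #bad 0 0) sum≡0)) ∷ []) ,
      (λ { b≡0 (¬c ∷ []) → cong₂ _+_ (trans (K₁ #bad refl 0 0) b≡0) (trans cell≡ (proj₂ verdict ¬c)) })
      where
      verdict = Row-verdict env t≡ F T∈ row
      cell≡ : μ₁ #B (μ₁ #T-left (μ₁ #n 0 0 + 1) 0) (μ₁ #P-root (μ₁ #t 0 0) 0) ≡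
              μ₁ #B (pointer (root T)) (pointer (root (P p)))
      cell≡ = cong₂ (μ₁ #B)
        (trans (K₁ #T-left refl _ 0) (trans (cong (λ i → μ #T-left i 0)
          (trans (cong (_+ 1) (trans (K₁ #n refl 0 0) n≡)) (+-comm n 1))) (proj₁ st)))
        (trans (K₁ #P-root refl _ 0) (trans (cong (λ u → μ #P-root u 0) (trans (K₁ #t refl 0 0) t≡)) P-root))
    combine : ∀ {b b₁ b₂} → Verdict n T b [ p ] b₁ → Verdict n T b₁ ps b₂ → Verdict n T b (p ∷ ps) b₂
    combine (to₁ , from₁) (to₂ , from₂) =
      (λ b₂≡0 → let b₁≡0 , av = to₂ b₂≡0 ; b≡0 , ¬c = to₁ b₁≡0 in b≡0 , All.head ¬c ∷ av) ,
      (λ { b≡0 (¬c ∷ av) → from₂ (from₁ b≡0 (¬c ∷ [])) av })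
    1≤k : 1 ≤ k p
    1≤k = ≤-trans (n≤1+n 1) (Friendly⇒2≤k p F)
    open ≤-Reasoning
    M = suc (k p) * 32 + size T * (142 + suc (k p) * 112)
    bound : 8 + (60 + M + 28) + (600 * (n * sumOfSquares ps) + 8) ≤ 600 * (n * sumOfSquares (p ∷ ps)) + 8
    bound = begin
      8 + (60 + M + 28) + (600 * (n * sumOfSquares ps) + 8)
        ≡⟨ solve 2 (λ m s → con 8 :+ (con 60 :+ m :+ con 28) :+ (s :+ con 8) := (con 36 :+ (con 60 :+ m)) :+ s :+ con 8) refl M _ ⟩
      36 + (60 + M) + 600 * (n * sumOfSquares ps) + 8
        ≤⟨ +-monoˡ-≤ 8 (+-monoˡ-≤ (600 * (n * sumOfSquares ps))
             (subst (λ s → 36 + (60 + (suc (k p) * 32 + s * (142 + suc (k p) * 112))) ≤ 600 * (n * k p ^ 2)) (sym size≡)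
               (iteration-cost n (k p) 1≤n 1≤k))) ⟩
      600 * (n * k p ^ 2) + 600 * (n * sumOfSquares ps) + 8
        ≡⟨ cong (_+ 8) (trans (sym (*-distribˡ-+ 600 (n * k p ^ 2) _)) (cong (600 *_) (sym (*-distribˡ-+ n (k p ^ 2) _)))) ⟩
      600 * (n * sumOfSquares (p ∷ ps)) + 8 ∎

  check-correct : ∀ ps {μ} → All Friendly ps → PatternsAt μ 0 ps → μ #ℓ 0 0 ≡ length ps →
    μ #n 0 0 ≡ n → Stored μ (top (suc n) T) →
    Within check (600 * (n * sumOfSquares ps) + 16) μ (λ μ′ →
      ((μ′ #bad 0 0 ≡ 0 → 𝒯 n ps T) × (𝒯 n ps T → μ′ #bad 0 0 ≡ 0)) × Keeps check-spares μ μ′)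
  check-correct ps {μ} Fs envs ℓ≡ n≡ st = frame check-spares
    {Q = λ μ′ → (μ′ #bad 0 0 ≡ 0 → 𝒯 n ps T) × (𝒯 n ps T → μ′ #bad 0 0 ≡ 0)} refl
    (weaken (≤-reflexive (solve 1 (λ s → con 8 :+ (s :+ con 8) := s :+ con 16) refl (600 * (n * sumOfSquares ps)))) id
    (assign-then {i = lit 0} {lit 0} {lit 0} (assign-then {i = lit 0} {lit 0} {lit 0}
    (weaken ≤-refl (λ (to , from) → (λ b≡0 → T∈ , proj₂ (to b≡0)) , (λ (_ , av) → from refl av))
    (check-loop-correct ps 0 Fs (PatternsAt-Keeps {_<ᵇ 7} (λ _ → id) resets 0 ps envs) refl ℓ≡ n≡
      (Stored-frame {μ} (top (suc n) T) (λ _ → refl , refl) st))))))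
    where
    resets : Keeps (_<ᵇ 7) μ (write (write μ #bad 0 0 0) #t 0 0 0)
    resets = spared (_<ᵇ 7) {c = set #bad (lit 0) ⨾ set #t (lit 0)} {config μ 0 []} refl (seq assign assign)

-- Slides

size-vertices : ∀ t → size t ≡ length (vertices t)
size-vertices ε            = refl
size-vertices (node l x r) = trans (cong suc (cong₂ _+_ (size-vertices l) (size-vertices r)))
  (trans (sym (+-suc (length (vertices l)) _)) (sym (length-++ (vertices l))))

size-resp : ∀ {t u} → vertices t ≡ vertices u → size t ≡ size u
size-resp {t} {u} eq = trans (size-vertices t) (trans (cong length eq) (sym (size-vertices u)))

size-⊑ : ∀ {t u} → t ⊑ u → size t ≤ size u
size-⊑ ⊑-refl = ≤-refl
size-⊑ (⊑-left {l = l} {r = r} s)  = ≤-trans (size-⊑ s) (m≤n⇒m≤1+n (m≤m+n (size l) (size r)))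
size-⊑ (⊑-right {l = l} {r = r} s) = ≤-trans (size-⊑ s) (m≤n⇒m≤1+n (m≤n+m (size r) (size l)))

UpRotation-⊑ : ∀ {j T T′} → UpRotation j T T′ →
  ∃₂ λ Y Z → ∃₂ λ X i → node Y j Z ⊑ T × node (node X i Y) j Z ⊑ T′
UpRotation-⊑ here    = _ , _ , _ , _ , ⊑-right ⊑-refl , ⊑-refl
UpRotation-⊑ (inˡ ρ) = let Y , Z , X , i , s , s′ = UpRotation-⊑ ρ in Y , Z , X , i , ⊑-left s , ⊑-left s′
UpRotation-⊑ (inʳ ρ) = let Y , Z , X , i , s , s′ = UpRotation-⊑ ρ in Y , Z , X , i , ⊑-right s , ⊑-right s′

-- The left subtree `Y` of `j` becomes a part of the new one, which also has the former parent `i`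
-- and its left subtree `X`.
UpRotation-left-size : ∀ {j T T′} → SearchTree T → SearchTree T′ → UpRotation j T T′ → size (L T j) < size (L T′ j)
UpRotation-left-size sT sT′ ρ with UpRotation-⊑ ρ
... | Y , _ , X , _ , s , s′ rewrite subtree-node sT s | subtree-node sT′ s′ = s≤s (m≤n+m (size Y) (size X))

up-slide-size : ∀ {j d T T′} → SearchTree T → Slide ↑ j d T T′ → size (L T j) + d ≤ size (L T′ j)
up-slide-size sT done = ≤-reflexive (+-identityʳ _)
up-slide-size {d = suc d} sT (ρ ◅ ρs) = ≤-trans (≤-reflexive (+-suc _ d))
  (≤-trans (+-monoˡ-≤ d (UpRotation-left-size sT (UpRotation-SearchTree ρ sT) ρ)) (up-slide-size (UpRotation-SearchTree ρ sT) ρs))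

down-slide-size : ∀ {j d T T′} → SearchTree T → Slide ↓ j d T T′ → size (L T′ j) + d ≤ size (L T j)
down-slide-size sT done = ≤-reflexive (+-identityʳ _)
down-slide-size {d = suc d} sT (ρ ◅ ρs) = ≤-trans (≤-reflexive (+-suc _ d))
  (≤-trans (s≤s (down-slide-size (DownRotation-SearchTree ρ sT) ρs)) (UpRotation-left-size (DownRotation-SearchTree ρ sT) sT ρ))

slide-length : ∀ {δ j d T T′} → SearchTree T → Slide δ j d T T′ → d ≤ size T
slide-length {↑} {j} {d} {T} {T′} sT ρs = ≤-trans (m≤n+m d _) (≤-trans (up-slide-size sT ρs)
  (≤-trans (size-⊑ (L-⊑ T′ j)) (≤-reflexive (sym (size-resp {T} (Slide-vertices ρs))))))
slide-length {↓} {j} {d} {T} sT ρs = ≤-trans (m≤n+m d _) (≤-trans (down-slide-size sT ρs) (size-⊑ (L-⊑ T j)))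

-- Setting `#bad` to 1 forces the first rotation, since a slide has at least one step even though it
-- starts in the language.
slide-loop slide-by : Program
slide-loop = while (var #bad) (rotate ⨾ check)
slide-by   = set #bad (lit 1) ⨾ slide-loop

slide-spares : ℕ → Bool
slide-spares a = (a <ᵇ 14) ∧ (not (a ≡ᵇ #T-left) ∧ not (a ≡ᵇ #T-right))

rotate-spares-input : ∀ a → (a <ᵇ 7) ≡ true → rotate-spares a ≡ true
rotate-spares-input 0 _ = refl
rotate-spares-input 1 _ = refl
rotate-spares-input 2 _ = refl
rotate-spares-input 3 _ = refl
rotate-spares-input 4 _ = refl
rotate-spares-input 5 _ = refl
rotate-spares-input 6 _ = refl
rotate-spares-input (suc (suc (suc (suc (suc (suc (suc _))))))) ()

slide-spares-input : ∀ a → (a <ᵇ 7) ≡ true → slide-spares a ≡ true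
slide-spares-input 0 _ = refl
slide-spares-input 1 _ = refl
slide-spares-input 2 _ = refl
slide-spares-input 3 _ = refl
slide-spares-input 4 _ = refl
slide-spares-input 5 _ = refl
slide-spares-input 6 _ = refl
slide-spares-input (suc (suc (suc (suc (suc (suc (suc _))))))) ()

record InputCells (n : ℕ) (ps : List Pattern) (μ : Memory) : Set where
  field
    n-cell   : μ #n 0 0 ≡ n
    ℓ-cell   : μ #ℓ 0 0 ≡ length ps
    patterns : PatternsAt μ 0 ps

InputCells-Keeps : ∀ {S n ps μ μ′} → (∀ a → (a <ᵇ 7) ≡ true → S a ≡ true) → Keeps S μ μ′ →
  InputCells n ps μ → InputCells n ps μ′
InputCells-Keeps {S} {ps = ps} S⊇ K I = record
  { n-cell   = trans (K #n (S⊇ #n refl) 0 0) n-cell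
  ; ℓ-cell   = trans (K #ℓ (S⊇ #ℓ refl) 0 0) ℓ-cell
  ; patterns = PatternsAt-Keeps {S} S⊇ K 0 ps patterns
  }
  where open InputCells I

module _ {n : ℕ} {ps : List Pattern} (1≤n : 1 ≤ n) (Fs : All Friendly ps) (1≤S : 1 ≤ sumOfSquares ps) where

  private N = n * sumOfSquares ps

  1≤N : 1 ≤ N
  1≤N = *-mono-≤ 1≤n 1≤S

  n≤N : n ≤ N
  n≤N = subst (_≤ N) (*-identityʳ n) (*-monoʳ-≤ n 1≤S)

  -- The test of `#bad`, the rotation and the check add up to 600 N + 38 n + 126. Both n and 1 are
  -- at most N, as the sum of squares is positive, and 764 = 600 + 38 + 126.
  rotation-cost : 4 + (n * 38 + 106 + (600 * N + 16)) ≤ 764 * N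
  rotation-cost = begin
    4 + (n * 38 + 106 + (600 * N + 16)) ≡⟨ solve 2 (λ a b → con 4 :+ (a :+ con 106 :+ (b :+ con 16)) := b :+ a :+ con 126) refl (n * 38) (600 * N) ⟩
    600 * N + n * 38 + 126 ≤⟨ +-mono-≤ (+-monoʳ-≤ (600 * N) (*-monoˡ-≤ 38 n≤N)) (*-monoʳ-≤ 126 1≤N) ⟩
    600 * N + N * 38 + 126 * N ≡⟨ solve 1 (λ a → con 600 :* a :+ a :* con 38 :+ con 126 :* a := con 764 :* a) refl N ⟩
    764 * N ∎
    where open ≤-Reasoning

  -- Minimality keeps the loop running at all intermediate trees, and membership of the last tree
  -- stops it there.
  slide-loop-correct : ∀ {δ j d T T′ μ} → T ∈𝒯 n → size T ≡ n → Slide δ j (suc d) T T′ → 𝒯 n ps T′ →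
    (∀ d′ T″ → 1 ≤ d′ → d′ < suc d → Slide δ j d′ T T″ → ¬ 𝒯 n ps T″) →
    InputCells n ps μ → Stored μ (top (suc n) T) → μ #j 0 0 ≡ j → μ #d 0 0 ≡ direction δ → μ #bad 0 0 ≢ 0 →
    Within slide-loop (suc d * (764 * N) + 4) μ (λ μ′ → Stored μ′ (top (suc n) T′))
  slide-loop-correct {δ} {j} {d} {T} {T′} {μ} T∈ size≡ (_◅_ {T′ = U} ρ ρs) T′∈ minimal I st j≡ d≡ bad≢0 =
    weaken bound id (loop-rule {R = Checked} bad≢0
      (rotate-correct δ (proj₁ (insert-∈𝒯 0 T∈)) ρ st n-cell j≡ d≡ ⨾-rule λ {μ₁} (st₁ , K₁) →
       weaken ≤-refl (λ (verdict , K₂) → record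
           { sound    = proj₁ verdict
           ; complete = proj₂ verdict
           ; input    = InputCells-Keeps {check-spares} (<ᵇ-weaken (m≤m+n 7 7)) K₂ (InputCells-Keeps {rotate-spares} rotate-spares-input K₁ I)
           ; stored   = Stored-Keeps {check-spares} (top (suc n) U) refl refl K₂ st₁
           ; j-cell   = trans (K₂ #j refl 0 0) (trans (K₁ #j refl 0 0) j≡)
           ; d-cell   = trans (K₂ #d refl 0 0) (trans (K₁ #d refl 0 0) d≡) })
         (check-correct 1≤n U∈ sizeU ps Fs (PatternsAt-Keeps {rotate-spares} rotate-spares-input K₁ 0 ps patterns)
           (trans (K₁ #ℓ refl 0 0) ℓ-cell) (trans (K₁ #n refl 0 0) n-cell) st₁))
      (continue ρs minimal))
    where
    open InputCells I
    U∈ : U ∈𝒯 n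
    U∈ = ∈𝒯-resp (Rotation-vertices δ ρ) (Rotation-SearchTree δ ρ (proj₁ T∈)) T∈
    sizeU : size U ≡ n
    sizeU = trans (sym (size-resp {T} (Rotation-vertices δ ρ))) size≡
    record Checked (μ : Memory) : Set where
      field
        sound    : μ #bad 0 0 ≡ 0 → 𝒯 n ps U
        complete : 𝒯 n ps U → μ #bad 0 0 ≡ 0
        input    : InputCells n ps μ
        stored   : Stored μ (top (suc n) U)
        j-cell   : μ #j 0 0 ≡ j
        d-cell   : μ #d 0 0 ≡ direction δ
    continue : ∀ {d μ₂} → Slide δ j d U T′ →
      (∀ d′ T″ → 1 ≤ d′ → d′ < suc d → Slide δ j d′ T T″ → ¬ 𝒯 n ps T″) → Checked μ₂ →
      Within slide-loop (d * (764 * N) + 4) μ₂ (λ μ′ → Stored μ′ (top (suc n) T′))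
    continue done minimal C = exit-rule (Checked.complete C T′∈) (Checked.stored C)
    continue {suc d} ρs@(_ ◅ _) minimal C = slide-loop-correct U∈ sizeU ρs T′∈
      (λ d′ T″ 1≤d′ d′<d πs → minimal (suc d′) T″ (s≤s z≤n) (s≤s d′<d) (ρ ◅ πs))
      (Checked.input C) (Checked.stored C) (Checked.j-cell C) (Checked.d-cell C)
      (λ bad≡0 → minimal 1 U ≤-refl (s≤s (s≤s z≤n)) (ρ ◅ done) (Checked.sound C bad≡0))
    bound : 4 + (size T * 38 + 106 + (600 * N + 16)) + (d * (764 * N) + 4) ≤ suc d * (764 * N) + 4
    bound = subst (λ s → 4 + (s * 38 + 106 + (600 * N + 16)) + (d * (764 * N) + 4) ≤ suc d * (764 * N) + 4) (sym size≡)
      (≤-trans (+-monoˡ-≤ (d * (764 * N) + 4) rotation-cost) (≤-reflexive (sym (+-assoc (764 * N) (d * (764 * N)) 4))))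

  slide-by-correct : ∀ {δ j T T′ μ} → T ∈𝒯 n → size T ≡ n → MinimalSlide (𝒯 n ps) δ j T T′ →
    InputCells n ps μ → Stored μ (top (suc n) T) → μ #j 0 0 ≡ j → μ #d 0 0 ≡ direction δ →
    Within slide-by (764 * (n * N) + 8) μ (λ μ′ → Stored μ′ (top (suc n) T′) × Keeps slide-spares μ μ′)
  slide-by-correct {δ} {j} {T} {T′} {μ} T∈ size≡ (suc d , _ , ρs , T′∈ , minimal) I st j≡ d≡ =
    frame slide-spares {Q = λ μ′ → Stored μ′ (top (suc n) T′)} refl
    (weaken bound id (assign-then {i = lit 0} {lit 0} {lit 1} (slide-loop-correct T∈ size≡ ρs T′∈ minimal
      (InputCells-Keeps {slide-spares} slide-spares-input
        (spared slide-spares {c = set #bad (lit 1)} {config μ 0 []} refl assign) I)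
      (Stored-frame {μ} (top (suc n) T) (λ _ → refl , refl) st) j≡ d≡ (λ ()))))
    where
    open ≤-Reasoning
    bound : 4 + (suc d * (764 * N) + 4) ≤ 764 * (n * N) + 8
    bound = begin
      4 + (suc d * (764 * N) + 4) ≤⟨ +-monoʳ-≤ 4 (+-monoˡ-≤ 4 (*-monoˡ-≤ (764 * N) (subst (suc d ≤_) size≡ (slide-length (proj₁ T∈) ρs)))) ⟩
      4 + (n * (764 * N) + 4) ≡⟨ solve 2 (λ a b → con 4 :+ (a :* (con 764 :* b) :+ con 4) := con 764 :* (a :* b) :+ con 8) refl n N ⟩
      764 * (n * N) + 8 ∎

-- One iteration of Algorithm H

skip-rule : ∀ {μ Q} → Q μ → Within skip 1 μ Q
skip-rule q = within _ (λ _ _ → skip) ≤-refl q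

-- The parent found inside the last rotation is out of date once that rotation has been carried out,
-- so `find` is run again before the test for a turn.
test-turn prepare turn-around work main-loop : Program
test-turn   = ifnz (var #d) (set #y (leftOf (var #j) equals lit 0)) (set #y (var #j less var #p))
prepare     = set #j (read #s (var #n) (lit 0)) ⨾ (set #d (read #o (var #j) (lit 0)) ⨾ (slide-by ⨾
              (assign #s (var #n) (lit 0) (var #n) ⨾ (find ⨾ test-turn))))
turn-around = assign #o (var #j) (lit 0) (lit 1 ⊖ var #d) ⨾
              (assign #s (var #j) (lit 0) (read #s (var #j ⊖ lit 1) (lit 0)) ⨾
               assign #s (var #j ⊖ lit 1) (lit 0) (var #j ⊖ lit 1))
work        = prepare ⨾ (ifnz (var #y) turn-around skip ⨾ set #T-root (leftOf (var #n ⊕ lit 1)))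
main-loop   = while (lit 1 less read #s (var #n) (lit 0)) (work ⨾ visit)

write-update : ∀ {A : Set} (f : A → ℕ) (g : ℕ → A) μ a i {v w} i′ → μ a i′ 0 ≡ f (g i′) → v ≡ f w →
  write μ a i 0 v a i′ 0 ≡ f ((g [ i ↦ w ]) i′)
write-update f g μ a i i′ old new rewrite ≡ᵇ-refl a with i′ ≡ᵇ i
... | true  = new
... | false = old

record Cells (n : ℕ) (ps : List Pattern) (T : Tree) (o : ℕ → Direction) (s : ℕ → ℕ) (μ : Memory) : Set where
  field
    input  : InputCells n ps μ
    stored : Stored μ (top (suc n) T)
    o-cell : ∀ i → i ∈[ n ] → μ #o i 0 ≡ direction (o i)
    s-cell : ∀ i → i ∈[ n ] → μ #s i 0 ≡ s i

Cells⇒Represents : ∀ {n ps T o s μ} → T ∈𝒯 n → Cells n ps T o s μ → μ #T-root 0 0 ≡ pointer (root T) →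
  Represents n μ ⟨ T , o , s ⟩
Cells⇒Represents {n} {ps} {T} {o} {s} {μ} T∈ C root≡ = record
  { T-root  = root≡
  ; T-left  = λ i i∈ → let l , r , p = ∈⇒⊑ (label⇒∈ T∈ i∈) in
      trans (proj₁ (Stored-⊑ p stT)) (cong pointer (sym (cL-node (proj₁ T∈) p)))
  ; T-right = λ i i∈ → let l , r , p = ∈⇒⊑ (label⇒∈ T∈ i∈) in
      trans (proj₁ (proj₂ (Stored-⊑ p stT))) (cong pointer (sym (cR-node (proj₁ T∈) p)))
  ; o-cell  = o-cell
  ; s-cell  = s-cell
  }
  where
  open Cells C
  stT : Stored μ T
  stT = proj₁ (proj₂ (proj₂ stored))

module _ {n : ℕ} {ps : List Pattern} (1≤n : 1 ≤ n) (Fs : All Friendly ps) (1≤S : 1 ≤ sumOfSquares ps) where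

  private
    N = n * sumOfSquares ps
    𝓛 = 𝒯 n ps

  open AlgorithmH 𝓛 n using (Turn; turn-s; Step; turn; keep; RunFrom)

  record Prepared (T : Tree) (o : ℕ → Direction) (s : ℕ → ℕ) (j : ℕ) (μ : Memory) : Set where
    field
      cells  : Cells n ps T o (s [ n ↦ n ]) μ
      j-cell : μ #j 0 0 ≡ j
      d-cell : μ #d 0 0 ≡ direction (o j)
      turns  : μ #y 0 0 ≢ 0 → Turn (o j) j T
      keeps  : μ #y 0 0 ≡ 0 → ¬ Turn (o j) j T

  module _ {T T′ : Tree} {o : ℕ → Direction} {s : ℕ → ℕ} (T∈ : T ∈𝒯 n) (size≡ : size T ≡ n)
    (ms : MinimalSlide 𝓛 (o (s n)) (s n) T T′) where

    private
      j = s n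
      δ = o j
      ρs = proj₁ (proj₂ (proj₂ ms))

    slid-∈𝒯 : T′ ∈𝒯 n
    slid-∈𝒯 = ∈𝒯-resp (Slide-vertices ρs) (Slide-SearchTree ρs (proj₁ T∈)) T∈

    slid-size : size T′ ≡ n
    slid-size = trans (sym (size-resp {T} (Slide-vertices ρs))) size≡

    slid-label : j ∈[ n ]
    slid-label = ∈⇒label T∈ (MinimalSlide-∈ {𝓛} {δ} ms)

    private
      j∈T′ : j ∈ᵗ T′
      j∈T′ = label⇒∈ slid-∈𝒯 slid-label

    test-turn-correct : ∀ {μ q} → InputCells n ps μ → Stored μ (top (suc n) T′) → μ #j 0 0 ≡ j → μ #d 0 0 ≡ direction δ →
      (μ #q 0 0 , μ #p 0 0) ≡ ancestors (top (suc n) T′) j q 0 →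
      Within test-turn 14 μ (λ μ′ → ((μ′ #y 0 0 ≢ 0 → Turn δ j T′) × (μ′ #y 0 0 ≡ 0 → ¬ Turn δ j T′)) × Keeps find-spares μ μ′)
    test-turn-correct {μ} {q} I st j≡ d≡ anc = frame find-spares
      {Q = λ μ′ → (μ′ #y 0 0 ≢ 0 → Turn δ j T′) × (μ′ #y 0 0 ≡ 0 → ¬ Turn δ j T′)} refl (go δ d≡)
      where
      go : ∀ δ → μ #d 0 0 ≡ direction δ →
        Within test-turn 14 μ (λ μ′ → (μ′ #y 0 0 ≢ 0 → Turn δ j T′) × (μ′ #y 0 0 ≡ 0 → ¬ Turn δ j T′))
      go ↑ d≡ = if-no-rule d≡ (assign-rule
        ((λ neq → parent>⇒Turn {𝓛} {q = q} {0} slid-∈𝒯 j∈T′ (subst₂ _<_ j≡ (cong proj₂ anc) (bit-≢0 neq))) ,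
         (λ eq t → bit-≡0 eq (subst₂ _<_ (sym j≡) (sym (cong proj₂ anc)) (Turn⇒parent> {𝓛} {q = q} {0} slid-∈𝒯 j∈T′ t)))))
      go ↓ d≡ = if-yes-rule (λ eq → case trans (sym d≡) eq of λ ()) (assign-rule
        ((λ neq → none (zero-pointer (λ ≢0 → neq (cong bit (trans (cong (_≡ᵇ 0) left≡) (≢⇒≡ᵇ ≢0)))))) ,
         (λ eq t → case trans (sym (cong bit (trans (cong (_≡ᵇ 0) left≡) (cong (λ m → pointer m ≡ᵇ 0) t)))) eq of λ ())))
        where
        left≡ : μ #T-left (μ #j 0 0) 0 ≡ pointer (cL T′ j)
        left≡ with ∈⇒⊑ j∈T′
        ... | l , r , p = trans (cong (λ i → μ #T-left i 0) j≡)
          (trans (proj₁ (Stored-⊑ p (proj₁ (proj₂ (proj₂ st))))) (cong pointer (sym (cL-node (proj₁ slid-∈𝒯) p))))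
        zero-pointer : ¬ pointer (cL T′ j) ≢ 0 → pointer (cL T′ j) ≡ 0
        zero-pointer ¬≢ with pointer (cL T′ j) ≟ 0
        ... | yes eq = eq
        ... | no neq = contradiction neq ¬≢
        none : pointer (cL T′ j) ≡ 0 → cL T′ j ≡ nothing
        none eq with cL T′ j in eqL
        ... | nothing = refl
        ... | just x  = contradiction (subst (_∈ᵗ T′) eq (∈-⊑ (L-⊑ T′ j) (root⇒∈ eqL))) (0∉ slid-∈𝒯)

    prepare-correct : ∀ {μ} → Cells n ps T o s μ →
      Within prepare (764 * (n * N) + 8 + (n * 38 + 98)) μ (Prepared T′ o s j)
    prepare-correct {μ} C = weaken (≤-reflexive bound) id
      (assign-then {i = lit 0} {lit 0} {read #s (var #n) (lit 0)} (assign-then {i = lit 0} {lit 0} {read #o (var #j) (lit 0)}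
      (slide-by-correct 1≤n Fs 1≤S T∈ size≡ ms I₂ (Stored-frame {μ} (top (suc n) T) (λ _ → refl , refl) stored) j≡ d≡ ⨾-rule λ {μ₃} (st₃ , K₃) →
        assign-then {i = var #n} {lit 0} {var #n} (after-slide st₃ K₃))))
      where
      open Cells C
      open InputCells input
      μ₂ = write (write μ #j 0 0 (μ #s (μ #n 0 0) 0)) #d 0 0 (μ #o (μ #s (μ #n 0 0) 0) 0)
      I₂ : InputCells n ps μ₂
      I₂ = InputCells-Keeps {_<ᵇ 7} (λ _ → id)
        (spared (_<ᵇ 7) {c = set #j (read #s (var #n) (lit 0)) ⨾ set #d (read #o (var #j) (lit 0))} {config μ 0 []} refl (seq assign assign)) input
      j≡ : μ #s (μ #n 0 0) 0 ≡ j
      j≡ = trans (cong (λ i → μ #s i 0) n-cell) (s-cell n (1≤n , ≤-refl))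
      d≡ : μ #o (μ #s (μ #n 0 0) 0) 0 ≡ direction δ
      d≡ = trans (cong (λ i → μ #o i 0) j≡) (o-cell j slid-label)
      after-slide : ∀ {μ₃} → Stored μ₃ (top (suc n) T′) → Keeps slide-spares μ₂ μ₃ →
        Within (find ⨾ test-turn) (size T′ * 38 + 60 + 14) (write μ₃ #s (μ₃ #n 0 0) 0 (μ₃ #n 0 0)) (Prepared T′ o s j)
      after-slide {μ₃} st₃ K₃ =
        find-correct (proj₁ (insert-∈𝒯 0 slid-∈𝒯)) j∈T′ st₄ (InputCells.n-cell I₄) j₄ ⨾-rule λ {μ₅} ((q , anc) , K₅) →
        weaken ≤-refl (λ (verdict , K₆) → let K₄₆ = Keeps-trans {find-spares} K₅ K₆ in record
            { cells  = record
              { input  = InputCells-Keeps {find-spares} (<ᵇ-weaken (m≤m+n 7 9)) K₄₆ I₄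
              ; stored = Stored-Keeps {find-spares} (top (suc n) T′) refl refl K₄₆ st₄
              ; o-cell = λ i i∈ → trans (K₄₆ #o refl i 0) (trans (K₃ #o refl i 0) (o-cell i i∈))
              ; s-cell = λ i i∈ → trans (K₄₆ #s refl i 0) (s₄ i i∈)
              }
            ; j-cell = trans (K₄₆ #j refl 0 0) j₄
            ; d-cell = trans (K₄₆ #d refl 0 0) d₄
            ; turns  = proj₁ verdict
            ; keeps  = proj₂ verdict
            })
          (test-turn-correct (InputCells-Keeps {find-spares} (<ᵇ-weaken (m≤m+n 7 9)) K₅ I₄)
            (Stored-Keeps {find-spares} (top (suc n) T′) refl refl K₅ st₄) (trans (K₅ #j refl 0 0) j₄)
            (trans (K₅ #d refl 0 0) d₄) anc)
        where
        μ₄ = write μ₃ #s (μ₃ #n 0 0) 0 (μ₃ #n 0 0)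
        I₃ : InputCells n ps μ₃
        I₃ = InputCells-Keeps {slide-spares} slide-spares-input K₃ I₂
        I₄ : InputCells n ps μ₄
        I₄ = InputCells-Keeps {_<ᵇ 7} (λ _ → id)
          (spared (_<ᵇ 7) {c = assign #s (var #n) (lit 0) (var #n)} {config μ₃ 0 []} refl assign) I₃
        st₄ : Stored μ₄ (top (suc n) T′)
        st₄ = Stored-frame {μ₃} (top (suc n) T′) (λ _ → refl , refl) st₃
        j₄ : μ₃ #j 0 0 ≡ j
        j₄ = trans (K₃ #j refl 0 0) j≡
        d₄ : μ₃ #d 0 0 ≡ direction δ
        d₄ = trans (K₃ #d refl 0 0) d≡
        s₄ : ∀ i → i ∈[ n ] → μ₄ #s i 0 ≡ (s [ n ↦ n ]) i
        s₄ i i∈ rewrite InputCells.n-cell I₃ = write-update id s μ₃ #s n i (trans (K₃ #s refl i 0) (s-cell i i∈)) refl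
      bound : 16 + (764 * (n * N) + 8 + (8 + (size T′ * 38 + 60 + 14))) ≡ 764 * (n * N) + 8 + (n * 38 + 98)
      bound rewrite slid-size = solve 2 (λ a b → con 16 :+ (a :+ con 8 :+ (con 8 :+ (b :+ con 60 :+ con 14))) := a :+ con 8 :+ (b :+ con 98))
        refl (764 * (n * N)) (n * 38)

    store-root : ∀ {o′ s′ μ} → Cells n ps T′ o′ s′ μ →
      Within (set #T-root (leftOf (var #n ⊕ lit 1))) 10 μ (λ μ′ → Cells n ps T′ o′ s′ μ′ × μ′ #T-root 0 0 ≡ pointer (root T′))
    store-root {μ = μ} C = weaken ≤-refl (λ { (refl , K′) → record
        { input  = InputCells-Keeps {_<ᵇ 7} (λ _ → id) K′ input
        ; stored = Stored-frame {μ} (top (suc n) T′) (λ _ → refl , refl) stored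
        ; o-cell = o-cell
        ; s-cell = s-cell
        } , trans (cong (λ i → μ #T-left i 0) (trans (cong (_+ 1) n-cell) (+-comm n 1))) (proj₁ stored) })
      (frame (_<ᵇ 7) {Q = _≡ write μ #T-root 0 0 (μ #T-left (μ #n 0 0 + 1) 0)} refl (assign-rule refl))
      where
      open Cells C
      open InputCells input

    turn-around-correct : ∀ {μ} → j ≢ 1 → Prepared T′ o s j μ →
      Within turn-around 34 μ (Cells n ps T′ (o [ j ↦ opposite δ ]) (turn-s j (s [ n ↦ n ])))
    turn-around-correct {μ} j≢1 Pr = weaken ≤-refl (λ { (refl , K′) → record
        { input  = InputCells-Keeps {_<ᵇ 7} (λ _ → id) K′ input
        ; stored = Stored-frame {μ} (top (suc n) T′) (λ _ → refl , refl) stored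
        ; o-cell = o₁
        ; s-cell = s₁
        } })
      (frame (_<ᵇ 7) {Q = _≡ ν} refl (assign-then (assign-then (assign-rule refl))))
      where
      open Prepared Pr
      open Cells cells
      J = μ #j 0 0
      ν₁ = write μ #o J 0 (1 ∸ μ #d 0 0)
      ν₂ = write ν₁ #s J 0 (μ #s (J ∸ 1) 0)
      ν = write ν₂ #s (J ∸ 1) 0 (J ∸ 1)
      1∸ : ∀ δ → 1 ∸ direction δ ≡ direction (opposite δ)
      1∸ ↑ = refl
      1∸ ↓ = refl
      j-1∈ : (j ∸ 1) ∈[ n ]
      j-1∈ = m<n⇒0<n∸m (≤∧≢⇒< (proj₁ slid-label) (j≢1 ∘ sym)) , ≤-trans (m∸n≤m j 1) (proj₂ slid-label)
      o₁ : ∀ i → i ∈[ n ] → ν #o i 0 ≡ direction ((o [ j ↦ opposite δ ]) i)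
      o₁ i i∈ rewrite j-cell = write-update direction o μ #o j i (o-cell i i∈) (trans (cong (1 ∸_) d-cell) (1∸ δ))
      s₁ : ∀ i → i ∈[ n ] → ν #s i 0 ≡ turn-s j (s [ n ↦ n ]) i
      s₁ i i∈ rewrite j-cell = write-update id ((s [ n ↦ n ]) [ j ↦ (s [ n ↦ n ]) (j ∸ 1) ]) (write μ #s j 0 (μ #s (j ∸ 1) 0)) #s (j ∸ 1) i
        (write-update id (s [ n ↦ n ]) μ #s j i (s-cell i i∈) (s-cell (j ∸ 1) j-1∈)) refl

  work-cost : ℕ
  work-cost = 764 * (n * N) + 8 + (n * 38 + 98) + 48

  work-correct : ∀ {σ σ′ μ} → tree σ ∈𝒯 n → size (tree σ) ≡ n → Step σ σ′ → Cells n ps (tree σ) (o σ) (s σ) μ →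
    Within work work-cost μ (λ μ′ → Cells n ps (tree σ′) (o σ′) (s σ′) μ′ × μ′ #T-root 0 0 ≡ pointer (root (tree σ′)))
  work-correct {σ} T∈ size≡ (turn j≢1 ms t) C = prepare-correct {o = o σ} {s σ} T∈ size≡ ms C ⨾-rule λ Pr →
    if-yes-rule (λ y≡0 → Prepared.keeps Pr y≡0 t) (turn-around-correct {o = o σ} {s σ} T∈ size≡ ms j≢1 Pr) ⨾-rule λ C′ → store-root {o = o σ} {s σ} T∈ size≡ ms C′
  -- Without a turn the last part takes 5 + 10 operations instead of 38 + 10; the 33 make up the
  -- difference.
  work-correct {σ} T∈ size≡ (keep j≢1 ms ¬t) C = weaken (+-monoʳ-≤ (764 * (n * N) + 8 + (n * 38 + 98)) (m≤m+n 15 33)) id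
    (prepare-correct {o = o σ} {s σ} T∈ size≡ ms C ⨾-rule λ {μ} Pr →
    if-no-rule {Q = Cells n ps _ (o σ) (s σ [ n ↦ n ])} (y≡0 ¬t Pr) (skip-rule (Prepared.cells Pr)) ⨾-rule λ C′ → store-root {o = o σ} {s σ} T∈ size≡ ms C′)
    where
    y≡0 : ∀ {μ T′} → ¬ Turn (o σ (s σ n)) (s σ n) T′ → Prepared T′ (o σ) (s σ) (s σ n) μ → μ #y 0 0 ≡ 0
    y≡0 {μ} ¬t Pr with μ #y 0 0 ≟ 0
    ... | yes eq = eq
    ... | no neq = contradiction (Prepared.turns Pr neq) ¬t

-- The complete program

init-cell init program : Program
init-cell = assign #T-left (var #x) (lit 0) (lit 0) ⨾ (assign #T-right (var #x) (lit 0) (var #x ⊕ lit 1) ⨾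
            (assign #o (var #x) (lit 0) (lit 0) ⨾ (assign #s (var #x) (lit 0) (var #x) ⨾ set #x (var #x ⊕ lit 1))))
init      = set #x (lit 1) ⨾ (while (var #x less (var #n ⊕ lit 1)) init-cell ⨾
            -- The loop has given n the right child n + 1; this is undone, and n + 1 becomes the
            -- virtual root with left child 1.
            (assign #T-right (var #n) (lit 0) (lit 0) ⨾ (assign #T-left (var #n ⊕ lit 1) (lit 0) (lit 1) ⨾
            (assign #T-right (var #n ⊕ lit 1) (lit 0) (lit 0) ⨾ set #T-root (lit 1)))))
program   = init ⨾ (visit ⨾ main-loop)

module Init {n : ℕ} {ps : List Pattern} {μ₀ : Memory} (1≤n : 1 ≤ n) (I : InputCells n ps μ₀) where
  open InputCells I

  record Inv (a : ℕ) (μ : Memory) : Set where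
    field
      counter : μ #x 0 0 ≡ a
      keeps   : Keeps (_<ᵇ 7) μ₀ μ
      lefts   : ∀ b → 1 ≤ b → b < a → μ #T-left b 0 ≡ 0
      rights  : ∀ b → 1 ≤ b → b < a → μ #T-right b 0 ≡ suc b
      o-cells : ∀ b → 1 ≤ b → b < a → μ #o b 0 ≡ 0
      s-cells : ∀ b → 1 ≤ b → b < a → μ #s b 0 ≡ b

  open Inv

  init-cell-correct : ∀ {a μ} → a ∈[ n ] → Inv a μ → Within init-cell 38 μ (Inv (suc a))
  init-cell-correct {a} {μ} _ J = weaken ≤-refl (λ { (refl , K) → record
      { counter = trans (+-comm X 1) (cong suc (counter J))
      ; keeps   = Keeps-trans {_<ᵇ 7} (keeps J) K
      ; lefts   = λ b 1≤b b≤a → extend (λ _ → 0) #T-left b b≤a (lefts J b 1≤b) refl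
      ; rights  = λ b 1≤b b≤a → extend suc #T-right b b≤a (rights J b 1≤b) (trans (+-comm X 1) (cong suc (counter J)))
      ; o-cells = λ b 1≤b b≤a → extend (λ _ → 0) #o b b≤a (o-cells J b 1≤b) refl
      ; s-cells = λ b 1≤b b≤a → extend id #s b b≤a (s-cells J b 1≤b) (counter J) } })
    (frame (_<ᵇ 7) {Q = _≡ ν} refl (assign-then (assign-then (assign-then (assign-then (assign-rule refl))))))
    where
    X = μ #x 0 0
    ν = write (write (write (write (write μ #T-left X 0 0) #T-right X 0 (X + 1)) #o X 0 0) #s X 0 X) #x 0 0 (X + 1)
    extend : ∀ (f : ℕ → ℕ) c {v} b → b < suc a → (b < a → μ c b 0 ≡ f b) → v ≡ f a → write μ c X 0 v c b 0 ≡ f b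
    extend f c {v} b (s≤s b≤a) old v≡ with m≤n⇒m<n∨m≡n b≤a
    ... | inj₁ b<a  = trans (write-≢ μ c X 0 v 0 (λ b≡X → <⇒≢ b<a (trans b≡X (counter J)))) (old b<a)
    ... | inj₂ refl = write-hit μ c X 0 v (sym (counter J)) refl v≡

  path-stored : ∀ {μ} → (∀ b → b ∈[ n ] → μ #T-left b 0 ≡ 0) → (∀ b → 1 ≤ b → b < n → μ #T-right b 0 ≡ suc b) →
    μ #T-right n 0 ≡ 0 → ∀ m a → 1 ≤ a → m + a ≡ suc n → Stored μ (rightPathFrom a m)
  path-stored l r r-n zero a 1≤a eq = tt
  path-stored l r r-n (suc zero) a 1≤a refl = l a (1≤a , ≤-refl) , r-n , tt , tt
  path-stored l r r-n (suc (suc m)) a 1≤a eq =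
    l a (1≤a , <⇒≤ a<n) , r a 1≤a a<n , tt , path-stored l r r-n (suc m) (suc a) (s≤s z≤n) (trans (cong suc (+-suc m a)) eq)
    where
    a<n : a < n
    a<n = ≤-pred (subst (suc (suc a) ≤_) eq (s≤s (s≤s (m≤n+m a m))))

  root-rightPath : pointer (root (rightPath n)) ≡ 1
  root-rightPath = go 1≤n
    where
    go : ∀ {n} → 1 ≤ n → pointer (root (rightPath n)) ≡ 1
    go {suc n} _ = refl

  init-correct : Within init (suc n * 48 + 30) μ₀ (λ μ →
    Cells n ps (rightPath n) (λ _ → ↑) (λ j → j) μ × μ #T-root 0 0 ≡ pointer (root (rightPath n)))
  init-correct = weaken (≤-reflexive (trans (cong (4 +_) (+-comm (suc n * 48) 26)) (+-comm 30 (suc n * 48)))) id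
    (assign-then {i = lit 0} {lit 0} {lit 1} (count-rule Inv counter (λ J → trans (keeps J #n refl 0 0) n-cell) init-cell-correct initial ⨾-rule λ {μ} J →
      weaken ≤-refl (λ { (refl , K) → finish J K }) (frame (_<ᵇ 7) {Q = _≡ ν μ} refl
        (assign-then (assign-then (assign-then (assign-rule refl)))))))
    where
    initial : Inv 1 (write μ₀ #x 0 0 1)
    initial = record
      { counter = refl
      ; keeps   = spared (_<ᵇ 7) {c = set #x (lit 1)} {config μ₀ 0 []} refl assign
      ; lefts   = λ b 1≤b b<1 → contradiction 1≤b (<⇒≱ b<1)
      ; rights  = λ b 1≤b b<1 → contradiction 1≤b (<⇒≱ b<1)
      ; o-cells = λ b 1≤b b<1 → contradiction 1≤b (<⇒≱ b<1)
      ; s-cells = λ b 1≤b b<1 → contradiction 1≤b (<⇒≱ b<1)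
      }
    ν : Memory → Memory
    ν μ = write (write (write (write μ #T-right M 0 0) #T-left (M + 1) 0 1) #T-right (M + 1) 0 0) #T-root 0 0 1
      where M = μ #n 0 0
    finish : ∀ {μ} → Inv (suc n) μ → Keeps (_<ᵇ 7) μ (ν μ) →
      Cells n ps (rightPath n) (λ _ → ↑) (λ j → j) (ν μ) × 1 ≡ pointer (root (rightPath n))
    finish {μ} J K = record
      { input  = InputCells-Keeps {_<ᵇ 7} (λ _ → id) (Keeps-trans {_<ᵇ 7} (keeps J) K) I
      ; stored = trans (write-hit μ₁ #T-left (M + 1) 0 1 (sym M+1) refl refl) (sym root-rightPath) ,
                 write-hit μ₂ #T-right (M + 1) 0 0 (sym M+1) refl refl ,
                 path-stored
                   (λ b b∈ → trans (write-≢ μ₁ #T-left (M + 1) 0 1 0 (≢M+1 b∈)) (lefts J b (proj₁ b∈) (s≤s (proj₂ b∈))))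
                   (λ b 1≤b b<n → trans (write-≢ μ₂ #T-right (M + 1) 0 0 0 (≢M+1 (1≤b , <⇒≤ b<n)))
                     (trans (write-≢ μ #T-right M 0 0 0 (λ b≡M → <⇒≢ b<n (trans b≡M M≡))) (rights J b 1≤b (m<n⇒m<1+n b<n))))
                   (trans (write-≢ μ₂ #T-right (M + 1) 0 0 0 (≢M+1 (1≤n , ≤-refl))) (write-hit μ #T-right M 0 0 (sym M≡) refl refl))
                   n 1 ≤-refl (+-comm n 1) , tt
      ; o-cell = λ b (1≤b , b≤n) → o-cells J b 1≤b (s≤s b≤n)
      ; s-cell = λ b (1≤b , b≤n) → s-cells J b 1≤b (s≤s b≤n)
      } , sym root-rightPath
      where
      M = μ #n 0 0
      μ₁ = write μ #T-right M 0 0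
      μ₂ = write μ₁ #T-left (M + 1) 0 1
      M≡ : M ≡ n
      M≡ = trans (keeps J #n refl 0 0) n-cell
      M+1 : M + 1 ≡ suc n
      M+1 = trans (cong (_+ 1) M≡) (+-comm n 1)
      ≢M+1 : ∀ {b} → b ∈[ n ] → b ≢ M + 1
      ≢M+1 (_ , b≤n) b≡ = <⇒≢ (s≤s b≤n) (trans b≡ M+1)

Input⇒InputCells : ∀ {n ps μ} → Input n ps μ → InputCells n ps μ
Input⇒InputCells {n} {ps} {μ} inp = record
  { n-cell = n-cell ; ℓ-cell = ℓ-cell
  ; patterns = go ps 0 λ t → record
      { k-cell = k-cell t ; P-root = P-root t ; P-left = P-left t ; P-right = P-right t ; P-e = P-e t } }
  where
  open Input inp
  go : ∀ qs off → (∀ (t : Fin (length qs)) → PatternAt μ (off + toℕ t) (lookup qs t)) → PatternsAt μ off qs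
  go []       off cells = tt
  go (q ∷ qs) off cells = subst (λ t → PatternAt μ t q) (+-identityʳ off) (cells zero) ,
    go qs (suc off) (λ t → subst (λ u → PatternAt μ u (lookup qs t)) (+-suc off (toℕ t)) (cells (suc t)))

module Costs {n : ℕ} {ps : List Pattern} (1≤n : 1 ≤ n) (Fs : All Friendly ps) (1≤S : 1 ≤ sumOfSquares ps) where

  open ≤-Reasoning

  bound : ℕ
  bound = 1000 * (n ^ 2 * sumOfSquares ps)

  N M : ℕ
  N = n * sumOfSquares ps
  M = n * N

  bound≡ : bound ≡ 1000 * M
  bound≡ = cong (1000 *_) (trans (cong (λ m → n * m * sumOfSquares ps) (*-identityʳ n)) (*-assoc n n (sumOfSquares ps)))

  1≤M : 1 ≤ M
  1≤M = *-mono-≤ 1≤n (1≤N 1≤n Fs 1≤S)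

  n≤M : n ≤ M
  n≤M = subst (_≤ M) (*-identityʳ n) (*-monoʳ-≤ n (1≤N 1≤n Fs 1≤S))

  -- The 9 covers the test of the main loop with 8 operations and the visit with 1. The total
  -- coefficient is 764 + 38 + 163 = 965, rounded up to 1000.
  work-bound : 9 + work-cost 1≤n Fs 1≤S ≤ bound
  work-bound = begin
    9 + (764 * M + 8 + (n * 38 + 98) + 48) ≡⟨ solve 2 (λ a b → con 9 :+ (a :+ con 8 :+ (b :+ con 98) :+ con 48) := a :+ b :+ con 163) refl (764 * M) (n * 38) ⟩
    764 * M + n * 38 + 163 ≤⟨ +-mono-≤ (+-monoʳ-≤ (764 * M) (*-monoˡ-≤ 38 n≤M)) (*-monoʳ-≤ 163 1≤M) ⟩
    764 * M + M * 38 + 163 * M ≡⟨ solve 1 (λ a → con 764 :* a :+ a :* con 38 :+ con 163 :* a := con 965 :* a) refl M ⟩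
    965 * M ≤⟨ *-monoˡ-≤ M (m≤m+n 965 35) ⟩
    1000 * M ≡⟨ bound≡ ⟨
    bound ∎

  init-bound : suc (suc n * 48 + 30) ≤ bound
  init-bound = begin
    suc (suc n * 48 + 30) ≡⟨ solve 1 (λ a → con 1 :+ ((con 48 :+ a) :+ con 30) := a :+ con 79) refl (n * 48) ⟩
    n * 48 + 79 ≤⟨ +-mono-≤ (*-monoˡ-≤ 48 n≤M) (*-monoʳ-≤ 79 1≤M) ⟩
    M * 48 + 79 * M ≡⟨ solve 1 (λ a → a :* con 48 :+ con 79 :* a := con 127 :* a) refl M ⟩
    127 * M ≤⟨ *-monoˡ-≤ M (m≤m+n 127 873) ⟩
    1000 * M ≡⟨ bound≡ ⟨
    bound ∎

module Execution {n : ℕ} {ps : List Pattern} (1≤n : 1 ≤ n) (Fs : All Friendly ps) (1≤S : 1 ≤ sumOfSquares ps)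
  (bound : ℕ) (work-bound : 9 + work-cost 1≤n Fs 1≤S ≤ bound) (init-bound : suc (suc n * 48 + 30) ≤ bound) where

  private 𝓛 = 𝒯 n ps

  open AlgorithmH 𝓛 n using (RunFrom; halt; _◅_; H1)

  halt-time : 8 ≤ bound
  halt-time = ≤-trans (m≤m+n 8 (1 + work-cost 1≤n Fs 1≤S)) work-bound

  visit-time : ∀ {t} → t ≤ work-cost 1≤n Fs 1≤S → suc (t + 8) ≤ bound
  visit-time {t} t≤ = ≤-trans (≤-trans (≤-reflexive (+-comm (suc t) 8)) (+-monoʳ-≤ 9 t≤)) work-bound

  Visits : List (ℕ × Memory) → List HState → Set
  Visits vs σs = Pointwise (λ v σ → Represents n (proj₂ v) σ) vs σs × All (λ v → proj₁ v ≤ bound) vs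

  -- Starts just after the visit of `σ`, with the clock at 0. So the new log entries match the
  -- states after `σ` only.
  main-loop-correct : ∀ {σ σs μ ℓ} → RunFrom σ σs → tree σ ∈𝒯 n → size (tree σ) ≡ n →
    Cells n ps (tree σ) (o σ) (s σ) μ → ∃₂ λ κ vs → ∃ λ σs′ → σs ≡ σ ∷ σs′ ×
      main-loop / config μ 0 ℓ ⇓ κ × log κ ≡ ℓ ++ vs × Visits vs σs′ × clock κ ≤ bound
  main-loop-correct {σ} {μ = μ} {ℓ} (halt s≡1) T∈ size≡ C =
    config μ 8 ℓ , [] , [] , refl , exit halted , sym (++-identityʳ ℓ) , ([] , []) ,
    halt-time
    where
    open Cells C
    open InputCells input
    halted : bit (1 <ᵇ μ #s (μ #n 0 0) 0) ≡ 0
    halted = cong (λ v → bit (1 <ᵇ v)) (trans (cong (λ i → μ #s i 0) n-cell) (trans (s-cell n (1≤n , ≤-refl)) s≡1))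
  main-loop-correct {σ} {μ = μ} {ℓ} (_◅_ {σ′ = σ′} st run) T∈ size≡ C =
    go (work-correct 1≤n Fs 1≤S T∈ size≡ st C)
    where
    open Cells C
    open InputCells input
    ms = Joint.Step-minimal 𝓛 n st
    j∈ : s σ n ∈[ n ]
    j∈ = slid-label 1≤n Fs 1≤S {o = o σ} {s σ} T∈ size≡ ms
    continue : bit (1 <ᵇ μ #s (μ #n 0 0) 0) ≢ 0
    continue eq = bit-≡0 eq (subst (1 <_) (sym (trans (cong (λ i → μ #s i 0) n-cell) (s-cell n (1≤n , ≤-refl))))
      (≤∧≢⇒< (proj₁ j∈) (λ 1≡j → Joint.Step-≢1 𝓛 n st (sym 1≡j))))
    go : Within work (work-cost 1≤n Fs 1≤S) μ (λ μ′ → Cells n ps (tree σ′) (o σ′) (s σ′) μ′ × μ′ #T-root 0 0 ≡ pointer (root (tree σ′))) →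
      ∃₂ λ κ vs → ∃ λ σs′ → σ ∷ _ ≡ σ ∷ σs′ ×
        main-loop / config μ 0 ℓ ⇓ κ × log κ ≡ ℓ ++ vs × Visits vs σs′ × clock κ ≤ bound
    go (within {μ′} t ex t≤ (C′ , root≡)) = conclude (main-loop-correct run T′∈ T′-size C′)
      where
      T′∈ : tree σ′ ∈𝒯 n
      T′∈ = slid-∈𝒯 1≤n Fs 1≤S {o = o σ} {s σ} T∈ size≡ ms
      T′-size : size (tree σ′) ≡ n
      T′-size = slid-size 1≤n Fs 1≤S {o = o σ} {s σ} T∈ size≡ ms
      v : ℕ × Memory
      v = suc (t + 8) , μ′
      conclude : ∀ {σs} → (∃₂ λ κ vs → ∃ λ σs′ → σs ≡ σ′ ∷ σs′ ×
          main-loop / config μ′ 0 (ℓ ∷ʳ v) ⇓ κ × log κ ≡ (ℓ ∷ʳ v) ++ vs × Visits vs σs′ × clock κ ≤ bound) →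
        ∃₂ λ κ vs → ∃ λ σs′ → σ ∷ σs ≡ σ ∷ σs′ ×
          main-loop / config μ 0 ℓ ⇓ κ × log κ ≡ ℓ ++ vs × Visits vs σs′ × clock κ ≤ bound
      conclude (κ , vs , σs′ , refl , rest , log≡ , (reps , times) , clock≤) =
        κ , v ∷ vs , σ′ ∷ σs′ , refl , loop continue (seq (ex 8 ℓ) visit) rest ,
        trans log≡ (++-assoc ℓ [ v ] vs) ,
        (Cells⇒Represents T′∈ C′ root≡ ∷ reps , visit-time t≤ ∷ times) , clock≤

  program-correct : ∀ {σs} → RunFrom H1 σs → rightPath n ∈𝒯 n → size (rightPath n) ≡ n →
    Executes program n ps σs bound
  program-correct {σs} run T∈ size≡ μ inp = go (Init.init-correct 1≤n (Input⇒InputCells inp))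
    where
    go : Within init (suc n * 48 + 30) μ (λ μ₁ →
           Cells n ps (rightPath n) (λ _ → ↑) (λ j → j) μ₁ × μ₁ #T-root 0 0 ≡ pointer (root (rightPath n))) →
         ∃ λ κ → program / start μ ⇓ κ × Pointwise (λ v σ → Represents n (proj₂ v) σ) (log κ) σs ×
                 All (λ v → proj₁ v ≤ bound) (log κ) × clock κ ≤ bound
    go (within {μ₁} t ex t≤ (C , root≡)) = conclude (main-loop-correct run T∈ size≡ C)
      where
      v : ℕ × Memory
      v = suc (t + 0) , μ₁
      conclude : (∃₂ λ κ vs → ∃ λ σs′ → σs ≡ H1 ∷ σs′ ×
          main-loop / config μ₁ 0 [ v ] ⇓ κ × log κ ≡ [ v ] ++ vs × Visits vs σs′ × clock κ ≤ bound) →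
        ∃ λ κ → program / start μ ⇓ κ × Pointwise (λ v σ → Represents n (proj₂ v) σ) (log κ) σs ×
                All (λ v → proj₁ v ≤ bound) (log κ) × clock κ ≤ bound
      conclude (κ , vs , σs′ , refl , rest , log≡ , (reps , times) , clock≤) =
        κ , seq (ex 0 []) (seq visit rest) ,
        subst (λ l → Pointwise (λ v σ → Represents n (proj₂ v) σ) l (H1 ∷ σs′)) (sym log≡) (Cells⇒Represents T∈ C root≡ ∷ reps) ,
        subst (All (λ v → proj₁ v ≤ bound)) (sym log≡)
          (≤-trans (s≤s (≤-trans (≤-reflexive (+-identityʳ t)) t≤)) init-bound ∷ times) ,
        clock≤

rightPath-size : ∀ a m → size (rightPathFrom a m) ≡ m
rightPath-size a zero    = refl
rightPath-size a (suc m) = cong suc (rightPath-size (suc a) m)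

-- For an empty list the time bound would be 0, which no program meets; a single pattern already
-- makes the sum positive and lets it absorb all constants.
1≤sumOfSquares : ∀ {ps} → ps ≢ [] → All Friendly ps → 1 ≤ sumOfSquares ps
1≤sumOfSquares ps≢[] []                        = contradiction refl ps≢[]
1≤sumOfSquares _     (_∷_ {p} {ps} F Fs) = ≤-trans (*-mono-≤ 1≤k (*-mono-≤ 1≤k ≤-refl)) (m≤m+n (k p ^ 2) (sumOfSquares ps))
  where
  1≤k : 1 ≤ k p
  1≤k = ≤-trans (n≤1+n 1) (Friendly⇒2≤k p F)

theorem10 : ∃ λ (program : Program) → ∃ λ (C : ℕ) →
    ∀ (n : ℕ) → 1 ≤ n → (ps : List Pattern) → All Friendly ps →
    ∃ λ (σs : List HState) →
    (∀ σs′ → AlgorithmH.Run (𝒯 n ps) n σs′ ⇔ σs′ ≡ σs) ×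
    Unique (map tree σs) ×
    (∀ T → T ∈ map tree σs ⇔ 𝒯 n ps T) ×
    (∀ Ts → AlgorithmS.Run (𝒯 n ps) (rightPath n) Ts ⇔ Ts ≡ map tree σs) ×
    (ps ≢ [] → Executes program n ps σs (C * (n ^ 2 * sumOfSquares ps)))
theorem10 = program , 1000 , λ { (suc n) 1≤n ps Fs →
  let open Joint (𝒯 (suc n) ps) (suc n)
      σs , run , cover = joint-run Fs n
      T₀∈ = 𝒯-rightPath Fs n
      sT₀ = proj₁ (proj₁ T₀∈)
  in σs ,
     (λ σs′ → mk⇔ (λ run′ → H-functional sT₀ run′ (Run⇒H run)) (λ { refl → Run⇒H run })) ,
     proj₁ (Run⇒fresh run (here refl)) ,
     (λ T → mk⇔ (All.lookup (Run⇒𝓛 T₀∈ run)) cover) ,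
     (λ Ts → mk⇔ (λ run′ → S-functional sT₀ run′ (Run⇒S run)) (λ { refl → Run⇒S run })) ,
     (λ ps≢[] → 
       let 1≤S = 1≤sumOfSquares ps≢[] Fs
           open Costs 1≤n Fs 1≤S
       in Execution.program-correct 1≤n Fs 1≤S bound work-bound init-bound (Run⇒H run) (proj₁ T₀∈) (rightPath-size 1 (suc n))) }
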